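{- Let $\Gamma$ be a connected leaf-free signed graph with $c(\Gamma)\geq 3$. Then $\eta(\Gamma)=2c(\Gamma)-1$ if and only if $\Gamma$ is a signed graph obtained from a signed tree $T$ with $p(T)=c(\Gamma)$ and $\eta(T)=p(T)-1$ by attaching a signed cycle with nullity $2$ at each leaf of $T$ (i.e., identifying each leaf of $T$ with a vertex of its own, pairwise disjoint, signed cycle of nullity $2$).
   Context: A signed graph $\Gamma=(G,\sigma)$ is a simple finite graph $G$ with a map $\sigma:E(G)\to\{+,-\}$; its adjacency matrix has entry $\sigma(v_iv_j)$ if $v_i\sim v_j$ and $0$ otherwise; $\eta(\Gamma)$ is the multiplicity of the eigenvalue $0$ of this matrix. $c(\Gamma)=|E(G)|-|V(G)|+\omega(G)$ with $\omega(G)$ the number of components. $p(\Gamma)$ is the number of vertices of degree one (leaves); leaf-free means $p(\Gamma)=0$. -}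

module Defs where

open import Data.Nat using (ℕ; zero; suc; _+_; _∸_; _≤_)
open import Data.Fin using (Fin; zero; suc; toℕ; _<?_)
open import Data.Bool using (Bool; true; false; if_then_else_; _∧_)
open import Data.Maybe using (Maybe; just; nothing; is-just)
open import Data.Sign using (Sign) renaming (+ to ⊕; - to ⊖)
open import Data.Rational using (ℚ; 0ℚ; 1ℚ; -_; _*_) renaming (_+_ to _+ℚ_)
open import Data.Product using (Σ; ∃; ∃-syntax; _×_; _,_)
open import Data.Sum using (_⊎_)
open import Relation.Nullary using (¬_; does)
open import Relation.Binary.PropositionalEquality using (_≡_)
open import Relation.Binary.Construct.Closure.ReflexiveTransitive using (Star)
open import Function.Bundles using (_⇔_)

-- Signed graphs on vertex set Fin n.
-- σ i j = nothing : no edge;  σ i j = just s : edge of sign s.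
-- Simple: symmetric and loopless.

record SignedGraph : Set where
  field
    size  : ℕ
    σ     : Fin size → Fin size → Maybe Sign
    sym   : ∀ i j → σ i j ≡ σ j i
    loopless : ∀ i → σ i i ≡ nothing
open SignedGraph public

∑ℕ : ∀ {n} → (Fin n → ℕ) → ℕ
∑ℕ {zero}  f = 0
∑ℕ {suc n} f = f zero + ∑ℕ (λ i → f (suc i))

∑ℚ : ∀ {n} → (Fin n → ℚ) → ℚ
∑ℚ {zero}  f = 0ℚ
∑ℚ {suc n} f = f zero +ℚ ∑ℚ (λ i → f (suc i))

[_] : Bool → ℕ
[ true ]  = 1
[ false ] = 0

Adj : (Γ : SignedGraph) → Fin (size Γ) → Fin (size Γ) → Set
Adj Γ u v = ∃[ s ] (σ Γ u v ≡ just s)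

deg : (Γ : SignedGraph) → Fin (size Γ) → ℕ
deg Γ i = ∑ℕ (λ j → [ is-just (σ Γ i j) ])

edgeCount : SignedGraph → ℕ
edgeCount Γ = ∑ℕ (λ i → ∑ℕ (λ j → [ does (i <? j) ∧ is-just (σ Γ i j) ]))

leafCount : SignedGraph → ℕ
leafCount Γ = ∑ℕ (λ i → [ does (deg Γ i Data.Nat.≟ 1) ])

Connected : SignedGraph → Set
Connected Γ = ∀ u v → Star (Adj Γ) u v

-- cyclomatic number c(Γ) = |E| - |V| + ω; used only for connected
-- graphs (ω = 1), where |E| + 1 ≥ |V| so truncated subtraction is exact.
cyc : SignedGraph → ℕ
cyc Γ = (edgeCount Γ + 1) ∸ size Γ

IsTree : SignedGraph → Set
IsTree T = Connected T × cyc T ≡ 0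

IsCycle : SignedGraph → Set
IsCycle C = 3 ≤ size C × Connected C × (∀ v → deg C v ≡ 2)

signVal : Maybe Sign → ℚ
signVal nothing  = 0ℚ
signVal (just ⊕) = 1ℚ
signVal (just ⊖) = - 1ℚ

A : (Γ : SignedGraph) → Fin (size Γ) → Fin (size Γ) → ℚ
A Γ i j = signVal (σ Γ i j)

InKernel : (Γ : SignedGraph) → (Fin (size Γ) → ℚ) → Set
InKernel Γ x = ∀ i → ∑ℚ (λ j → A Γ i j * x j) ≡ 0ℚ

LinIndep : ∀ {n k} → (Fin k → Fin n → ℚ) → Set
LinIndep {n} {k} v =
  ∀ (c : Fin k → ℚ) → (∀ j → ∑ℚ (λ i → c i * v i j) ≡ 0ℚ) → ∀ i → c i ≡ 0ℚ

HasNullity : SignedGraph → ℕ → Set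
HasNullity Γ k =
  (∃[ v ] ((∀ i → InKernel Γ (v i)) × LinIndep {size Γ} {k} v)) ×
  (∀ (w : Fin (suc k) → Fin (size Γ) → ℚ) →
     (∀ i → InKernel Γ (w i)) → ¬ LinIndep w)

-- Γ is obtained from a signed tree T by attaching, at each leaf of T,
-- its own signed cycle of nullity 2 (cycles pairwise disjoint).
-- Expressed by embeddings φ (of T) and ψ i (of the i-th cycle) into Γ,
-- whose images cover V(Γ), meet only at the identified vertices,
-- and whose edges are exactly the edges of Γ (with signs).

record TreeWithNullity2Cycles (Γ : SignedGraph) : Set where
  field
    T        : SignedGraph
    isTree   : IsTree T
    leaf     : Fin (leafCount T) → Fin (size T)
    leaf-inj : ∀ i j → leaf i ≡ leaf j → i ≡ j
    leaf-deg : ∀ i → deg T (leaf i) ≡ 1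
    C        : Fin (leafCount T) → SignedGraph
    C-cycle  : ∀ i → IsCycle (C i)
    C-null   : ∀ i → HasNullity (C i) 2
    att      : ∀ i → Fin (size (C i))
    φ        : Fin (size T) → Fin (size Γ)
    φ-inj    : ∀ a b → φ a ≡ φ b → a ≡ b
    ψ        : ∀ i → Fin (size (C i)) → Fin (size Γ)
    ψ-inj    : ∀ i a b → ψ i a ≡ ψ i b → a ≡ b
    glue     : ∀ i → ψ i (att i) ≡ φ (leaf i)
    TC-disj  : ∀ i a b → ψ i a ≡ φ b → a ≡ att i
    CC-disj  : ∀ i j a b → ψ i a ≡ ψ j b → i ≡ j
    cover    : ∀ v → (∃[ a ] (φ a ≡ v)) ⊎ (∃[ i ] ∃[ a ] (ψ i a ≡ v))
    edges    : ∀ u v s →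
      (σ Γ u v ≡ just s) ⇔
      ((∃[ a ] ∃[ b ] (φ a ≡ u × φ b ≡ v × σ T a b ≡ just s)) ⊎
       (∃[ i ] ∃[ a ] ∃[ b ] (ψ i a ≡ u × ψ i b ≡ v × σ (C i) a b ≡ just s)))

ObtainedFromTree : SignedGraph → Set
ObtainedFromTree Γ =
  Σ (TreeWithNullity2Cycles Γ) λ W →
    let T = TreeWithNullity2Cycles.T W in
    leafCount T ≡ cyc Γ × HasNullity T (leafCount T ∸ 1)

{-# OPTIONS --safe #-}

-- A cycle of nullity 2 has a kernel vector with value 1 at any given vertex. As the adjacency matrix
-- is symmetric, the kernel equation of the cycle at the attaching vertex therefore follows from the
-- other ones; so the kernel of Γ restricts onto the kernel of T, with one extra dimension for every
-- attached cycle, and η(Γ) = η(T) + p(T).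
--
-- Conversely, let D = Σ (deg v − 2) = 2 c(Γ) − 2, so that η(Γ) = D + 1. Suppose that kernel vectors are
-- determined on a vertex set S by k coordinates, and let out(v) be the number of neighbours of v outside
-- S. Adding vertices one by one, where v ∈ S with out(v) = 1 forces the value at its last neighbour, gives
-- η(Γ) ≤ k + Φ(S), where Φ(S) = Σ_{v ∈ S} (out(v) ∸ 1) + Σ_{v ∉ S} (deg v − 2). For a single vertex this
-- bound is D + 2, and it never increases when S grows. It drops whenever the new vertex meets S a second
-- time, unless a path of vertices of degree 2 returns to its own starting point v with out(v) = 2. By
-- assumption the bound may drop only once; as c(Γ) ≥ 3, this forces some path to return in that way, so
-- there is a pendant cycle. An exploration starting at it (where the bound is already D + 1) can only
-- build a tree with pendant cycles at its leaves. A pendant cycle whose nullity is not 2 would be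
-- determined by one coordinate, and the bound would drop again.

module Submission where

open import Defs hiding (sym)
open import Algebra.Structures using (IsCommutativeMonoid)
open import Data.Bool using (Bool; true; false; if_then_else_; _∧_; _∨_; not) renaming (_≟_ to _≟ᵇ_)
open import Data.Empty using (⊥; ⊥-elim)
open import Data.Fin using (Fin; zero; suc; punchIn; _≟_; _<?_; _↑ˡ_; _↑ʳ_; splitAt)
open import Data.List using (List; []; _∷_; length; lookup; tabulate)
open import Data.List.Membership.Propositional using (_∈_; _∉_)
open import Data.List.Membership.Propositional.Properties using (∈-tabulate⁺; ∈-lookup)
open import Data.List.Properties using (length-tabulate)
open import Data.List.Relation.Unary.All using ([]; _∷_) renaming (tabulate to tabulateAll; lookup to lookupAll)
open import Data.List.Relation.Unary.AllPairs using (AllPairs; []; _∷_)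
open import Data.List.Relation.Unary.Any using (here; there; index)
open import Data.List.Relation.Unary.Any.Properties using (lookup-index)
open import Data.Maybe using (Maybe; just; nothing; is-just)
open import Data.Nat using (ℕ; zero; suc; _+_; _*_; _∸_; _≤_; _<_; z≤n; s≤s; _≤?_) renaming (_≟_ to _≟ℕ_)
open import Data.Product using (Σ; ∃-syntax; _×_; _,_; proj₁; proj₂)
open import Data.Rational using (ℚ; 0ℚ; 1ℚ; 1/_; ≢-nonZero) renaming (_+_ to _+ℚ_; _*_ to _*ℚ_; -_ to -ℚ_)
open import Data.Sign using (Sign) renaming (+ to ⊕; - to ⊖)
open import Data.Sum using (_⊎_; inj₁; inj₂; [_,_]′)
open import Data.Unit using (⊤; tt)
open import Data.Vec.Functional using (insertAt)
open import Function.Base using (_∘_)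
open import Function.Bundles using (_⇔_; mk⇔; Equivalence)
open import Relation.Binary.Construct.Closure.ReflexiveTransitive using (Star; ε; _◅_; _◅◅_; reverse)
open import Relation.Binary.Definitions using (tri<; tri≈; tri>)
open import Relation.Binary.PropositionalEquality using (_≡_; _≢_; refl; cong; cong₂; subst; trans; module ≡-Reasoning; subst₂; sym)
open import Relation.Nullary using (¬_; Dec; yes; no; does)
open import Relation.Nullary.Decidable using (dec-true; dec-false; ¬?; toSum)
import Data.Fin.Properties as Fin
import Data.Nat.Properties as ℕ
import Data.Rational.Properties as ℚ
import Data.Rational.Solver as ℚ-Solver
import Data.Vec.Functional.Properties as Vecₚ

-- Finite sums

-- The delicate point is the truncation in out(v) ∸ 1: a vertex with out(v) = 1 already has weight
-- 0, so nothing is gained when its last outside neighbour enters S. Hence S is kept free of such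
-- vertices between steps: the path that one of them forces is followed until it enters a vertex of
-- degree at least 3 or returns to S. Then a second neighbour of a new vertex normally has out at
-- least 2, and its weight really falls. The exception is the start of the path, whose out has
-- fallen during the same step. Φ alone cannot tell whether anything remains to be explored, because
-- a cycle may close without a drop. A second potential Θ falls by 2 for every cycle that closes,
-- drop or not; it shows that the graph is not yet exhausted, and finally counts the pendant cycles.
-- Here c(Γ) ≥ 3 enters: for c(Γ) = 2 the all-positive K(2,3) and two all-positive 4-cycles sharing
-- a vertex have nullity 3 but are not of the described form; there D = 2, and Θ is 0 as soon as two
-- cycles have closed.

module Summation {X : Set} (_∙_ : X → X → X) (e : X)
  (isCM : IsCommutativeMonoid _≡_ _∙_ e)
  (∑ : ∀ {n} → (Fin n → X) → X)
  (∑-zero : ∀ (f : Fin 0 → X) → ∑ f ≡ e)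
  (∑-suc : ∀ {n} (f : Fin (suc n) → X) → ∑ f ≡ f zero ∙ ∑ (λ i → f (suc i)))
  where

  open IsCommutativeMonoid isCM using (identityˡ; identityʳ; assoc; comm)

  ∑-cong : ∀ {n} {f g : Fin n → X} → (∀ i → f i ≡ g i) → ∑ f ≡ ∑ g
  ∑-cong {zero} {f} {g} h = trans (∑-zero f) (sym (∑-zero g))
  ∑-cong {suc n} {f} {g} h =
    trans (∑-suc f) (trans (cong₂ _∙_ (h zero) (∑-cong (λ i → h (suc i)))) (sym (∑-suc g)))

  ∑-unit : ∀ {n} {f : Fin n → X} → (∀ i → f i ≡ e) → ∑ f ≡ e
  ∑-unit {zero} {f} h = ∑-zero f
  ∑-unit {suc n} {f} h =
    trans (∑-suc f) (trans (cong₂ _∙_ (h zero) (∑-unit (λ i → h (suc i)))) (identityˡ e))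

  interchange : ∀ a b c d → (a ∙ b) ∙ (c ∙ d) ≡ (a ∙ c) ∙ (b ∙ d)
  interchange a b c d = begin
    (a ∙ b) ∙ (c ∙ d) ≡⟨ assoc a b (c ∙ d) ⟩
    a ∙ (b ∙ (c ∙ d)) ≡⟨ cong (a ∙_) (sym (assoc b c d)) ⟩
    a ∙ ((b ∙ c) ∙ d) ≡⟨ cong (λ t → a ∙ (t ∙ d)) (comm b c) ⟩
    a ∙ ((c ∙ b) ∙ d) ≡⟨ cong (a ∙_) (assoc c b d) ⟩
    a ∙ (c ∙ (b ∙ d)) ≡⟨ sym (assoc a c (b ∙ d)) ⟩
    (a ∙ c) ∙ (b ∙ d) ∎
    where open ≡-Reasoning

  ∑-∙ : ∀ {n} (f g : Fin n → X) → ∑ (λ i → f i ∙ g i) ≡ ∑ f ∙ ∑ g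
  ∑-∙ {zero} f g =
    trans (∑-zero _) (sym (trans (cong₂ _∙_ (∑-zero f) (∑-zero g)) (identityˡ e)))
  ∑-∙ {suc n} f g = begin
    ∑ (λ i → f i ∙ g i)
      ≡⟨ ∑-suc _ ⟩
    (f zero ∙ g zero) ∙ ∑ (λ i → f (suc i) ∙ g (suc i))
      ≡⟨ cong ((f zero ∙ g zero) ∙_) (∑-∙ (λ i → f (suc i)) (λ i → g (suc i))) ⟩
    (f zero ∙ g zero) ∙ (∑ (λ i → f (suc i)) ∙ ∑ (λ i → g (suc i)))
      ≡⟨ interchange _ _ _ _ ⟩
    (f zero ∙ ∑ (λ i → f (suc i))) ∙ (g zero ∙ ∑ (λ i → g (suc i)))
      ≡⟨ cong₂ _∙_ (sym (∑-suc f)) (sym (∑-suc g)) ⟩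
    ∑ f ∙ ∑ g ∎
    where open ≡-Reasoning

  ∑-swap : ∀ {m n} (f : Fin m → Fin n → X) →
    ∑ (λ i → ∑ (λ j → f i j)) ≡ ∑ (λ j → ∑ (λ i → f i j))
  ∑-swap {zero} f = trans (∑-zero _) (sym (∑-unit (λ j → ∑-zero _)))
  ∑-swap {suc m} f = begin
    ∑ (λ i → ∑ (λ j → f i j))
      ≡⟨ ∑-suc _ ⟩
    ∑ (f zero) ∙ ∑ (λ i → ∑ (λ j → f (suc i) j))
      ≡⟨ cong (∑ (f zero) ∙_) (∑-swap (λ i → f (suc i))) ⟩
    ∑ (f zero) ∙ ∑ (λ j → ∑ (λ i → f (suc i) j))
      ≡⟨ sym (∑-∙ _ _) ⟩
    ∑ (λ j → f zero j ∙ ∑ (λ i → f (suc i) j))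
      ≡⟨ ∑-cong (λ j → sym (∑-suc (λ i → f i j))) ⟩
    ∑ (λ j → ∑ (λ i → f i j)) ∎
    where open ≡-Reasoning

  ∑-punchIn : ∀ {n} (f : Fin (suc n) → X) i → ∑ f ≡ f i ∙ ∑ (λ j → f (punchIn i j))
  ∑-punchIn f zero = ∑-suc f
  ∑-punchIn {suc n} f (suc i) = begin
    ∑ f
      ≡⟨ ∑-suc f ⟩
    f zero ∙ ∑ (λ j → f (suc j))
      ≡⟨ cong (f zero ∙_) (∑-punchIn (λ j → f (suc j)) i) ⟩
    f zero ∙ (f (suc i) ∙ R)
      ≡⟨ sym (assoc _ _ _) ⟩
    (f zero ∙ f (suc i)) ∙ R
      ≡⟨ cong (_∙ R) (comm _ _) ⟩
    (f (suc i) ∙ f zero) ∙ R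
      ≡⟨ assoc _ _ _ ⟩
    f (suc i) ∙ (f zero ∙ R)
      ≡⟨ cong (f (suc i) ∙_) (sym (∑-suc (λ j → f (punchIn (suc i) j)))) ⟩
    f (suc i) ∙ ∑ (λ j → f (punchIn (suc i) j)) ∎
    where
    open ≡-Reasoning
    R = ∑ (λ j → f (suc (punchIn i j)))

  ∑-single : ∀ {n} {f : Fin n → X} v → (∀ i → i ≢ v → f i ≡ e) → ∑ f ≡ f v
  ∑-single {suc n} {f} v h =
    trans (∑-punchIn f v)
      (trans (cong (f v ∙_) (∑-unit (λ j → h _ (Fin.punchInᵢ≢i v j)))) (identityʳ _))

  at : ∀ {n} → Fin n → X → Fin n → X
  at v c i = if does (i ≟ v) then c else e

  at-same : ∀ {n} (v : Fin n) c → at v c v ≡ c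
  at-same v c rewrite dec-true (v ≟ v) refl = refl

  at-other : ∀ {n} {v i : Fin n} c → i ≢ v → at v c i ≡ e
  at-other {v = v} {i} c ne rewrite dec-false (i ≟ v) ne = refl

  ∑-at : ∀ {n} (v : Fin n) c → ∑ (at v c) ≡ c
  ∑-at v c = trans (∑-single v (λ i → at-other c)) (at-same v c)

  ∑-pair : ∀ {n} {f : Fin n → X} {u v} → u ≢ v →
    (∀ i → i ≢ u → i ≢ v → f i ≡ e) → ∑ f ≡ f u ∙ f v
  ∑-pair {n} {f} {u} {v} u≢v h = begin
    ∑ f                                ≡⟨ ∑-cong split ⟩
    ∑ (λ i → at u (f u) i ∙ at v (f v) i) ≡⟨ ∑-∙ _ _ ⟩
    ∑ (at u (f u)) ∙ ∑ (at v (f v))       ≡⟨ cong₂ _∙_ (∑-at u _) (∑-at v _) ⟩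
    f u ∙ f v                          ∎
    where
    open ≡-Reasoning
    split : ∀ i → f i ≡ at u (f u) i ∙ at v (f v) i
    split i with i ≟ u | i ≟ v
    ... | yes refl | yes refl = ⊥-elim (u≢v refl)
    ... | yes refl | no _     = sym (identityʳ _)
    ... | no _     | yes refl = sym (identityˡ _)
    ... | no iu    | no iv    = trans (h i iu iv) (sym (identityˡ e))

  -- `g` is spread over the pairs (v, a) with φ a = v and the order of summation is exchanged;
  -- injectivity leaves at most one term in each row.
  ∑-reindex : ∀ {m n} (φ : Fin m → Fin n) → (∀ a b → φ a ≡ φ b → a ≡ b) →
    {g : Fin n → X} → (∀ v → (∀ a → φ a ≢ v) → g v ≡ e) → ∑ g ≡ ∑ (λ a → g (φ a))
  ∑-reindex {m} {n} φ inj {g} h = begin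
    ∑ g                     ≡⟨ ∑-cong (λ v → sym (row v)) ⟩
    ∑ (λ v → ∑ (λ a → F v a)) ≡⟨ ∑-swap F ⟩
    ∑ (λ a → ∑ (λ v → F v a)) ≡⟨ ∑-cong (λ a → ∑-at (φ a) (g (φ a))) ⟩
    ∑ (λ a → g (φ a))       ∎
    where
    open ≡-Reasoning
    F : Fin n → Fin m → X
    F v a = at (φ a) (g (φ a)) v
    row : ∀ v → ∑ (λ a → F v a) ≡ g v
    row v with Fin.any? (λ a → φ a ≟ v)
    ... | yes (a , refl) =
      trans (∑-single a (λ b b≢a → at-other _ (λ p → b≢a (sym (inj a b p))))) (at-same (φ a) _)
    ... | no none =
      trans (∑-unit (λ a → at-other _ (λ p → none (a , sym p))))
            (sym (h v (λ a p → none (a , p))))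

module ΣN = Summation _+_ 0 ℕ.+-0-isCommutativeMonoid ∑ℕ (λ _ → refl) (λ _ → refl)
module ΣQ = Summation _+ℚ_ 0ℚ ℚ.+-0-isCommutativeMonoid ∑ℚ (λ _ → refl) (λ _ → refl)

∑ℕ-mono : ∀ {n} {f g : Fin n → ℕ} → (∀ i → f i ≤ g i) → ∑ℕ f ≤ ∑ℕ g
∑ℕ-mono {zero} h = z≤n
∑ℕ-mono {suc n} h = ℕ.+-mono-≤ (h zero) (∑ℕ-mono (λ i → h (suc i)))

∑ℕ-mono-+ : ∀ {n} {f d g : Fin n → ℕ} → (∀ i → f i + d i ≤ g i) → ∑ℕ f + ∑ℕ d ≤ ∑ℕ g
∑ℕ-mono-+ {f = f} {d} h = ℕ.≤-trans (ℕ.≤-reflexive (sym (ΣN.∑-∙ f d))) (∑ℕ-mono h)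

∑ℕ-lower : ∀ {n} (f : Fin n → ℕ) v → f v ≤ ∑ℕ f
∑ℕ-lower f zero = ℕ.m≤m+n _ _
∑ℕ-lower f (suc v) = ℕ.≤-trans (∑ℕ-lower (λ i → f (suc i)) v) (ℕ.m≤n+m _ _)

*-distribˡ-∑ℚ : ∀ {n} c (f : Fin n → ℚ) → c *ℚ ∑ℚ f ≡ ∑ℚ (λ i → c *ℚ f i)
*-distribˡ-∑ℚ {zero} c f = ℚ.*-zeroʳ c
*-distribˡ-∑ℚ {suc n} c f =
  trans (ℚ.*-distribˡ-+ c _ _) (cong (c *ℚ f zero +ℚ_) (*-distribˡ-∑ℚ c (λ i → f (suc i))))

*-distribʳ-∑ℚ : ∀ {n} c (f : Fin n → ℚ) → ∑ℚ f *ℚ c ≡ ∑ℚ (λ i → f i *ℚ c)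
*-distribʳ-∑ℚ c f =
  trans (ℚ.*-comm _ c) (trans (*-distribˡ-∑ℚ c f) (ΣQ.∑-cong (λ i → ℚ.*-comm c (f i))))

-- Linear independence and coordinates

Vecℚ : ℕ → Set
Vecℚ n = Fin n → ℚ

record LinClosed {n} (K : Vecℚ n → Set) : Set where
  field
    closed : ∀ {x y} c → K x → K y → K (λ i → x i +ℚ c *ℚ y i)
open LinClosed public

*ℚ-≢0 : ∀ {a b} → a ≢ 0ℚ → a *ℚ b ≡ 0ℚ → b ≡ 0ℚ
*ℚ-≢0 {a} {b} a≢0 ab≡0 = begin
  b                        ≡⟨ sym (ℚ.*-identityˡ b) ⟩
  1ℚ *ℚ b                  ≡⟨ cong (_*ℚ b) (sym (ℚ.*-inverseˡ a)) ⟩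
  ((1/ a) *ℚ a) *ℚ b       ≡⟨ ℚ.*-assoc (1/ a) a b ⟩
  (1/ a) *ℚ (a *ℚ b)       ≡⟨ cong ((1/ a) *ℚ_) ab≡0 ⟩
  (1/ a) *ℚ 0ℚ             ≡⟨ ℚ.*-zeroʳ (1/ a) ⟩
  0ℚ                       ∎
  where
  open ≡-Reasoning
  instance _ = ≢-nonZero a≢0

1ℚ≢0ℚ : 1ℚ ≢ 0ℚ
1ℚ≢0ℚ ()

pivot-coeff : ∀ {a} → a ≢ 0ℚ → ∀ b → Σ ℚ λ c → b +ℚ c *ℚ a ≡ 0ℚ
pivot-coeff {a} a≢0 b = -ℚ b *ℚ (1/ a) , (begin
  b +ℚ (-ℚ b *ℚ (1/ a)) *ℚ a  ≡⟨ cong (b +ℚ_) (ℚ.*-assoc (-ℚ b) (1/ a) a) ⟩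
  b +ℚ -ℚ b *ℚ ((1/ a) *ℚ a)  ≡⟨ cong (λ t → b +ℚ -ℚ b *ℚ t) (ℚ.*-inverseˡ a) ⟩
  b +ℚ -ℚ b *ℚ 1ℚ             ≡⟨ cong (b +ℚ_) (ℚ.*-identityʳ (-ℚ b)) ⟩
  b +ℚ -ℚ b                   ≡⟨ ℚ.+-inverseʳ b ⟩
  0ℚ                          ∎)
  where
  open ≡-Reasoning
  instance _ = ≢-nonZero a≢0

LinIndep-tail : ∀ {n m} {w : Fin (suc m) → Vecℚ n} → LinIndep w → LinIndep (λ i → w (suc i))
LinIndep-tail {w = w} li c h i = li c′ h′ (suc i)
  where
  c′ : Fin _ → ℚ
  c′ zero    = 0ℚ
  c′ (suc i) = c i
  h′ : ∀ j → ∑ℚ (λ i → c′ i *ℚ w i j) ≡ 0ℚ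
  h′ j = trans (cong₂ _+ℚ_ (ℚ.*-zeroˡ (w zero j)) (h j)) (ℚ.+-identityˡ 0ℚ)

-- One step of Gaussian elimination. The pivot is a vector that is nonzero at `j`; if there is none,
-- the first vector is given up instead, so that the count falls by one in either case.
kill-coordinate : ∀ {n m} {K : Vecℚ n → Set} → LinClosed K →
  (w : Fin (suc m) → Vecℚ n) → (∀ i → K (w i)) → LinIndep w → ∀ j →
  Σ (Fin m → Vecℚ n) λ w′ → (∀ i → K (w′ i) × w′ i j ≡ 0ℚ) × LinIndep w′
kill-coordinate {n} {m} {K} cl w Kw li j with Fin.any? (λ i → ¬? (w i j ℚ.≟ 0ℚ))
... | no none = (λ i → w (suc i)) , (λ i → Kw (suc i) , zeros i) , LinIndep-tail {w = w} li
  where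
  zeros : ∀ i → w (suc i) j ≡ 0ℚ
  zeros i with w (suc i) j ℚ.≟ 0ℚ
  ... | yes p = p
  ... | no np = ⊥-elim (none (suc i , np))
... | yes (p , wpj≢0) = w′ , (λ a → closed cl (c a) (Kw _) (Kw p) , proj₂ (coeff a)) , li′
  where
  open ≡-Reasoning
  coeff : ∀ a → Σ ℚ λ c → w (punchIn p a) j +ℚ c *ℚ w p j ≡ 0ℚ
  coeff a = pivot-coeff wpj≢0 (w (punchIn p a) j)
  c : Fin m → ℚ
  c a = proj₁ (coeff a)
  w′ : Fin m → Vecℚ n
  w′ a k = w (punchIn p a) k +ℚ c a *ℚ w p k
  li′ : LinIndep w′
  li′ d h a = trans (sym (Vecₚ.insertAt-punchIn d p s a)) (li D hD (punchIn p a))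
    where
    -- The coefficient that the pivot collects when the vectors `w′ a` are expanded.
    s : ℚ
    s = ∑ℚ (λ a → d a *ℚ c a)
    D : Fin (suc m) → ℚ
    D = insertAt d p s
    hD : ∀ k → ∑ℚ (λ i → D i *ℚ w i k) ≡ 0ℚ
    hD k = begin
      ∑ℚ (λ i → D i *ℚ w i k)
        ≡⟨ ΣQ.∑-punchIn (λ i → D i *ℚ w i k) p ⟩
      D p *ℚ w p k +ℚ ∑ℚ (λ a → D (punchIn p a) *ℚ w (punchIn p a) k)
        ≡⟨ cong₂ _+ℚ_ (cong (_*ℚ w p k) (Vecₚ.insertAt-lookup d p s))
             (ΣQ.∑-cong (λ a → cong (_*ℚ w (punchIn p a) k) (Vecₚ.insertAt-punchIn d p s a))) ⟩
      s *ℚ w p k +ℚ ∑ℚ (λ a → d a *ℚ w (punchIn p a) k)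
        ≡⟨ cong (_+ℚ ∑ℚ (λ a → d a *ℚ w (punchIn p a) k)) (*-distribʳ-∑ℚ (w p k) (λ a → d a *ℚ c a)) ⟩
      ∑ℚ (λ a → d a *ℚ c a *ℚ w p k) +ℚ ∑ℚ (λ a → d a *ℚ w (punchIn p a) k)
        ≡⟨ sym (ΣQ.∑-∙ (λ a → d a *ℚ c a *ℚ w p k) (λ a → d a *ℚ w (punchIn p a) k)) ⟩
      ∑ℚ (λ a → d a *ℚ c a *ℚ w p k +ℚ d a *ℚ w (punchIn p a) k)
        ≡⟨ ΣQ.∑-cong (λ a → solve 4 (λ x y z t → x :* y :* z :+ x :* t := x :* (t :+ y :* z))
             refl (d a) (c a) (w p k) (w (punchIn p a) k)) ⟩
      ∑ℚ (λ a → d a *ℚ w′ a k)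
        ≡⟨ h k ⟩
      0ℚ ∎
      where open ℚ-Solver.+-*-Solver

kill-coordinates : ∀ {n m} {K : Vecℚ n → Set} → LinClosed K →
  (fs : List (Fin n)) (w : Fin (length fs + m) → Vecℚ n) → (∀ i → K (w i)) → LinIndep w →
  Σ (Fin m → Vecℚ n) λ w′ → (∀ i → K (w′ i) × (∀ v → v ∈ fs → w′ i v ≡ 0ℚ)) × LinIndep w′
kill-coordinates cl [] w Kw li = w , (λ i → Kw i , λ _ ()) , li
kill-coordinates {n} {m} {K} cl (f ∷ fs) w Kw li =
  let w₁ , Kw₁ , li₁ = kill-coordinate cl w Kw li f
      w₂ , Kw₂ , li₂ = kill-coordinates cl′ fs w₁ Kw₁ li₁
  in w₂ , (λ i → proj₁ (proj₁ (Kw₂ i)) , zeros (Kw₂ i)) , li₂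
  where
  K′ : Vecℚ n → Set
  K′ x = K x × x f ≡ 0ℚ
  cl′ : LinClosed K′
  cl′ .closed c (kx , x0) (ky , y0) =
    closed cl c kx ky , trans (cong₂ (λ s t → s +ℚ c *ℚ t) x0 y0)
                              (trans (ℚ.+-identityˡ _) (ℚ.*-zeroʳ c))
  zeros : ∀ {x} → K′ x × (∀ v → v ∈ fs → x v ≡ 0ℚ) → ∀ v → v ∈ (f ∷ fs) → x v ≡ 0ℚ
  zeros ((_ , x0) , _) v (here refl) = x0
  zeros (_ , xs0)      v (there v∈)  = xs0 v v∈

LinIndep-nonzero : ∀ {n} {w : Fin 1 → Vecℚ n} → LinIndep w → ¬ (∀ v → w zero v ≡ 0ℚ)
LinIndep-nonzero {w = w} li zeros =
  1ℚ≢0ℚ (li (λ _ → 1ℚ) (λ j → trans (ℚ.+-identityʳ _) (trans (ℚ.*-identityˡ _) (zeros j))) zero)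

-- If there were more vectors than entries of `fs`, killing those coordinates would leave at least
-- one vector; `det` makes it zero, which independence forbids.
LinIndep-bounded : ∀ {n} {K : Vecℚ n → Set} → LinClosed K → (fs : List (Fin n)) →
  (∀ x → K x → (∀ v → v ∈ fs → x v ≡ 0ℚ) → ∀ v → x v ≡ 0ℚ) →
  ∀ k (w : Fin k → Vecℚ n) → (∀ i → K (w i)) → LinIndep w → k ≤ length fs
LinIndep-bounded {K = K} cl fs det k w Kw li with k ≤? length fs
... | yes p = p
... | no np = ⊥-elim (go (k ∸ suc (length fs)) size-eq w Kw li)
  where
  size-eq : k ≡ length fs + suc (k ∸ suc (length fs))
  size-eq = sym (trans (ℕ.+-suc (length fs) _) (ℕ.m+[n∸m]≡n (ℕ.≰⇒> np)))
  go : ∀ {k} d → k ≡ length fs + suc d → (w : Fin k → Vecℚ _) → (∀ i → K (w i)) → LinIndep w → ⊥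
  go d refl w Kw li =
    let w′ , Kw′ , li′ = kill-coordinates cl fs w Kw li
    in LinIndep-nonzero {w = λ _ → w′ zero} (prefix w′ li′) (det _ (proj₁ (Kw′ zero)) (proj₂ (Kw′ zero)))
    where
    prefix : ∀ {d} (w : Fin (suc d) → Vecℚ _) → LinIndep w → LinIndep {k = 1} (λ _ → w zero)
    prefix w li c h zero = li c′ h′ zero
      where
      c′ : Fin _ → ℚ
      c′ zero    = c zero
      c′ (suc _) = 0ℚ
      h′ : ∀ j → ∑ℚ (λ i → c′ i *ℚ w i j) ≡ 0ℚ
      h′ j = trans (cong (c zero *ℚ w zero j +ℚ_) (ΣQ.∑-unit (λ i → ℚ.*-zeroˡ (w (suc i) j)))) (h j)

InKernel-closed : ∀ Γ → LinClosed (InKernel Γ)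
InKernel-closed Γ .closed {x} {y} c kx ky i = begin
  ∑ℚ (λ j → A Γ i j *ℚ (x j +ℚ c *ℚ y j))
    ≡⟨ ΣQ.∑-cong (λ j → solve 4 (λ a x c y → a :* (x :+ c :* y) := a :* x :+ c :* (a :* y)) refl (A Γ i j) (x j) c (y j)) ⟩
  ∑ℚ (λ j → A Γ i j *ℚ x j +ℚ c *ℚ (A Γ i j *ℚ y j))
    ≡⟨ ΣQ.∑-∙ (λ j → A Γ i j *ℚ x j) (λ j → c *ℚ (A Γ i j *ℚ y j)) ⟩
  ∑ℚ (λ j → A Γ i j *ℚ x j) +ℚ ∑ℚ (λ j → c *ℚ (A Γ i j *ℚ y j))
    ≡⟨ cong₂ _+ℚ_ (kx i) (trans (sym (*-distribˡ-∑ℚ c (λ j → A Γ i j *ℚ y j))) (cong (c *ℚ_) (ky i))) ⟩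
  0ℚ +ℚ c *ℚ 0ℚ
    ≡⟨ trans (ℚ.+-identityˡ _) (ℚ.*-zeroʳ c) ⟩
  0ℚ ∎
  where
  open ≡-Reasoning
  open ℚ-Solver.+-*-Solver

-- Forcing

true≢false : true ≢ false
true≢false ()

∧-true : ∀ {b c} → b ∧ c ≡ true → b ≡ true × c ≡ true
∧-true {true} {true} _ = refl , refl

not-true : ∀ {b} → not b ≡ true → b ≡ false
not-true {false} _ = refl

-- Raising `f` by one at a place where it lies strictly below `g` keeps it below `g`. Repeating this
-- at distinct places turns several strict inequalities into a gap of that size between the sums.
module Raise {n} {f g : Fin n → ℕ} (x : Fin n) (lt : f x < g x) where

  raised : Fin n → ℕ
  raised i = f i + ΣN.at x 1 i

  ∑-raised : ∑ℕ raised ≡ suc (∑ℕ f)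
  ∑-raised = trans (ΣN.∑-∙ f (ΣN.at x 1)) (trans (cong (∑ℕ f +_) (ΣN.∑-at x 1)) (ℕ.+-comm (∑ℕ f) 1))

  raised≤ : (∀ i → f i ≤ g i) → ∀ i → raised i ≤ g i
  raised≤ le i with i ≟ x
  ... | yes refl = subst (_≤ g i) (ℕ.+-comm 1 _) lt
  ... | no _     = subst (_≤ g i) (sym (ℕ.+-identityʳ _)) (le i)

  raised< : ∀ {v} → x ≢ v → f v < g v → raised v < g v
  raised< {v} x≢v = subst (_< g v) (sym (trans (cong (f v +_) (ΣN.at-other 1 (x≢v ∘ sym))) (ℕ.+-identityʳ _)))

∑ℕ-strict : ∀ {n} {f g : Fin n → ℕ} → (∀ i → f i ≤ g i) → ∀ x → f x < g x → ∑ℕ f < ∑ℕ g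
∑ℕ-strict {f = f} {g} le x lt = subst (_≤ ∑ℕ g) ∑-raised (∑ℕ-mono (raised≤ le))
  where open Raise {f = f} {g} x lt

∑ℕ-strict₂ : ∀ {n} {f g : Fin n → ℕ} → (∀ i → f i ≤ g i) → ∀ {x y} → x ≢ y →
  f x < g x → f y < g y → 2 + ∑ℕ f ≤ ∑ℕ g
∑ℕ-strict₂ {f = f} {g} le {x} {y} x≢y ltx lty =
  subst (λ k → suc k ≤ ∑ℕ g) ∑-raised (∑ℕ-strict (raised≤ le) y (raised< x≢y lty))
  where open Raise {f = f} {g} x ltx

∑ℕ-strict₃ : ∀ {n} {f g : Fin n → ℕ} → (∀ i → f i ≤ g i) → ∀ {x y z} → x ≢ y → x ≢ z → y ≢ z →
  f x < g x → f y < g y → f z < g z → 3 + ∑ℕ f ≤ ∑ℕ g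
∑ℕ-strict₃ {f = f} {g} le {x} {y} {z} x≢y x≢z y≢z ltx lty ltz =
  subst (λ k → 2 + k ≤ ∑ℕ g) ∑-raised (∑ℕ-strict₂ (raised≤ le) y≢z (raised< x≢y lty) (raised< x≢z ltz))
  where open Raise {f = f} {g} x ltx

∑ℕ-positive : ∀ {n} (f : Fin n → ℕ) → 1 ≤ ∑ℕ f → ∃[ i ] (1 ≤ f i)
∑ℕ-positive {suc n} f p with f zero in eq
... | suc k = zero , subst (1 ≤_) (sym eq) (s≤s z≤n)
... | zero  = let i , q = ∑ℕ-positive (λ i → f (suc i)) p in suc i , q

# : ∀ {n} → (Fin n → Bool) → ℕ
# P = ∑ℕ (λ i → [ P i ])

[]≥1 : ∀ {b} → 1 ≤ [ b ] → b ≡ true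
[]≥1 {true} _ = refl

[]-mono : ∀ {b c} → (b ≡ true → c ≡ true) → [ b ] ≤ [ c ]
[]-mono {false} h = z≤n
[]-mono {true} h rewrite h refl = s≤s z≤n

≢true⇒false : ∀ {b} → b ≢ true → b ≡ false
≢true⇒false {true} h = ⊥-elim (h refl)
≢true⇒false {false} h = refl

module Counting {n} {P : Fin n → Bool} where

  #-witness : 1 ≤ # P → ∃[ i ] (P i ≡ true)
  #-witness h = let i , p = ∑ℕ-positive (λ i → [ P i ]) h in i , []≥1 p

  #-≥1 : ∀ v → P v ≡ true → 1 ≤ # P
  #-≥1 v pv = ℕ.≤-trans (ℕ.≤-reflexive (cong [_] (sym pv))) (∑ℕ-lower (λ i → [ P i ]) v)

  #-none : (∀ i → P i ≡ false) → # P ≡ 0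
  #-none h = ΣN.∑-unit (λ i → cong [_] (h i))

  #-single : ∀ {v} → P v ≡ true → (∀ i → P i ≡ true → i ≡ v) → # P ≡ 1
  #-single {v} pv h =
    trans (ΣN.∑-single v (λ i ne → cong [_] (≢true⇒false (λ pi → ne (h i pi))))) (cong [_] pv)

  #-pair : ∀ {u v} → u ≢ v → P u ≡ true → P v ≡ true →
    (∀ i → P i ≡ true → i ≡ u ⊎ i ≡ v) → # P ≡ 2
  #-pair u≢v pu pv h =
    trans (ΣN.∑-pair u≢v (λ i nu nv → cong [_] (≢true⇒false (λ pi → [ nu , nv ]′ (h i pi)))))
      (cong₂ (λ b c → [ b ] + [ c ]) pu pv)

  #-≥2 : ∀ {u v} → u ≢ v → P u ≡ true → P v ≡ true → 2 ≤ # P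
  #-≥2 {u} {v} u≢v pu pv =
    subst (λ t → 2 + t ≤ # P) (ΣN.∑-unit {f = λ (_ : Fin n) → 0} (λ _ → refl))
      (∑ℕ-strict₂ {f = λ _ → 0} (λ _ → z≤n) u≢v (pos pu) (pos pv))
    where
    pos : ∀ {b} → b ≡ true → 0 < [ b ]
    pos refl = s≤s z≤n

  #-≥3 : ∀ {u v w} → u ≢ v → u ≢ w → v ≢ w → P u ≡ true → P v ≡ true → P w ≡ true → 3 ≤ # P
  #-≥3 {u} {v} {w} u≢v u≢w v≢w pu pv pw =
    subst (λ t → 2 + t ≤ # P) (ΣN.∑-at w 1)
      (∑ℕ-strict₂ {f = ΣN.at w 1} le u≢v (lt u≢w pu) (lt v≢w pv))
    where
    le : ∀ i → ΣN.at w 1 i ≤ [ P i ]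
    le i with i ≟ w
    ... | yes refl rewrite pw = s≤s z≤n
    ... | no _ = z≤n
    lt : ∀ {x} → x ≢ w → P x ≡ true → ΣN.at w 1 x < [ P x ]
    lt {x} ne px rewrite px | dec-false (x ≟ w) ne = s≤s z≤n

  #≡1-unique : # P ≡ 1 → ∀ {u v} → P u ≡ true → P v ≡ true → u ≡ v
  #≡1-unique e {u} {v} pu pv with u ≟ v
  ... | yes p = p
  ... | no ne with subst (2 ≤_) e (#-≥2 ne pu pv)
  ...   | s≤s ()

  #≡2-only : # P ≡ 2 → ∀ {u v} → u ≢ v → P u ≡ true → P v ≡ true →
    ∀ w → P w ≡ true → w ≡ u ⊎ w ≡ v
  #≡2-only e {u} {v} u≢v pu pv w pw with w ≟ u | w ≟ v
  ... | yes p | _ = inj₁ p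
  ... | no _ | yes p = inj₂ p
  ... | no nu | no nv with subst (3 ≤_) e (#-≥3 u≢v (nu ∘ sym) (nv ∘ sym) pu pv pw)
  ...   | s≤s (s≤s ())

open Counting public

#-mono : ∀ {n} {P Q : Fin n → Bool} → (∀ i → P i ≡ true → Q i ≡ true) → # P ≤ # Q
#-mono h = ∑ℕ-mono (λ i → []-mono (h i))

#-split : ∀ {n} (P Q : Fin n → Bool) → # (λ i → P i ∧ not (Q i)) + # (λ i → P i ∧ Q i) ≡ # P
#-split P Q = trans (sym (ΣN.∑-∙ (λ i → [ P i ∧ not (Q i) ]) (λ i → [ P i ∧ Q i ]))) (ΣN.∑-cong (λ i → pointwise (P i) (Q i)))
  where
  pointwise : ∀ p q → [ p ∧ not q ] + [ p ∧ q ] ≡ [ p ]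
  pointwise true true = refl
  pointwise true false = refl
  pointwise false _ = refl

∸1-strict : ∀ {a b} → a < b → 2 ≤ b → a ∸ 1 < b ∸ 1
∸1-strict {zero} {suc (suc b)} _ _ = s≤s z≤n
∸1-strict {zero} {suc zero} _ (s≤s ())
∸1-strict {suc a} {suc b} (s≤s p) _ = p

-- Here `a` stands for out(w) and `d` for the degree of a new vertex w with two neighbours in S. For
-- `d` = 2 both sides would be truncated to 0: closing a cycle at a vertex of degree 2 saves nothing
-- at that vertex.
+2≤⇒∸1<∸2 : ∀ {a d} → a + 2 ≤ d → 3 ≤ d → a ∸ 1 < d ∸ 2
+2≤⇒∸1<∸2 {zero} {suc (suc (suc d))} _ _ = s≤s z≤n
+2≤⇒∸1<∸2 {suc a} {d} p _ = subst (_≤ d ∸ 2) (ℕ.m+n∸n≡m (suc a) 2) (ℕ.∸-monoˡ-≤ 2 p)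
+2≤⇒∸1<∸2 {zero} {suc (suc zero)} _ (s≤s (s≤s ()))
+2≤⇒∸1<∸2 {zero} {suc zero} (s≤s ()) _

+1≤⇒∸1≤∸2 : ∀ {a d} → a + 1 ≤ d → a ∸ 1 ≤ d ∸ 2
+1≤⇒∸1≤∸2 {zero} _ = z≤n
+1≤⇒∸1≤∸2 {suc a} {d} p = subst (_≤ d ∸ 2) (trans (cong (_∸ 2) (ℕ.+-comm (suc a) 1)) refl) (ℕ.∸-monoˡ-≤ 2 p)

-- Determined vertex sets and the potential Φ

module Forcing (Γ : SignedGraph) where

  V : Set
  V = Fin (size Γ)

  adj : V → V → Bool
  adj u v = is-just (σ Γ u v)

  infix 4 _~_
  _~_ : V → V → Set
  u ~ v = adj u v ≡ true

  adj-sym : ∀ u v → adj u v ≡ adj v u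
  adj-sym u v = cong is-just (SignedGraph.sym Γ u v)

  ~-sym : ∀ {u v} → u ~ v → v ~ u
  ~-sym {u} {v} p = trans (adj-sym v u) p

  ~-irrefl : ∀ {v} → ¬ (v ~ v)
  ~-irrefl {v} p = true≢false (trans (sym p) (cong is-just (SignedGraph.loopless Γ v)))

  ~⇒≢ : ∀ {u v} → u ~ v → u ≢ v
  ~⇒≢ p refl = ~-irrefl p

  Adj⇒~ : ∀ {u v} → Adj Γ u v → u ~ v
  Adj⇒~ (s , e) = cong is-just e

  ~⇒Adj : ∀ {u v} → u ~ v → Adj Γ u v
  ~⇒Adj {u} {v} p with σ Γ u v
  ... | just s = s , refl

  A≢0 : ∀ {u v} → u ~ v → A Γ u v ≢ 0ℚ
  A≢0 {u} {v} p with σ Γ u v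
  ... | just ⊕ = λ ()
  ... | just ⊖ = λ ()

  A≡0 : ∀ {u v} → ¬ (u ~ v) → A Γ u v ≡ 0ℚ
  A≡0 {u} {v} np with σ Γ u v
  ... | just s = ⊥-elim (np refl)
  ... | nothing = refl

  Subset : Set
  Subset = V → Bool

  infix 4 _∈ₛ_ _∉ₛ_ _⊆ₛ_
  _∈ₛ_ _∉ₛ_ : V → Subset → Set
  v ∈ₛ S = S v ≡ true
  v ∉ₛ S = S v ≡ false

  _⊆ₛ_ : Subset → Subset → Set
  S ⊆ₛ S′ = ∀ v → v ∈ₛ S → v ∈ₛ S′

  ∈∉⇒≢ : ∀ {S u v} → u ∈ₛ S → v ∉ₛ S → u ≢ v
  ∈∉⇒≢ p q refl = true≢false (trans (sym p) q)

  clash : ∀ {S v} → v ∈ₛ S → v ∉ₛ S → ⊥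
  clash p q = true≢false (trans (sym p) q)

  out inn : Subset → V → ℕ
  out S v = # (λ j → adj v j ∧ not (S j))
  inn S v = # (λ j → adj v j ∧ S j)

  out+inn : ∀ S v → out S v + inn S v ≡ deg Γ v
  out+inn S v = #-split (adj v) S

  out-∧ : ∀ {S v w} → v ~ w → w ∉ₛ S → adj v w ∧ not (S w) ≡ true
  out-∧ p q rewrite p | q = refl

  inn-∧ : ∀ {S v w} → v ~ w → w ∈ₛ S → adj v w ∧ S w ≡ true
  inn-∧ p q rewrite p | q = refl

  out-elim : ∀ {S v w} → adj v w ∧ not (S w) ≡ true → v ~ w × w ∉ₛ S
  out-elim p = let q , r = ∧-true p in q , not-true r

  out≥1 : ∀ {S v w} → v ~ w → w ∉ₛ S → 1 ≤ out S v
  out≥1 {S} {v} {w} p q = #-≥1 w (out-∧ {S} p q)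

  out-witness : ∀ {S v} → 1 ≤ out S v → ∃[ w ] (v ~ w × w ∉ₛ S)
  out-witness {S} h = let w , p = #-witness h in w , out-elim {S} p

  out≡1-unique : ∀ {S v} → out S v ≡ 1 → ∀ {w x} → v ~ w → w ∉ₛ S → v ~ x → x ∉ₛ S → w ≡ x
  out≡1-unique {S} e p q r s = #≡1-unique e (out-∧ {S} p q) (out-∧ {S} r s)

  out-mono : ∀ {S S′} v → S ⊆ₛ S′ → out S′ v ≤ out S v
  out-mono {S} {S′} v sub = #-mono λ j h → let p , q = out-elim {S′} h in
    out-∧ {S} p (≢true⇒false (λ r → true≢false (trans (sym (sub j r)) q)))

  add : Subset → V → Subset
  add S w j = S j ∨ does (j ≟ w)

  add-self : ∀ S w → w ∈ₛ add S w
  add-self S w rewrite dec-true (w ≟ w) refl with S w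
  ... | true = refl
  ... | false = refl

  add-keep : ∀ S w → S ⊆ₛ add S w
  add-keep S w v p rewrite p = refl

  add-inv : ∀ {S w v} → v ∈ₛ add S w → v ∈ₛ S ⊎ v ≡ w
  add-inv {S} {w} {v} p with S v | v ≟ w
  ... | true  | _ = inj₁ refl
  ... | false | yes q = inj₂ q
  add-inv {S} {w} {v} () | false | no _

  add-∉-inv : ∀ {S w v} → v ∉ₛ add S w → v ∉ₛ S × v ≢ w
  add-∉-inv {S} {w} {v} p with S v | v ≟ w
  ... | false | no q = refl , q
  add-∉-inv {S} {w} {v} () | true | _
  add-∉-inv {S} {w} {v} () | false | yes _

  out-add : ∀ {S w} → w ∉ₛ S → ∀ v → out (add S w) v + [ adj v w ] ≡ out S v
  out-add {S} {w} w∉ v =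
    trans (cong (out (add S w) v +_) (sym (ΣN.∑-at w [ adj v w ])))
      (trans (sym (ΣN.∑-∙ (λ j → [ adj v j ∧ not (add S w j) ]) (ΣN.at w [ adj v w ]))) (ΣN.∑-cong pointwise))
    where
    pointwise : ∀ j → [ adj v j ∧ not (add S w j) ] + ΣN.at w [ adj v w ] j ≡ [ adj v j ∧ not (S j) ]
    pointwise j with j ≟ w
    ... | no _ with S j
    ...   | true = ℕ.+-identityʳ _
    ...   | false = ℕ.+-identityʳ _
    pointwise j | yes refl rewrite w∉ with adj v j
    ...   | true = refl
    ...   | false = refl

  out-add-adj : ∀ {S w v} → w ∉ₛ S → v ~ w → suc (out (add S w) v) ≡ out S v
  out-add-adj {S} {w} {v} w∉ p =
    trans (ℕ.+-comm 1 _) (trans (cong (λ b → out (add S w) v + [ b ]) (sym p)) (out-add w∉ v))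

  out-add-nonadj : ∀ {S w v} → w ∉ₛ S → ¬ (v ~ w) → out (add S w) v ≡ out S v
  out-add-nonadj {S} {w} {v} w∉ np =
    trans (sym (ℕ.+-identityʳ _))
      (trans (cong (λ b → out (add S w) v + [ b ]) (sym (≢true⇒false np))) (out-add w∉ v))

  inn-one : ∀ {S w t} → w ~ t → t ∈ₛ S → (∀ u → w ~ u → u ∈ₛ S → u ≡ t) → out S w + 1 ≡ deg Γ w
  inn-one {S} {w} {t} p q h = trans (cong (out S w +_) (sym one)) (out+inn S w)
    where
    one : inn S w ≡ 1
    one = #-single (inn-∧ {S} p q) (λ i r → let r₁ , r₂ = ∧-true r in h i r₁ r₂)

  inn-two : ∀ {S w t u} → t ≢ u → w ~ t → t ∈ₛ S → w ~ u → u ∈ₛ S →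
    (∀ x → w ~ x → x ∈ₛ S → x ≡ t ⊎ x ≡ u) → out S w + 2 ≡ deg Γ w
  inn-two {S} {w} t≢u p q p′ q′ h = trans (cong (out S w +_) (sym two)) (out+inn S w)
    where
    two : inn S w ≡ 2
    two = #-pair t≢u (inn-∧ {S} p q) (inn-∧ {S} p′ q′) (λ i r → let r₁ , r₂ = ∧-true r in h i r₁ r₂)

  inn≥1 : ∀ {S w t} → w ~ t → t ∈ₛ S → out S w + 1 ≤ deg Γ w
  inn≥1 {S} {w} {t} p q =
    ℕ.≤-trans (ℕ.+-monoʳ-≤ (out S w) (#-≥1 t (inn-∧ {S} p q))) (ℕ.≤-reflexive (out+inn S w))

  inn≥2 : ∀ {S w t u} → t ≢ u → w ~ t → t ∈ₛ S → w ~ u → u ∈ₛ S → out S w + 2 ≤ deg Γ w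
  inn≥2 {S} {w} t≢u p q p′ q′ =
    ℕ.≤-trans (ℕ.+-monoʳ-≤ (out S w) (#-≥2 t≢u (inn-∧ {S} p q) (inn-∧ {S} p′ q′))) (ℕ.≤-reflexive (out+inn S w))

  out-add-self : ∀ {S w} → w ∉ₛ S → out (add S w) w ≡ out S w
  out-add-self w∉ = out-add-nonadj w∉ ~-irrefl

  Zeros : List V → (V → ℚ) → Set
  Zeros fs x = ∀ v → v ∈ fs → x v ≡ 0ℚ

  -- By linearity, zero values suffice to express that the coordinates in `fs` determine a kernel
  -- vector on `S`.
  Det : Subset → List V → Set
  Det S fs = ∀ x → InKernel Γ x → Zeros fs x → ∀ v → v ∈ₛ S → x v ≡ 0ℚ

  row-single : ∀ (x : V → ℚ) {v w} → (∀ j → j ≢ w → v ~ j → x j ≡ 0ℚ) →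
    ∑ℚ (λ j → A Γ v j *ℚ x j) ≡ A Γ v w *ℚ x w
  row-single x {v} {w} h = ΣQ.∑-single w other
    where
    other : ∀ j → j ≢ w → A Γ v j *ℚ x j ≡ 0ℚ
    other j ne with adj v j ≟ᵇ true
    ... | yes p = trans (cong (A Γ v j *ℚ_) (h j ne p)) (ℚ.*-zeroʳ (A Γ v j))
    ... | no np = trans (cong (_*ℚ x j) (A≡0 {v} {j} np)) (ℚ.*-zeroˡ (x j))

  Det-force : ∀ {S fs v w} → out S v ≡ 1 → v ~ w → w ∉ₛ S → Det S fs → Det (add S w) fs
  Det-force {S} {fs} {v} {w} e p q det x ker zs u u∈ = [ det x ker zs u , (λ { refl → xw }) ]′ (add-inv {S} u∈)
    where
    x0 : ∀ j → j ≢ w → v ~ j → x j ≡ 0ℚ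
    x0 j ne r with S j in eq
    ... | true = det x ker zs j eq
    ... | false = ⊥-elim (ne (out≡1-unique {S} e r eq p q))
    xw : x w ≡ 0ℚ
    xw = *ℚ-≢0 (A≢0 p) (trans (sym (row-single x {v} {w} x0)) (ker v))

  Det-param : ∀ {S fs} w → Det S fs → Det (add S w) (w ∷ fs)
  Det-param {S} w det x ker zs u u∈ =
    [ det x ker (λ v v∈ → zs v (there v∈)) u , (λ { refl → zs w (here refl) }) ]′ (add-inv {S} u∈)

  -- The free choices still charged to a vertex. In `S`, all outside neighbours but the last may
  -- have to be chosen, the last being forced by the kernel equation at `v`. A vertex outside `S`
  -- will be entered through one neighbour, which leaves deg - 1 others and thus deg - 2 choices.
  weight : Subset → V → ℕ
  weight S v = if S v then out S v ∸ 1 else deg Γ v ∸ 2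

  Φ : Subset → ℕ
  Φ S = ∑ℕ (weight S)

  weight-∈ : ∀ {S v} → v ∈ₛ S → weight S v ≡ out S v ∸ 1
  weight-∈ p rewrite p = refl

  weight-∉ : ∀ {S v} → v ∉ₛ S → weight S v ≡ deg Γ v ∸ 2
  weight-∉ p rewrite p = refl

  module _ {S w t} (w∉ : w ∉ₛ S) (t∈ : t ∈ₛ S) (w~t : w ~ t) where

    weight-add≤ : ∀ x → weight (add S w) x ≤ weight S x
    weight-add≤ x with S x in eq | x ≟ w
    ... | true | _ = ℕ.∸-monoˡ-≤ 1 (out-mono x (add-keep S w))
    ... | false | no _ = ℕ.≤-refl
    ... | false | yes refl =
      subst (λ k → k ∸ 1 ≤ deg Γ x ∸ 2) (sym (out-add-self {S} w∉)) (+1≤⇒∸1≤∸2 (inn≥1 {S} w~t t∈))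

    weight-add-nbr< : ∀ {u} → u ∈ₛ S → u ~ w → 2 ≤ out S u → weight (add S w) u < weight S u
    weight-add-nbr< {u} u∈ u~w k rewrite weight-∈ {S} u∈ | weight-∈ {add S w} (add-keep S w u u∈) =
      ∸1-strict (ℕ.≤-reflexive (out-add-adj {S} w∉ u~w)) k

    weight-add-new< : ∀ {u} → t ≢ u → u ∈ₛ S → w ~ u → 3 ≤ deg Γ w → weight (add S w) w < weight S w
    weight-add-new< {u} t≢u u∈ w~u d rewrite weight-∉ {S} w∉ | weight-∈ {add S w} (add-self S w) | out-add-self {S} w∉ =
      +2≤⇒∸1<∸2 (inn≥2 {S} t≢u w~t t∈ w~u u∈) d

    Φ-add : Φ (add S w) ≤ Φ S
    Φ-add = ∑ℕ-mono weight-add≤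

    Φ-add-nbr : ∀ {u} → u ∈ₛ S → u ~ w → 2 ≤ out S u → suc (Φ (add S w)) ≤ Φ S
    Φ-add-nbr u∈ u~w k = ∑ℕ-strict weight-add≤ _ (weight-add-nbr< u∈ u~w k)

    Φ-add-new : ∀ {u} → t ≢ u → u ∈ₛ S → w ~ u → 3 ≤ deg Γ w → suc (Φ (add S w)) ≤ Φ S
    Φ-add-new t≢u u∈ w~u d = ∑ℕ-strict weight-add≤ _ (weight-add-new< t≢u u∈ w~u d)

    Φ-add-nbr₂ : ∀ {u v} → u ≢ v → u ∈ₛ S → u ~ w → 2 ≤ out S u → v ∈ₛ S → v ~ w → 2 ≤ out S v →
      2 + Φ (add S w) ≤ Φ S
    Φ-add-nbr₂ u≢v u∈ u~w k v∈ v~w k′ =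
      ∑ℕ-strict₂ weight-add≤ u≢v (weight-add-nbr< u∈ u~w k) (weight-add-nbr< v∈ v~w k′)

    Φ-add-nbr-new : ∀ {u v} → t ≢ u → u ∈ₛ S → w ~ u → v ∈ₛ S → v ~ w → 2 ≤ out S v → 3 ≤ deg Γ w →
      2 + Φ (add S w) ≤ Φ S
    Φ-add-nbr-new {u} {v} t≢u u∈ w~u v∈ v~w k d =
      ∑ℕ-strict₂ weight-add≤ (∈∉⇒≢ v∈ w∉) (weight-add-nbr< v∈ v~w k) (weight-add-new< t≢u u∈ w~u d)

  rest : Subset → ℕ
  rest S = # (λ v → not (S v))

  rest-⊂ : ∀ {S S′ w} → S ⊆ₛ S′ → w ∉ₛ S → w ∈ₛ S′ → rest S′ < rest S
  rest-⊂ {S} {S′} {w} sub w∉ w∈ = ∑ℕ-strict (λ i → []-mono (pointwise i)) w strict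
    where
    pointwise : ∀ i → not (S′ i) ≡ true → not (S i) ≡ true
    pointwise i p with S i in eq
    ... | false = refl
    ... | true = ⊥-elim (true≢false (trans (sym (sub i eq)) (not-true p)))
    strict : [ not (S′ w) ] < [ not (S w) ]
    strict rewrite w∉ | w∈ = s≤s z≤n

  rest-add : ∀ {S w} → w ∉ₛ S → rest (add S w) < rest S
  rest-add {S} {w} w∉ = rest-⊂ {S} {add S w} (add-keep S w) w∉ (add-self S w)

  boundary? : ∀ S → (∃[ v ] ∃[ w ] (v ∈ₛ S × v ~ w × w ∉ₛ S)) ⊎
                    (∀ v w → v ∈ₛ S → v ~ w → w ∈ₛ S)
  boundary? S with Fin.any? (λ v → Fin.any? (λ w → (S v ∧ (adj v w ∧ not (S w))) ≟ᵇ true))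
  ... | yes (v , w , p) = let q , r = ∧-true p in inj₁ (v , w , q , out-elim {S} r)
  ... | no none = inj₂ noExit
    where
    noExit : ∀ v w → v ∈ₛ S → v ~ w → w ∈ₛ S
    noExit v w p q with S w in eq
    ... | true = refl
    ... | false = ⊥-elim (none (v , w , h))
      where
      h : S v ∧ (adj v w ∧ not (S w)) ≡ true
      h rewrite p | q | eq = refl

  closed⇒full : ∀ {S r} → Connected Γ → r ∈ₛ S → (∀ v w → v ∈ₛ S → v ~ w → w ∈ₛ S) → ∀ v → v ∈ₛ S
  closed⇒full {S} {r} con r∈ cl v = go (con r v) r∈
    where
    go : ∀ {a b} → Star (Adj Γ) a b → a ∈ₛ S → b ∈ₛ S
    go ε p = p
    go (e ◅ es) p = go es (cl _ _ p (Adj⇒~ e))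

  module _ (con : Connected Γ) (deg≥2 : ∀ v → 2 ≤ deg Γ v) where

    -- Grow S along boundary edges; forcing is free, and a free choice is paid for by Φ.
    Det-complete : ∀ m S fs → rest S < m → ∀ {r} → r ∈ₛ S → Det S fs →
      Σ (List V) λ fs′ → (∀ v → v ∈ fs → v ∈ fs′) × length fs′ ≤ length fs + Φ S × Det (λ _ → true) fs′
    Det-complete (suc m) S fs (s≤s lt) {r} r∈ det with boundary? S
    ... | inj₂ cl = fs , (λ _ p → p) , ℕ.m≤m+n _ _ ,
      (λ x ker zs v _ → det x ker zs v (closed⇒full {S} con r∈ cl v))
    ... | inj₁ (v , w , v∈ , v~w , w∉) with 2 ≤? out S v
    ...   | yes k =
      let fs′ , sub , len , det′ = Det-complete m (add S w) (w ∷ fs) (ℕ.<-≤-trans (rest-add {S} w∉) lt)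
                                     (add-keep S w r r∈) (Det-param {S} w det)
      in fs′ , (λ v v∈ → sub v (there v∈)) ,
         ℕ.≤-trans len (ℕ.≤-trans (ℕ.≤-reflexive (sym (ℕ.+-suc (length fs) _)))
           (ℕ.+-monoʳ-≤ (length fs) (Φ-add-nbr {S} w∉ v∈ (~-sym v~w) v∈ v~w k))) ,
         det′
    ...   | no nk =
      let one = ℕ.≤-antisym (ℕ.≤-pred (ℕ.≰⇒> nk)) (out≥1 {S} v~w w∉)
          fs′ , sub , len , det′ = Det-complete m (add S w) fs (ℕ.<-≤-trans (rest-add {S} w∉) lt)
                                     (add-keep S w r r∈) (Det-force {S} one v~w w∉ det)
      in fs′ , sub , ℕ.≤-trans len (ℕ.+-monoʳ-≤ (length fs) (Φ-add {S} w∉ v∈ (~-sym v~w))) , det′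

    nullity≤ : ∀ S fs {r} → r ∈ₛ S → Det S fs →
      ∀ k (w : Fin k → Vecℚ (size Γ)) → (∀ i → InKernel Γ (w i)) → LinIndep w → k ≤ length fs + Φ S
    nullity≤ S fs r∈ det k w Kw li =
      let fs′ , _ , len , det′ = Det-complete (suc (rest S)) S fs ℕ.≤-refl r∈ det
      in ℕ.≤-trans (LinIndep-bounded (InKernel-closed Γ) fs′ (λ x ker zs v → det′ x ker zs v refl) k w Kw li) len

  ⟦_⟧ : V → Subset
  ⟦ r ⟧ v = does (v ≟ r)

  Det-⟦⟧ : ∀ r → Det ⟦ r ⟧ (r ∷ [])
  Det-⟦⟧ r x ker zs v v∈ with v ≟ r
  ... | yes refl = zs v (here refl)
  Det-⟦⟧ r x ker zs v () | no _

  ⟦⟧-self : ∀ r → r ∈ₛ ⟦ r ⟧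
  ⟦⟧-self r = dec-true (r ≟ r) refl

  ⟦⟧-inv : ∀ {r v} → v ∈ₛ ⟦ r ⟧ → v ≡ r
  ⟦⟧-inv {r} {v} p with v ≟ r
  ... | yes q = q
  ⟦⟧-inv {r} {v} () | no _

  out-⟦⟧ : ∀ r → out ⟦ r ⟧ r ≡ deg Γ r
  out-⟦⟧ r = ΣN.∑-cong pointwise
    where
    pointwise : ∀ j → [ adj r j ∧ not (⟦ r ⟧ j) ] ≡ [ adj r j ]
    pointwise j with adj r j in eq | j ≟ r
    ... | false | _ = refl
    ... | true | no _ = refl
    ... | true | yes refl = ⊥-elim (~-irrefl {r} eq)

  Φ-⟦⟧ : ∀ r → 2 ≤ deg Γ r → Φ ⟦ r ⟧ ≡ ∑ℕ (λ v → deg Γ v ∸ 2) + 1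
  Φ-⟦⟧ r d = trans (ΣN.∑-cong pointwise)
      (trans (ΣN.∑-∙ (λ v → deg Γ v ∸ 2) (ΣN.at r 1)) (cong (∑ℕ (λ v → deg Γ v ∸ 2) +_) (ΣN.∑-at r 1)))
    where
    arith : ∀ {k} → 2 ≤ k → k ∸ 1 ≡ k ∸ 2 + 1
    arith (s≤s (s≤s {n = k} _)) = ℕ.+-comm 1 k
    pointwise : ∀ v → weight ⟦ r ⟧ v ≡ (deg Γ v ∸ 2) + ΣN.at r 1 v
    pointwise v with v ≟ r
    ... | no _ = sym (ℕ.+-identityʳ _)
    ... | yes refl = trans (cong (_∸ 1) (out-⟦⟧ r)) (arith d)

-- Nullity of a tree with attached cycles

InKernel-cong : ∀ Γ {x y} → (∀ v → x v ≡ y v) → InKernel Γ x → InKernel Γ y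
InKernel-cong Γ h kx i = trans (ΣQ.∑-cong (λ j → cong (A Γ i j *ℚ_) (sym (h j)))) (kx i)

InKernel-zero : ∀ Γ → InKernel Γ (λ _ → 0ℚ)
InKernel-zero Γ i = ΣQ.∑-unit (λ j → ℚ.*-zeroʳ (A Γ i j))

InKernel-scale : ∀ Γ c {x} → InKernel Γ x → InKernel Γ (λ v → c *ℚ x v)
InKernel-scale Γ c kx =
  InKernel-cong Γ (λ v → ℚ.+-identityˡ _) (closed (InKernel-closed Γ) c (InKernel-zero Γ) kx)

InKernel-comb : ∀ Γ {m} (c : Fin m → ℚ) (w : Fin m → Vecℚ (size Γ)) → (∀ i → InKernel Γ (w i)) →
  InKernel Γ (λ v → ∑ℚ (λ i → c i *ℚ w i v))
InKernel-comb Γ {zero} c w Kw = InKernel-zero Γ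
InKernel-comb Γ {suc m} c w Kw =
  InKernel-cong Γ (λ v → ℚ.+-comm (∑ℚ (λ i → c (suc i) *ℚ w (suc i) v)) (c zero *ℚ w zero v))
    (closed (InKernel-closed Γ) (c zero)
      (InKernel-comb Γ (λ i → c (suc i)) (λ i → w (suc i)) (λ i → Kw (suc i))) (Kw zero))

A-sym : ∀ Γ i j → A Γ i j ≡ A Γ j i
A-sym Γ i j = cong signVal (SignedGraph.sym Γ i j)

-- A symmetric: pairing a kernel vector with A x shows that one row equation follows from the others.
last-row : ∀ Γ {x a : Vecℚ (size Γ)} r → InKernel Γ a → a r ≡ 1ℚ →
  (∀ b → b ≢ r → ∑ℚ (λ j → A Γ b j *ℚ x j) ≡ 0ℚ) → ∑ℚ (λ j → A Γ r j *ℚ x j) ≡ 0ℚ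
last-row Γ {x} {a} r Ka ar h = begin
  row r                                   ≡⟨ sym (ℚ.*-identityʳ _) ⟩
  row r *ℚ 1ℚ                             ≡⟨ cong (row r *ℚ_) (sym ar) ⟩
  row r *ℚ a r                            ≡⟨ sym (ΣQ.∑-single r other) ⟩
  ∑ℚ (λ b → row b *ℚ a b)                 ≡⟨ ΣQ.∑-cong (λ b → *-distribʳ-∑ℚ (a b) (λ j → A Γ b j *ℚ x j)) ⟩
  ∑ℚ (λ b → ∑ℚ (λ j → A Γ b j *ℚ x j *ℚ a b)) ≡⟨ ΣQ.∑-swap (λ b j → A Γ b j *ℚ x j *ℚ a b) ⟩
  ∑ℚ (λ j → ∑ℚ (λ b → A Γ b j *ℚ x j *ℚ a b)) ≡⟨ ΣQ.∑-unit col ⟩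
  0ℚ                                      ∎
  where
  open ≡-Reasoning
  row : Fin (size Γ) → ℚ
  row b = ∑ℚ (λ j → A Γ b j *ℚ x j)
  other : ∀ b → b ≢ r → row b *ℚ a b ≡ 0ℚ
  other b ne = trans (cong (_*ℚ a b) (h b ne)) (ℚ.*-zeroˡ (a b))
  col : ∀ j → ∑ℚ (λ b → A Γ b j *ℚ x j *ℚ a b) ≡ 0ℚ
  col j = begin
    ∑ℚ (λ b → A Γ b j *ℚ x j *ℚ a b)
      ≡⟨ ΣQ.∑-cong (λ b → trans (solve 3 (λ p q s → p :* q :* s := q :* (p :* s)) refl (A Γ b j) (x j) (a b))
           (cong (λ t → x j *ℚ (t *ℚ a b)) (A-sym Γ b j))) ⟩
    ∑ℚ (λ b → x j *ℚ (A Γ j b *ℚ a b))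
      ≡⟨ sym (*-distribˡ-∑ℚ (x j) (λ b → A Γ j b *ℚ a b)) ⟩
    x j *ℚ ∑ℚ (λ b → A Γ j b *ℚ a b)
      ≡⟨ cong (x j *ℚ_) (Ka j) ⟩
    x j *ℚ 0ℚ
      ≡⟨ ℚ.*-zeroʳ (x j) ⟩
    0ℚ ∎
    where open ℚ-Solver.+-*-Solver

cycle-Φ : ∀ C → IsCycle C → ∀ r → Forcing.Φ C (Forcing.⟦_⟧ C r) ≡ 1
cycle-Φ C (_ , _ , deg2) r = trans (Forcing.Φ-⟦⟧ C r (ℕ.≤-reflexive (sym (deg2 r))))
  (cong (_+ 1) (ΣN.∑-unit (λ v → cong (_∸ 2) (deg2 v))))

-- In a cycle the potential of a single vertex is 1, so completing the determined set from `r` adds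
-- at most one coordinate, which is `y`.
cycle-det : ∀ C → IsCycle C → ∀ r → Σ (Fin (size C)) λ y →
  ∀ x → InKernel C x → x r ≡ 0ℚ → x y ≡ 0ℚ → ∀ v → x v ≡ 0ℚ
cycle-det C cy@(_ , con , deg2) r =
  let fs , sub , len , det = Det-complete con (λ v → ℕ.≤-reflexive (sym (deg2 v)))
                               (suc (rest ⟦ r ⟧)) ⟦ r ⟧ (r ∷ []) ℕ.≤-refl {r} (⟦⟧-self r) (Det-⟦⟧ r)
  in pick fs (sub r (here refl)) (subst (λ t → length fs ≤ 1 + t) (cycle-Φ C cy r) len) det
  where
  open Forcing C
  pick : ∀ fs → r ∈ fs → length fs ≤ 2 → Det (λ _ → true) fs →
    Σ (Fin (size C)) λ y → ∀ x → InKernel C x → x r ≡ 0ℚ → x y ≡ 0ℚ → ∀ v → x v ≡ 0ℚ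
  -- No second coordinate was chosen, so `r` itself serves as `y`.
  pick (f ∷ []) (here refl) _ det = r , λ x ker xr _ v → det x ker (λ { _ (here refl) → xr }) v refl
  pick (f ∷ g ∷ []) (here refl) _ det =
    g , λ x ker xr xg v → det x ker (λ { _ (here refl) → xr ; _ (there (here refl)) → xg }) v refl
  pick (f ∷ g ∷ []) (there (here refl)) _ det =
    f , λ x ker xr xf v → det x ker (λ { _ (here refl) → xf ; _ (there (here refl)) → xr }) v refl
  pick (f ∷ g ∷ h ∷ fs) _ (s≤s (s≤s ())) _

-- A basis of the kernel adapted to the attaching vertex: `one` carries a value at `r` into the
-- cycle, `zer` is the extra dimension contributed by the cycle, and `y` is a vertex at which `zer`
-- is detected.
record CycleKernel (C : SignedGraph) (r : Fin (size C)) : Set where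
  field
    one      : Vecℚ (size C)
    one-ker  : InKernel C one
    one-r    : one r ≡ 1ℚ
    zer      : Vecℚ (size C)
    zer-ker  : InKernel C zer
    zer-r    : zer r ≡ 0ℚ
    y        : Fin (size C)
    zer-y    : zer y ≢ 0ℚ
    det      : ∀ x → InKernel C x → x r ≡ 0ℚ → x y ≡ 0ℚ → ∀ v → x v ≡ 0ℚ

-- If both basis vectors vanished at `r`, the coordinate at `y` alone would determine them, which
-- allows only dimension 1. So some vector can be scaled to 1 at `r`, and eliminating the coordinate
-- `r` leaves `zer`.
cycle-kernel : ∀ C → IsCycle C → HasNullity C 2 → ∀ r → CycleKernel C r
cycle-kernel C cyc ((w , Kw , li) , _) r with cycle-det C cyc r | Fin.any? (λ i → ¬? (w i r ℚ.≟ 0ℚ))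
... | y , det | no none = ⊥-elim (absurd (LinIndep-bounded cl (y ∷ []) (λ x kx zs → det x (proj₁ kx) (proj₂ kx) (zs y (here refl))) 2 w
                                   (λ i → Kw i , zeros i) li))
  where
  absurd : ¬ (2 ≤ 1)
  absurd (s≤s ())
  cl : LinClosed (λ x → InKernel C x × x r ≡ 0ℚ)
  cl .closed c (kx , x0) (ky , y0) =
    closed (InKernel-closed C) c kx ky ,
    trans (cong₂ (λ s t → s +ℚ c *ℚ t) x0 y0) (trans (ℚ.+-identityˡ _) (ℚ.*-zeroʳ c))
  zeros : ∀ i → w i r ≡ 0ℚ
  zeros i with w i r ℚ.≟ 0ℚ
  ... | yes p = p
  ... | no np = ⊥-elim (none (i , np))
... | y , det | yes (i , wir≢0) with kill-coordinate (InKernel-closed C) w Kw li r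
...   | (z , Kz , liz) = record
  { one = λ v → (1/ (w i r)) *ℚ w i v
  ; one-ker = InKernel-scale C (1/ (w i r)) (Kw i)
  ; one-r = ℚ.*-inverseˡ (w i r)
  ; zer = z zero
  ; zer-ker = proj₁ (Kz zero)
  ; zer-r = proj₂ (Kz zero)
  ; y = y
  ; zer-y = λ zy → LinIndep-nonzero {w = z} liz (det (z zero) (proj₁ (Kz zero)) (proj₂ (Kz zero)) zy)
  ; det = det }
  where instance _ = ≢-nonZero wir≢0

≡-from-just : ∀ {X : Set} {m m′ : Maybe X} →
  (∀ s → m ≡ just s → m′ ≡ just s) → (∀ s → m′ ≡ just s → m ≡ just s) → m ≡ m′
≡-from-just {m = just s} f g = sym (f s refl)
≡-from-just {m = nothing} {just s} f g = g s refl
≡-from-just {m = nothing} {nothing} f g = refl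

∑ℚ-+ : ∀ q {m} (f : Fin (q + m) → ℚ) → ∑ℚ f ≡ ∑ℚ (λ i → f (i ↑ˡ m)) +ℚ ∑ℚ (λ j → f (q ↑ʳ j))
∑ℚ-+ zero f = sym (ℚ.+-identityˡ _)
∑ℚ-+ (suc q) {m} f = trans (cong (f zero +ℚ_) (∑ℚ-+ q (λ i → f (suc i)))) (sym (ℚ.+-assoc (f zero) (∑ℚ (λ i → f (suc (i ↑ˡ m)))) (∑ℚ (λ j → f (suc (q ↑ʳ j))))))

module Attached {Γ : SignedGraph} (W : TreeWithNullity2Cycles Γ) where
  open TreeWithNullity2Cycles W

  q : ℕ
  q = leafCount T

  n : ℕ
  n = size Γ

  kernelOf : ∀ i → CycleKernel (C i) (att i)
  kernelOf i = cycle-kernel (C i) (C-cycle i) (C-null i) (att i)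

  module CK i = CycleKernel (kernelOf i)

  edge-cases : ∀ {u v s} → σ Γ u v ≡ just s →
    (∃[ a ] ∃[ b ] (φ a ≡ u × φ b ≡ v × σ T a b ≡ just s)) ⊎
    (∃[ i ] ∃[ a ] ∃[ b ] (ψ i a ≡ u × ψ i b ≡ v × σ (C i) a b ≡ just s))
  edge-cases = Equivalence.to (edges _ _ _)

  loop-absurd : ∀ (G : SignedGraph) a {s} → ¬ (σ G a a ≡ just s)
  loop-absurd G a e with trans (sym (SignedGraph.loopless G a)) e
  ... | ()

  -- A cycle meets the tree only in its attaching vertex, so an edge of a cycle between two tree
  -- vertices would be a loop.
  σ-φ : ∀ a b → σ Γ (φ a) (φ b) ≡ σ T a b
  σ-φ a b = ≡-from-just fwd (λ s e → Equivalence.from (edges _ _ s) (inj₁ (a , b , refl , refl , e)))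
    where
    fwd : ∀ s → σ Γ (φ a) (φ b) ≡ just s → σ T a b ≡ just s
    fwd s e with edge-cases e
    ... | inj₁ (a′ , b′ , p , p′ , e′) with φ-inj _ _ p | φ-inj _ _ p′
    ...   | refl | refl = e′
    fwd s e | inj₂ (i , c , d , p , p′ , e′) with TC-disj i c a p | TC-disj i d b p′
    ...   | refl | refl = ⊥-elim (loop-absurd (C i) (att i) e′)

  σ-ψ : ∀ i b c → σ Γ (ψ i b) (ψ i c) ≡ σ (C i) b c
  σ-ψ i b c = ≡-from-just fwd (λ s e → Equivalence.from (edges _ _ s) (inj₂ (i , b , c , refl , refl , e)))
    where
    fwd : ∀ s → σ Γ (ψ i b) (ψ i c) ≡ just s → σ (C i) b c ≡ just s
    fwd s e with edge-cases e
    ... | inj₁ (a , a′ , p , p′ , e′) with TC-disj i b a (sym p) | TC-disj i c a′ (sym p′)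
    ...   | refl | refl with φ-inj a a′ (trans p (sym p′))
    ...     | refl = ⊥-elim (loop-absurd T a e′)
    fwd s e | inj₂ (j , b′ , c′ , p , p′ , e′) with CC-disj j i b′ b p
    ...   | refl with ψ-inj i _ _ p | ψ-inj i _ _ p′
    ...     | refl | refl = e′

  A-zero : ∀ {u v} → (∀ s → ¬ (σ Γ u v ≡ just s)) → A Γ u v ≡ 0ℚ
  A-zero {u} {v} h with σ Γ u v
  ... | nothing = refl
  ... | just s = ⊥-elim (h s refl)

  A-zero-φ : ∀ {a} → (∀ i → leaf i ≢ a) → ∀ v → (∀ b → φ b ≢ v) → A Γ (φ a) v ≡ 0ℚ
  A-zero-φ {a} nl v h = A-zero absurd
    where
    absurd : ∀ s → ¬ (σ Γ (φ a) v ≡ just s)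
    absurd s e with edge-cases e
    ... | inj₁ (_ , b , _ , p , _) = h b p
    ... | inj₂ (i , c , d , p , _) with TC-disj i c a p
    ...   | refl = nl i (φ-inj _ _ (trans (sym (glue i)) p))

  A-zero-ψ : ∀ i {b} → b ≢ att i → ∀ v → (∀ c → ψ i c ≢ v) → A Γ (ψ i b) v ≡ 0ℚ
  A-zero-ψ i {b} nb v h = A-zero absurd
    where
    absurd : ∀ s → ¬ (σ Γ (ψ i b) v ≡ just s)
    absurd s e with edge-cases e
    ... | inj₁ (a , _ , p , _) = nb (TC-disj i b a (sym p))
    ... | inj₂ (j , c , d , p , p′ , _) with CC-disj j i c b p
    ...   | refl = h d p′

  A-zero-leaf : ∀ i v → (∀ b → φ b ≢ v) → (∀ c → ψ i c ≢ v) → A Γ (φ (leaf i)) v ≡ 0ℚ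
  A-zero-leaf i v h h′ = A-zero absurd
    where
    absurd : ∀ s → ¬ (σ Γ (φ (leaf i)) v ≡ just s)
    absurd s e with edge-cases e
    ... | inj₁ (_ , b , _ , p , _) = h b p
    ... | inj₂ (j , c , d , p , p′ , _) with CC-disj j i c (att i) (trans p (sym (glue i)))
    ...   | refl = h′ d p′

  module _ (x : Vecℚ n) where

    rowT : Fin (size T) → ℚ
    rowT a = ∑ℚ (λ b → A T a b *ℚ x (φ b))

    rowC : ∀ i → Fin (size (C i)) → ℚ
    rowC i b = ∑ℚ (λ c → A (C i) b c *ℚ x (ψ i c))

    rowΓ : Fin n → ℚ
    rowΓ u = ∑ℚ (λ v → A Γ u v *ℚ x v)

    sum-φ : ∀ a → ∑ℚ (λ b → A Γ (φ a) (φ b) *ℚ x (φ b)) ≡ rowT a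
    sum-φ a = ΣQ.∑-cong (λ b → cong (λ t → signVal t *ℚ x (φ b)) (σ-φ a b))

    sum-ψ : ∀ i b → ∑ℚ (λ c → A Γ (ψ i b) (ψ i c) *ℚ x (ψ i c)) ≡ rowC i b
    sum-ψ i b = ΣQ.∑-cong (λ c → cong (λ t → signVal t *ℚ x (ψ i c)) (σ-ψ i b c))

    row-φ : ∀ {a} → (∀ i → leaf i ≢ a) → rowΓ (φ a) ≡ rowT a
    row-φ {a} nl = trans (ΣQ.∑-reindex φ φ-inj (λ v h → trans (cong (_*ℚ x v) (A-zero-φ nl v h)) (ℚ.*-zeroˡ (x v)))) (sum-φ a)

    row-ψ : ∀ i {b} → b ≢ att i → rowΓ (ψ i b) ≡ rowC i b
    row-ψ i {b} nb = trans (ΣQ.∑-reindex (ψ i) (ψ-inj i) (λ v h → trans (cong (_*ℚ x v) (A-zero-ψ i nb v h)) (ℚ.*-zeroˡ (x v)))) (sum-ψ i b)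

    row-leaf : ∀ i → rowΓ (φ (leaf i)) ≡ rowT (leaf i) +ℚ rowC i (att i)
    row-leaf i = begin
      ∑ℚ f                                        ≡⟨ ΣQ.∑-cong split ⟩
      ∑ℚ (λ v → g₁ v +ℚ g₂ v)                     ≡⟨ ΣQ.∑-∙ g₁ g₂ ⟩
      ∑ℚ g₁ +ℚ ∑ℚ g₂                              ≡⟨ cong₂ _+ℚ_ (ΣQ.∑-reindex φ φ-inj off₁) (ΣQ.∑-reindex (ψ i) (ψ-inj i) off₂) ⟩
      ∑ℚ (λ b → g₁ (φ b)) +ℚ ∑ℚ (λ c → g₂ (ψ i c)) ≡⟨ cong₂ _+ℚ_ (ΣQ.∑-cong on₁) (ΣQ.∑-cong on₂) ⟩
      ∑ℚ (λ b → f (φ b)) +ℚ ∑ℚ (λ c → f (ψ i c))   ≡⟨ cong₂ _+ℚ_ (sum-φ (leaf i)) sumC ⟩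
      rowT (leaf i) +ℚ rowC i (att i)             ∎
      where
      open ≡-Reasoning
      u = φ (leaf i)
      f : Fin n → ℚ
      f v = A Γ u v *ℚ x v
      inT? : ∀ v → Dec (∃[ b ] (φ b ≡ v))
      inT? v = Fin.any? (λ b → φ b ≟ v)
      g₁ g₂ : Fin n → ℚ
      g₁ v = if does (inT? v) then f v else 0ℚ
      g₂ v = if does (inT? v) then 0ℚ else f v
      split : ∀ v → f v ≡ g₁ v +ℚ g₂ v
      split v with inT? v
      ... | yes _ = sym (ℚ.+-identityʳ _)
      ... | no _ = sym (ℚ.+-identityˡ _)
      off₁ : ∀ v → (∀ b → φ b ≢ v) → g₁ v ≡ 0ℚ
      off₁ v h rewrite dec-false (inT? v) (λ { (b , p) → h b p }) = refl
      off₂ : ∀ v → (∀ c → ψ i c ≢ v) → g₂ v ≡ 0ℚ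
      off₂ v h with inT? v
      ... | yes _ = refl
      ... | no nT = trans (cong (_*ℚ x v) (A-zero-leaf i v (λ b p → nT (b , p)) h)) (ℚ.*-zeroˡ (x v))
      on₁ : ∀ b → g₁ (φ b) ≡ f (φ b)
      on₁ b rewrite dec-true (inT? (φ b)) (b , refl) = refl
      on₂ : ∀ c → g₂ (ψ i c) ≡ f (ψ i c)
      on₂ c with inT? (ψ i c)
      ... | no _ = refl
      ... | yes (b , p) with TC-disj i c b (sym p)
      -- The glued vertex lies in both images. Its term was assigned to `g₁`, and nothing is missing
      -- from `g₂` because the diagonal entry of A is 0.
      ...   | refl = sym (trans (cong (λ t → signVal t *ℚ x (ψ i c)) (trans (cong (σ Γ u) (glue i)) (SignedGraph.loopless Γ u))) (ℚ.*-zeroˡ (x (ψ i c))))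
      sumC : ∑ℚ (λ c → f (ψ i c)) ≡ rowC i (att i)
      sumC = trans (ΣQ.∑-cong (λ c → cong (λ t → A Γ t (ψ i c) *ℚ x (ψ i c)) (sym (glue i)))) (sum-ψ i (att i))

    leaf? : ∀ a → Dec (∃[ i ] (leaf i ≡ a))
    leaf? a = Fin.any? (λ i → leaf i ≟ a)

    InKernel-glue : InKernel T (λ a → x (φ a)) → (∀ i → InKernel (C i) (λ b → x (ψ i b))) → InKernel Γ x
    InKernel-glue kT kC v with cover v
    ... | inj₁ (a , refl) with leaf? a
    ...   | no nl = trans (row-φ (λ i p → nl (i , p))) (kT a)
    ...   | yes (i , refl) = trans (row-leaf i) (trans (cong₂ _+ℚ_ (kT (leaf i)) (kC i (att i))) (ℚ.+-identityˡ 0ℚ))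
    InKernel-glue kT kC v | inj₂ (i , b , refl) with b ≟ att i
    ...   | no nb = trans (row-ψ i nb) (kC i b)
    ...   | yes refl = trans (cong rowΓ (glue i)) (trans (row-leaf i)
              (trans (cong₂ _+ℚ_ (kT (leaf i)) (kC i (att i))) (ℚ.+-identityˡ 0ℚ)))

    InKernel-C : InKernel Γ x → ∀ i → InKernel (C i) (λ b → x (ψ i b))
    InKernel-C k i b with b ≟ att i
    ... | no nb = trans (sym (row-ψ i nb)) (k (ψ i b))
    ... | yes refl = last-row (C i) (att i) (CK.one-ker i) (CK.one-r i)
                       (λ b nb → trans (sym (row-ψ i nb)) (k (ψ i b)))

    InKernel-T : InKernel Γ x → InKernel T (λ a → x (φ a))
    InKernel-T k a with leaf? a
    ... | no nl = trans (sym (row-φ (λ i p → nl (i , p)))) (k (φ a))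
    ... | yes (i , refl) =
      trans (sym (ℚ.+-identityʳ _)) (trans (cong (rowT (leaf i) +ℚ_) (sym (InKernel-C k i (att i))))
        (trans (sym (row-leaf i)) (k (φ (leaf i)))))

  -- `cover` picks some preimage of a vertex; `compat` makes the value independent of that choice.
  module Glued (f : Vecℚ (size T)) (g : ∀ i → Vecℚ (size (C i))) (compat : ∀ i → g i (att i) ≡ f (leaf i)) where

    glued : Vecℚ n
    glued v with cover v
    ... | inj₁ (a , _) = f a
    ... | inj₂ (i , b , _) = g i b

    glued-φ : ∀ a → glued (φ a) ≡ f a
    glued-φ a with cover (φ a)
    ... | inj₁ (a′ , p) = cong f (φ-inj a′ a p)
    ... | inj₂ (i , b , p) with TC-disj i b a p
    ...   | refl = trans (compat i) (cong f (φ-inj _ _ (trans (sym (glue i)) p)))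

    glued-ψ : ∀ i b → glued (ψ i b) ≡ g i b
    glued-ψ i b with cover (ψ i b)
    ... | inj₁ (a , p) with TC-disj i b a (sym p)
    ...   | refl = trans (cong f (φ-inj _ _ (trans p (glue i)))) (sym (compat i))
    glued-ψ i b | inj₂ (j , c , p) with CC-disj j i c b p
    ...   | refl = cong (g i) (ψ-inj i c b p)

    glued-ker : InKernel T f → (∀ i → InKernel (C i) (g i)) → InKernel Γ glued
    glued-ker kf kg = InKernel-glue glued
      (InKernel-cong T (λ a → sym (glued-φ a)) kf)
      (λ i → InKernel-cong (C i) (λ b → sym (glued-ψ i b)) (kg i))

  module Ext (f : Vecℚ (size T)) =
    Glued f (λ i b → f (leaf i) *ℚ CK.one i b)
      (λ i → trans (cong (f (leaf i) *ℚ_) (CK.one-r i)) (ℚ.*-identityʳ _))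

  zerAt : Fin q → ∀ i → Vecℚ (size (C i))
  zerAt j i b = if does (i ≟ j) then CK.zer i b else 0ℚ

  zerAt-att : ∀ j i → zerAt j i (att i) ≡ 0ℚ
  zerAt-att j i with i ≟ j
  ... | yes _ = CK.zer-r i
  ... | no _ = refl

  module Zer (j : Fin q) = Glued (λ _ → 0ℚ) (zerAt j) (zerAt-att j)

  Zer-ker : ∀ j → InKernel Γ (Zer.glued j)
  Zer-ker j = Zer.glued-ker j (InKernel-zero T) ker
    where
    ker : ∀ i → InKernel (C i) (zerAt j i)
    ker i with i ≟ j
    ... | yes _ = CK.zer-ker i
    ... | no _ = InKernel-zero (C i)

  -- The vectors `Zer` vanish on the tree, so a relation restricted to T involves only `w` and its
  -- coefficients `ct` are 0. Evaluating what remains at `y` in cycle `i` isolates the coefficient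
  -- of the `i`-th `Zer`.
  lift : ∀ {m} (w : Fin m → Vecℚ (size T)) → (∀ i → InKernel T (w i)) → LinIndep w →
    Σ (Fin (q + m) → Vecℚ n) λ w′ → (∀ i → InKernel Γ (w′ i)) × LinIndep w′
  lift {m} w Kw li = u , Ku , liu
    where
    pickVec : Fin q ⊎ Fin m → Vecℚ n
    pickVec = [ Zer.glued , (λ j → Ext.glued (w j)) ]′
    u : Fin (q + m) → Vecℚ n
    u k = pickVec (splitAt q k)
    Kpick : ∀ s → InKernel Γ (pickVec s)
    Kpick (inj₁ j) = Zer-ker j
    Kpick (inj₂ j) = Ext.glued-ker (w j) (Kw j) (λ i → InKernel-scale (C i) (w j (leaf i)) (CK.one-ker i))
    Ku : ∀ k → InKernel Γ (u k)
    Ku k = Kpick (splitAt q k)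
    liu : LinIndep u
    liu c h = result
      where
      open ≡-Reasoning
      cz : Fin q → ℚ
      cz i = c (i ↑ˡ m)
      ct : Fin m → ℚ
      ct j = c (q ↑ʳ j)
      sum-split : ∀ v → ∑ℚ (λ i → cz i *ℚ Zer.glued i v) +ℚ ∑ℚ (λ j → ct j *ℚ Ext.glued (w j) v) ≡ 0ℚ
      sum-split v = trans (sym (trans (∑ℚ-+ q (λ k → c k *ℚ u k v))
          (cong₂ _+ℚ_ (ΣQ.∑-cong (λ i → cong (λ s → cz i *ℚ pickVec s v) (Fin.splitAt-↑ˡ q i m)))
                      (ΣQ.∑-cong (λ j → cong (λ s → ct j *ℚ pickVec s v) (Fin.splitAt-↑ʳ q m j)))))) (h v)
      ct≡0 : ∀ j → ct j ≡ 0ℚ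
      ct≡0 = li ct λ a → begin
        ∑ℚ (λ j → ct j *ℚ w j a)
          ≡⟨ sym (ℚ.+-identityˡ _) ⟩
        0ℚ +ℚ ∑ℚ (λ j → ct j *ℚ w j a)
          ≡⟨ cong₂ _+ℚ_ (sym (ΣQ.∑-unit (λ i → trans (cong (cz i *ℚ_) (Zer.glued-φ i a)) (ℚ.*-zeroʳ (cz i)))))
               (ΣQ.∑-cong (λ j → cong (ct j *ℚ_) (sym (Ext.glued-φ (w j) a)))) ⟩
        ∑ℚ (λ i → cz i *ℚ Zer.glued i (φ a)) +ℚ ∑ℚ (λ j → ct j *ℚ Ext.glued (w j) (φ a))
          ≡⟨ sum-split (φ a) ⟩
        0ℚ ∎
      zerAt-same : ∀ i b → zerAt i i b ≡ CK.zer i b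
      zerAt-same i b rewrite dec-true (i ≟ i) refl = refl
      zerAt-other : ∀ {i j} b → j ≢ i → zerAt j i b ≡ 0ℚ
      zerAt-other {i} {j} b ne rewrite dec-false (i ≟ j) (λ p → ne (sym p)) = refl
      cz≡0 : ∀ i → cz i ≡ 0ℚ
      cz≡0 i = *ℚ-≢0 (CK.zer-y i) (trans (ℚ.*-comm (CK.zer i y) (cz i)) (begin
        cz i *ℚ CK.zer i y
          ≡⟨ cong (cz i *ℚ_) (sym (trans (Zer.glued-ψ i i y) (zerAt-same i y))) ⟩
        cz i *ℚ Zer.glued i (ψ i y)
          ≡⟨ sym (ΣQ.∑-single i (λ j ne → trans (cong (cz j *ℚ_) (trans (Zer.glued-ψ j i y) (zerAt-other y ne))) (ℚ.*-zeroʳ (cz j)))) ⟩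
        ∑ℚ (λ j → cz j *ℚ Zer.glued j (ψ i y))
          ≡⟨ sym (ℚ.+-identityʳ _) ⟩
        ∑ℚ (λ j → cz j *ℚ Zer.glued j (ψ i y)) +ℚ 0ℚ
          ≡⟨ cong (∑ℚ (λ j → cz j *ℚ Zer.glued j (ψ i y)) +ℚ_)
               (sym (ΣQ.∑-unit (λ j → trans (cong (_*ℚ Ext.glued (w j) (ψ i y)) (ct≡0 j)) (ℚ.*-zeroˡ (Ext.glued (w j) (ψ i y)))))) ⟩
        ∑ℚ (λ j → cz j *ℚ Zer.glued j (ψ i y)) +ℚ ∑ℚ (λ j → ct j *ℚ Ext.glued (w j) (ψ i y))
          ≡⟨ sum-split (ψ i y) ⟩
        0ℚ ∎))
        where y = CK.y i
      result : ∀ k → c k ≡ 0ℚ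
      result k with splitAt q k in eq
      ... | inj₁ i = trans (cong c (sym (Fin.splitAt⁻¹-↑ˡ eq))) (cz≡0 i)
      ... | inj₂ j = trans (cong c (sym (Fin.splitAt⁻¹-↑ʳ eq))) (ct≡0 j)

  -- One coordinate per cycle, the one at `y`, is eliminated. After that a combination vanishing on
  -- T is zero at both `att i` and `y` in every cycle, hence zero on the whole cycle, so restriction
  -- to T preserves independence.
  restrict : ∀ {m} (w : Fin (q + m) → Vecℚ n) → (∀ i → InKernel Γ (w i)) → LinIndep w →
    Σ (Fin m → Vecℚ (size T)) λ w′ → (∀ i → InKernel T (w′ i)) × LinIndep w′
  restrict {m} w Kw li = go (subst (λ t → Fam (t + m)) (sym len) (w , Kw , li))
    where
    Fam : ℕ → Set
    Fam t = Σ (Fin t → Vecℚ n) λ w → (∀ i → InKernel Γ (w i)) × LinIndep w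
    ys : List (Fin n)
    ys = tabulate (λ i → ψ i (CK.y i))
    len : length ys ≡ q
    len = length-tabulate (λ i → ψ i (CK.y i))
    go : Fam (length ys + m) → Σ (Fin m → Vecℚ (size T)) λ w′ → (∀ i → InKernel T (w′ i)) × LinIndep w′
    go (w , Kw , li) with kill-coordinates (InKernel-closed Γ) ys w Kw li
    ... | w′ , Kw′ , li′ = (λ i a → w′ i (φ a)) , (λ i → InKernel-T (w′ i) (proj₁ (Kw′ i))) , liT
      where
      liT : LinIndep (λ i a → w′ i (φ a))
      liT c h = li′ c X≡0
        where
        X : Vecℚ n
        X v = ∑ℚ (λ i → c i *ℚ w′ i v)
        KX : InKernel Γ X
        KX = InKernel-comb Γ c w′ (λ i → proj₁ (Kw′ i))
        Xψ : ∀ i b → X (ψ i b) ≡ 0ℚ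
        Xψ i = CK.det i (λ b → X (ψ i b)) (InKernel-C X KX i) (trans (cong X (glue i)) (h (leaf i)))
          (ΣQ.∑-unit (λ j → trans (cong (c j *ℚ_) (proj₂ (Kw′ j) _ (∈-tabulate⁺ i))) (ℚ.*-zeroʳ (c j))))
        X≡0 : ∀ v → X v ≡ 0ℚ
        X≡0 v with cover v
        ... | inj₁ (a , refl) = h a
        ... | inj₂ (i , b , refl) = Xψ i b

  Family : SignedGraph → ℕ → Set
  Family G k = Σ (Fin k → Vecℚ (size G)) λ w → (∀ i → InKernel G (w i)) × LinIndep w

  nullity-T⇒Γ : ∀ {k} → HasNullity T k → HasNullity Γ (q + k)
  nullity-T⇒Γ {k} ((w , Kw , li) , up) = lift w Kw li , upper
    where
    upper : ∀ (w : Fin (suc (q + k)) → Vecℚ n) → (∀ i → InKernel Γ (w i)) → ¬ LinIndep w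
    upper w Kw li =
      let w₁ , Kw₁ , li₁ = subst (Family Γ) (sym (ℕ.+-suc q k)) (w , Kw , li)
          w₂ , Kw₂ , li₂ = restrict {suc k} w₁ Kw₁ li₁
      in up w₂ Kw₂ li₂

  nullity-Γ⇒T : ∀ {k} → HasNullity Γ (q + k) → HasNullity T k
  nullity-Γ⇒T {k} ((w , Kw , li) , up) = restrict w Kw li , upper
    where
    upper : ∀ (w : Fin (suc k) → Vecℚ (size T)) → (∀ i → InKernel T (w i)) → ¬ LinIndep w
    upper w Kw li =
      let w₁ , Kw₁ , li₁ = subst (Family Γ) (ℕ.+-suc q k) (lift w Kw li)
      in up w₁ Kw₁ li₁

-- Growing a determined set

≢1⇒≥2 : ∀ {k} → 1 ≤ k → k ≢ 1 → 2 ≤ k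
≢1⇒≥2 {suc zero} _ ne = ⊥-elim (ne refl)
≢1⇒≥2 {suc (suc k)} _ _ = s≤s (s≤s z≤n)

≢0⇒≥1 : ∀ {k} → k ≢ 0 → 1 ≤ k
≢0⇒≥1 {zero} ne = ⊥-elim (ne refl)
≢0⇒≥1 {suc k} _ = s≤s z≤n

1≢0 : ∀ {k} → k ≡ 1 → k ≢ 0
1≢0 refl ()

2≰1 : ¬ (2 ≤ 1)
2≰1 (s≤s ())

deg-2-or-3 : ∀ {d} → 2 ≤ d → d ≡ 2 ⊎ 3 ≤ d
deg-2-or-3 {suc (suc zero)} _ = inj₁ refl
deg-2-or-3 {suc (suc (suc d))} _ = inj₂ (s≤s (s≤s (s≤s z≤n)))
deg-2-or-3 {suc zero} (s≤s ())

module Growth (Γ : SignedGraph) (con : Connected Γ) (deg≥2 : ∀ v → 2 ≤ deg Γ v) where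
  open Forcing Γ public

  D : ℕ
  D = ∑ℕ (λ v → deg Γ v ∸ 2)

  other? : ∀ S w t → (∃[ u ] (u ∈ₛ S × w ~ u × u ≢ t)) ⊎ (∀ u → w ~ u → u ∈ₛ S → u ≡ t)
  other? S w t with Fin.any? (λ u → (S u ∧ (adj w u ∧ not (does (u ≟ t)))) ≟ᵇ true)
  ... | yes (u , p) = let p₁ , p₂ = ∧-true p ; p₃ , p₄ = ∧-true p₂ in inj₁ (u , p₁ , p₃ , ne p₄)
    where
    ne : not (does (u ≟ t)) ≡ true → u ≢ t
    ne e refl = true≢false (trans (sym (dec-true (u ≟ u) refl)) (not-true e))
  ... | no none = inj₂ only
    where
    only : ∀ u → w ~ u → u ∈ₛ S → u ≡ t
    only u p q with u ≟ t
    ... | yes e = e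
    ... | no ne = ⊥-elim (none (u , h))
      where
      h : S u ∧ (adj w u ∧ not (does (u ≟ t))) ≡ true
      h rewrite p | q | dec-false (u ≟ t) ne = refl

  deg2-nbrs : ∀ {w t u} → deg Γ w ≡ 2 → t ≢ u → w ~ t → w ~ u → ∀ x → w ~ x → x ≡ t ⊎ x ≡ u
  deg2-nbrs e ne p q x r = #≡2-only e ne p q x r

  θ : Subset → V → ℕ
  θ S v = if S v then out S v else deg Γ v ∸ 2

  -- When S induces a connected subgraph of cyclomatic number k, this is 2 (c(Γ) − k).
  Θ : Subset → ℕ
  Θ S = ∑ℕ (θ S)

  θ-∈ : ∀ {S v} → v ∈ₛ S → θ S v ≡ out S v
  θ-∈ p rewrite p = refl

  θ-∉ : ∀ {S v} → v ∉ₛ S → θ S v ≡ deg Γ v ∸ 2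
  θ-∉ p rewrite p = refl

  ∈-or-∉ : ∀ S v → v ∈ₛ S ⊎ v ∉ₛ S
  ∈-or-∉ S v with S v
  ... | true = inj₁ refl
  ... | false = inj₂ refl

  Θ-⟦⟧ : ∀ r → Θ ⟦ r ⟧ ≡ 2 + D
  Θ-⟦⟧ r = trans (ΣN.∑-cong pointwise)
      (trans (ΣN.∑-∙ (λ v → deg Γ v ∸ 2) (ΣN.at r 2)) (trans (cong (D +_) (ΣN.∑-at r 2)) (ℕ.+-comm D 2)))
    where
    pointwise : ∀ v → θ ⟦ r ⟧ v ≡ (deg Γ v ∸ 2) + ΣN.at r 2 v
    pointwise v with v ≟ r
    ... | no _ = sym (ℕ.+-identityʳ _)
    ... | yes refl = trans (out-⟦⟧ r) (sym (ℕ.m∸n+n≡m (deg≥2 r)))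

  OnlyNbr : Subset → V → V → Set
  OnlyNbr S w t = ∀ u → w ~ u → u ∈ₛ S → u ≡ t

  -- `t` loses one outside neighbour, while `w` exchanges deg w - 2 for out(w) = deg w - 1. The gain
  -- and the loss sit at different vertices, so a point mass is added on each side before comparing
  -- termwise.
  Θ-add-one : ∀ {S w t} → w ∉ₛ S → t ∈ₛ S → w ~ t → OnlyNbr S w t → Θ (add S w) ≡ Θ S
  Θ-add-one {S} {w} {t} w∉ t∈ w~t only = ℕ.+-cancelʳ-≡ 1 _ _ (begin
    Θ (add S w) + 1                              ≡⟨ cong (Θ (add S w) +_) (sym (ΣN.∑-at t 1)) ⟩
    Θ (add S w) + ∑ℕ (ΣN.at t 1)                 ≡⟨ sym (ΣN.∑-∙ (θ (add S w)) (ΣN.at t 1)) ⟩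
    ∑ℕ (λ v → θ (add S w) v + ΣN.at t 1 v)       ≡⟨ ΣN.∑-cong pointwise ⟩
    ∑ℕ (λ v → θ S v + ΣN.at w 1 v)               ≡⟨ ΣN.∑-∙ (θ S) (ΣN.at w 1) ⟩
    Θ S + ∑ℕ (ΣN.at w 1)                         ≡⟨ cong (Θ S +_) (ΣN.∑-at w 1) ⟩
    Θ S + 1                                      ∎)
    where
    open ≡-Reasoning
    arith : ∀ {k d} → k + 1 ≡ d → 2 ≤ d → k ≡ d ∸ 2 + 1
    arith {k} {d} e p = ℕ.+-cancelʳ-≡ 1 k _ (trans e (sym (trans (ℕ.+-assoc (d ∸ 2) 1 1) (ℕ.m∸n+n≡m p))))
    pointwise : ∀ v → θ (add S w) v + ΣN.at t 1 v ≡ θ S v + ΣN.at w 1 v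
    pointwise v with v ≟ t | v ≟ w
    ... | yes refl | yes refl = ⊥-elim (~-irrefl w~t)
    ... | yes refl | no _ rewrite t∈ = trans (ℕ.+-comm _ 1) (trans (out-add-adj {S} w∉ (~-sym w~t)) (sym (ℕ.+-identityʳ _)))
    ... | no _ | yes refl rewrite w∉ =
      trans (ℕ.+-identityʳ _) (trans (out-add-self {S} w∉) (arith (inn-one {S} w~t t∈ only) (deg≥2 w)))
    ... | no v≢t | no v≢w with S v in eq
    ...   | true = cong (_+ 0) (out-add-nonadj {S} w∉ (λ p → v≢t (only v (~-sym p) eq)))
    ...   | false = refl

  -- `t` and `u` lose one outside neighbour each, and `w` keeps its value, as now out(w) = deg w -
  -- 2.
  Θ-add-two : ∀ {S w t u} → w ∉ₛ S → t ≢ u → t ∈ₛ S → w ~ t → u ∈ₛ S → w ~ u →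
    (∀ x → w ~ x → x ∈ₛ S → x ≡ t ⊎ x ≡ u) → Θ (add S w) + 2 ≡ Θ S
  Θ-add-two {S} {w} {t} {u} w∉ t≢u t∈ w~t u∈ w~u only = begin
    Θ (add S w) + 2
      ≡⟨ cong (Θ (add S w) +_) (sym (trans (ΣN.∑-∙ (ΣN.at t 1) (ΣN.at u 1)) (cong₂ _+_ (ΣN.∑-at t 1) (ΣN.∑-at u 1)))) ⟩
    Θ (add S w) + ∑ℕ (λ v → ΣN.at t 1 v + ΣN.at u 1 v)
      ≡⟨ sym (ΣN.∑-∙ (θ (add S w)) (λ v → ΣN.at t 1 v + ΣN.at u 1 v)) ⟩
    ∑ℕ (λ v → θ (add S w) v + (ΣN.at t 1 v + ΣN.at u 1 v))
      ≡⟨ ΣN.∑-cong pointwise ⟩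
    Θ S ∎
    where
    open ≡-Reasoning
    pointwise : ∀ v → θ (add S w) v + (ΣN.at t 1 v + ΣN.at u 1 v) ≡ θ S v
    pointwise v with v ≟ t | v ≟ u
    ... | yes refl | yes refl = ⊥-elim (t≢u refl)
    ... | yes refl | no _ rewrite t∈ = trans (ℕ.+-comm _ 1) (out-add-adj {S} w∉ (~-sym w~t))
    ... | no _ | yes refl rewrite u∈ = trans (ℕ.+-comm _ 1) (out-add-adj {S} w∉ (~-sym w~u))
    ... | no v≢t | no v≢u = trans (ℕ.+-identityʳ _) rest-case
      where
      rest-case : θ (add S w) v ≡ θ S v
      rest-case with S v in eq | v ≟ w
      ... | true | _ = out-add-nonadj {S} w∉ (λ p → [ v≢t , v≢u ]′ (only v (~-sym p) eq))
      ... | false | no _ = refl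
      ... | false | yes refl = trans (out-add-self {S} w∉)
              (trans (sym (ℕ.m+n∸n≡m (out S w) 2)) (cong (_∸ 2) (inn-two {S} t≢u w~t t∈ w~u u∈ only)))

  -- A certificate, through `nullity≤`, that the nullity is at most `b`; `root` makes `S` nonempty.
  -- The converse direction is bookkeeping on `b`: it starts at D + 2 and, when η(Γ) = D + 1, can
  -- never be D.
  record Reach (b : ℕ) (S : Subset) : Set where
    field
      fs    : List V
      root  : V
      root∈ : root ∈ₛ S
      det   : Det S fs
      bound : length fs + Φ S ≤ b
  open Reach

  private
    shrink : ∀ {b S} (r : Reach b S) {d} w → d + Φ (add S w) ≤ Φ S → length (fs r) + (d + Φ (add S w)) ≤ b
    shrink {S = S} r w le = ℕ.≤-trans (ℕ.+-monoʳ-≤ (length (fs r)) le) (bound r)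

    swap+ : ∀ l d p → l + (d + p) ≡ d + (l + p)
    swap+ l d p = trans (sym (ℕ.+-assoc l d p)) (trans (cong (_+ p) (ℕ.+-comm l d)) (ℕ.+-assoc d l p))

  reach-force : ∀ {b S v w} d → Reach (d + b) S → out S v ≡ 1 → v ~ w → w ∉ₛ S →
    d + Φ (add S w) ≤ Φ S → Reach b (add S w)
  reach-force {b} {S} {v} {w} d r e p q le = record
    { fs = fs r ; root = root r ; root∈ = add-keep S w _ (root∈ r) ; det = Det-force {S} e p q (det r)
    ; bound = ℕ.+-cancelˡ-≤ d _ _ (subst (_≤ d + b) (swap+ (length (fs r)) d _) (shrink r w le)) }

  -- A freely chosen coordinate lengthens `fs`, hence `suc d`: one unit of the decrease of Φ pays
  -- for it and the other `d` units lower the bound.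
  reach-param : ∀ {b S} d w → Reach (d + b) S → suc d + Φ (add S w) ≤ Φ S → Reach b (add S w)
  reach-param {b} {S} d w r le = record
    { fs = w ∷ fs r ; root = root r ; root∈ = add-keep S w _ (root∈ r) ; det = Det-param {S} w (det r)
    ; bound = ℕ.+-cancelˡ-≤ d _ _ (subst (_≤ d + b)
        (trans (swap+ (length (fs r)) (suc d) _) (sym (ℕ.+-suc d _))) (shrink r w le)) }

  reach-⟦⟧ : ∀ r → Reach (2 + D) ⟦ r ⟧
  reach-⟦⟧ r = record
    { fs = r ∷ [] ; root = r ; root∈ = ⟦⟧-self r ; det = Det-⟦⟧ r
    ; bound = ℕ.≤-reflexive (cong suc (trans (Φ-⟦⟧ r (deg≥2 r)) (ℕ.+-comm D 1))) }

  -- A tip is a vertex of S with exactly one neighbour outside S: its kernel equation determines that neighbour.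
  Tipless : Subset → Set
  Tipless S = ∀ u → u ∈ₛ S → out S u ≢ 1

  TipsIn : Subset → (V → Set) → Set
  TipsIn S Q = ∀ u → u ∈ₛ S → out S u ≡ 1 → Q u

  -- A new vertex that is still open has met the set through a single edge. This later fixes the
  -- degree at the foot of a pendant cycle.
  New : Subset → Subset → Set
  New S S′ = ∀ u → u ∈ₛ S′ → u ∉ₛ S → out S′ u ≡ 0 ⊎ deg Γ u ≡ suc (out S′ u)

  record AddOne (S : Subset) (w t : V) : Set where
    constructor addOne
    field
      w∉   : w ∉ₛ S
      t∈   : t ∈ₛ S
      w~t  : w ~ t
      only : OnlyNbr S w t

  addOne-out-w : ∀ {S w t} → AddOne S w t → suc (out (add S w) w) ≡ deg Γ w
  addOne-out-w {S} (addOne w∉ t∈ w~t only) =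
    trans (cong suc (out-add-self {S} w∉)) (trans (ℕ.+-comm 1 _) (inn-one {S} w~t t∈ only))

  addOne-out-other : ∀ {S w t u} → AddOne S w t → u ∈ₛ S → u ≢ t → out (add S w) u ≡ out S u
  addOne-out-other {S} (addOne w∉ t∈ w~t only) u∈ ne = out-add-nonadj {S} w∉ (λ p → ne (only _ (~-sym p) u∈))

  addOne-out-t : ∀ {S w t} → AddOne S w t → suc (out (add S w) t) ≡ out S t
  addOne-out-t {S} (addOne w∉ t∈ w~t only) = out-add-adj {S} w∉ (~-sym w~t)

  -- The outcome of following forced vertices of degree 2 from a tip `t`. The walk stops in front of
  -- `w`, the first vertex that has degree at least 3 or a second neighbour in the set, and leaves
  -- `w` outside, since what its entry saves depends on the situation. `Q` records what has to be
  -- remembered on the way.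
  record Walk (Q : Subset → V → Set) (b : ℕ) (S : Subset) (t : V) : Set where
    field
      S*    : Subset
      t* w  : V
      reach : Reach b S*
      q     : Q S* t*
      sub   : S ⊆ₛ S*
      t*∈   : t* ∈ₛ S*
      tip   : out S* t* ≡ 1
      t*~w  : t* ~ w
      w∉    : w ∉ₛ S*
      keep  : ∀ u → u ∈ₛ S → u ≢ t → out S* u ≡ out S u
      new   : ∀ u → u ∈ₛ S* → u ≢ t* → (u ∈ₛ S × u ≢ t) ⊎ out S* u ≡ 0
      start : t* ≡ t ⊎ t* ∉ₛ S
      stop  : 3 ≤ deg Γ w ⊎ (deg Γ w ≡ 2 × ∃[ u ] (u ∈ₛ S* × w ~ u × u ≢ t*))

  StepClosed : (Subset → V → Set) → Set
  StepClosed Q = ∀ {S t w} → Q S t → AddOne S w t → deg Γ w ≡ 2 → Q (add S w) w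

  walk : ∀ {Q} → StepClosed Q → ∀ m {b S t} → rest S < m → Reach b S → Q S t → t ∈ₛ S → out S t ≡ 1 → Walk Q b S t
  walk {Q} step (suc m) {b} {S} {t} (s≤s lt) r q t∈ tip with out-witness {S} (ℕ.≤-reflexive (sym tip))
  ... | w , t~w , w∉ with other? S w t | deg-2-or-3 (deg≥2 w)
  ...   | _ | inj₂ d3 = record
    { S* = S ; t* = t ; w = w ; reach = r ; q = q ; sub = λ _ p → p ; t*∈ = t∈ ; tip = tip ; t*~w = t~w ; w∉ = w∉
    ; keep = λ _ _ _ → refl ; new = λ u u∈ ne → inj₁ (u∈ , ne) ; start = inj₁ refl ; stop = inj₁ d3 }
  ...   | inj₁ oth | inj₁ d2 = record
    { S* = S ; t* = t ; w = w ; reach = r ; q = q ; sub = λ _ p → p ; t*∈ = t∈ ; tip = tip ; t*~w = t~w ; w∉ = w∉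
    ; keep = λ _ _ _ → refl ; new = λ u u∈ ne → inj₁ (u∈ , ne) ; start = inj₁ refl ; stop = inj₂ (d2 , oth) }
  ...   | inj₂ only | inj₁ d2 = record
    { S* = R.S* ; t* = R.t* ; w = R.w ; reach = R.reach ; q = R.q
    ; sub = λ v p → R.sub v (add-keep S w v p) ; t*∈ = R.t*∈ ; tip = R.tip ; t*~w = R.t*~w ; w∉ = R.w∉
    ; keep = keep ; new = new ; start = inj₂ start ; stop = R.stop }
    where
    a : AddOne S w t
    a = addOne w∉ t∈ (~-sym t~w) only
    rec : Walk Q b (add S w) w
    rec = walk step m (ℕ.<-≤-trans (rest-add {S} w∉) lt)
            (reach-force 0 r tip t~w w∉ (Φ-add {S} w∉ t∈ (~-sym t~w))) (step q a d2)
            (add-self S w) (ℕ.suc-injective (trans (addOne-out-w a) d2))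
    module R = Walk rec
    start : R.t* ∉ₛ S
    start = [ (λ e → subst (_∉ₛ S) (sym e) w∉) , (λ t∉ → proj₁ (add-∉-inv {S} t∉)) ]′ R.start
    keep : ∀ u → u ∈ₛ S → u ≢ t → out R.S* u ≡ out S u
    keep u u∈ ne = trans (R.keep u (add-keep S w u u∈) (∈∉⇒≢ {S} u∈ w∉)) (addOne-out-other a u∈ ne)
    new : ∀ u → u ∈ₛ R.S* → u ≢ R.t* → (u ∈ₛ S × u ≢ t) ⊎ out R.S* u ≡ 0
    new u u∈ ne with R.new u u∈ ne
    ... | inj₂ z = inj₂ z
    ... | inj₁ (u∈′ , u≢w) with add-inv {S} u∈′
    ...   | inj₂ e = ⊥-elim (u≢w e)
    ...   | inj₁ u∈S with u ≟ t
    ...     | no u≢t = inj₁ (u∈S , u≢t)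
    ...     | yes refl = inj₂ (trans (R.keep u u∈′ u≢w) (ℕ.suc-injective (trans (addOne-out-t a) tip)))

-- A single exploration step from a set without tips

module Stepping (Γ : SignedGraph) (con : Connected Γ) (deg≥2 : ∀ v → 2 ≤ deg Γ v) where
  open Growth Γ con deg≥2 public
  open Reach

  reach-≤ : ∀ {b b′ S} → b ≤ b′ → Reach b S → Reach b′ S
  reach-≤ le r = record { fs = fs r ; root = root r ; root∈ = root∈ r ; det = det r ; bound = ℕ.≤-trans (bound r) le }

  record AddTwo (S : Subset) (w t u : V) : Set where
    field
      w∉   : w ∉ₛ S
      t≢u  : t ≢ u
      t∈   : t ∈ₛ S
      w~t  : w ~ t
      u∈   : u ∈ₛ S
      w~u  : w ~ u
      only : ∀ x → w ~ x → x ∈ₛ S → x ≡ t ⊎ x ≡ u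

  module AddTwo-out {S w t u} (a : AddTwo S w t u) where
    open AddTwo a

    out-w : out (add S w) w + 2 ≡ deg Γ w
    out-w = trans (cong (_+ 2) (out-add-self {S} w∉)) (inn-two {S} t≢u w~t t∈ w~u u∈ only)

    out-t : suc (out (add S w) t) ≡ out S t
    out-t = out-add-adj {S} w∉ (~-sym w~t)

    out-u : suc (out (add S w) u) ≡ out S u
    out-u = out-add-adj {S} w∉ (~-sym w~u)

    out-other : ∀ {v} → v ∈ₛ S → v ≢ t → v ≢ u → out (add S w) v ≡ out S v
    out-other v∈ v≢t v≢u = out-add-nonadj {S} w∉ (λ p → [ v≢t , v≢u ]′ (only _ (~-sym p) v∈))

    Θ-eq : Θ (add S w) + 2 ≡ Θ S
    Θ-eq = Θ-add-two w∉ t≢u t∈ w~t u∈ w~u only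

  addTwo-deg2 : ∀ {S w t u} → w ∉ₛ S → t ≢ u → t ∈ₛ S → w ~ t → u ∈ₛ S → w ~ u → deg Γ w ≡ 2 → AddTwo S w t u
  addTwo-deg2 w∉ ne t∈ w~t u∈ w~u d = record
    { w∉ = w∉ ; t≢u = ne ; t∈ = t∈ ; w~t = w~t ; u∈ = u∈ ; w~u = w~u
    ; only = λ x p _ → deg2-nbrs d ne w~t w~u x p }

  PClosed : (Subset → Set) → Set
  PClosed P = ∀ {S w t} → P S → AddOne S w t → P (add S w)

  -- The newest vertex stands at the head, so a walk leaving `o` extends its chain by one
  -- constructor per vertex.
  data Chain (o : V) : List V → Set where
    one  : ∀ {w} → o ~ w → deg Γ w ≡ 2 → Chain o (w ∷ [])
    next : ∀ {w t ws} → Chain o (t ∷ ws) → t ~ w → deg Γ w ≡ 2 → w ≢ o → w ∉ (t ∷ ws) →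
           Chain o (w ∷ t ∷ ws)

  -- At least two interior vertices are required, so that the two edges at `o` are different and the
  -- cycle has length at least 3.
  record Loop (o : V) : Set where
    field
      t u   : V
      us    : List V
      chain : Chain o (t ∷ u ∷ us)
      close : t ~ o
    interior : List V
    interior = t ∷ u ∷ us
  open Loop public using (interior)

  record Trail (P : Subset → Set) (o : V) (S S* : Subset) (t : V) : Set where
    field
      pS    : P S*
      ws    : List V
      chain : Chain o (t ∷ ws)
      old   : S ⊆ₛ S*
      inS   : ∀ x → x ∈ (t ∷ ws) → x ∈ₛ S*
      notS  : ∀ x → x ∈ (t ∷ ws) → x ∉ₛ S

  trail-step : ∀ {P o S} → PClosed P → o ∈ₛ S → StepClosed (Trail P o S)
  trail-step {P} {o} {S} closedP o∈ {S*} {t} {x} tr b d = record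
    { pS = closedP pS b ; ws = t ∷ ws
    ; chain = next chain (~-sym (AddOne.w~t b)) d (λ { refl → clash {S*} (old o o∈) x∉ })
                (λ x∈ → clash {S*} (inS x x∈) x∉)
    ; old = λ v v∈ → add-keep S* x v (old v v∈)
    ; inS = λ { y (here refl) → add-self S* x ; y (there y∈) → add-keep S* x y (inS y y∈) }
    ; notS = λ { y (here refl) → ≢true⇒false (λ y∈ → clash {S*} (old y y∈) x∉) ; y (there y∈) → notS y y∈ } }
    where
    open Trail tr
    x∉ : x ∉ₛ S*
    x∉ = AddOne.w∉ b

  record FreshOut (P : Subset → Set) (b : ℕ) (S : Subset) : Set where
    field
      S′      : Subset
      reach   : Reach b S′
      p       : P S′
      tipless : Tipless S′
      sub     : S ⊆ₛ S′
      w       : V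
      w∈      : w ∈ₛ S′
      w∉      : w ∉ₛ S
      w≥2     : 2 ≤ out S′ w
      w-deg   : deg Γ w ≡ suc (out S′ w)
      new     : New S S′

  record Saved₁ (b : ℕ) : Set where
    field
      S′    : Subset
      x     : V
      reach : Reach b S′
      x∈    : x ∈ₛ S′
      x≥1   : 1 ≤ out S′ x
      tips  : TipsIn S′ (_≡ x)

  -- After a cycle has closed at a vertex of degree 2, two vertices may be tips. `S` is the set just
  -- before, where `P` still holds, so that the loss of 2 in Θ can be read off from `addTwo`.
  record Saved₂ (P : Subset → Set) (b : ℕ) : Set where
    field
      S     : Subset
      w t u : V
      addTwo : AddTwo S w t u
      p     : P S
      reach : Reach b (add S w)
      x y   : V
      x≢y   : x ≢ y
      x∈    : x ∈ₛ add S w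
      y∈    : y ∈ₛ add S w
      x≥1   : 1 ≤ out (add S w) x
      y≥1   : 1 ≤ out (add S w) y
      tips  : TipsIn (add S w) (λ z → z ≡ x ⊎ z ≡ y)

  -- A step starts with bound `suc b`. `fresh` keeps this bound on a larger set without tips, the
  -- two saved cases lower it to `b`, and `loop` is the one way of closing a cycle that need not
  -- lower it.
  data StepOut (P : Subset → Set) (b : ℕ) (S : Subset) (o : V) : Set where
    loop   : (ℓ : Loop o) → (∀ x → x ∈ interior ℓ → x ∉ₛ S) → StepOut P b S o
    fresh  : FreshOut P (suc b) S → StepOut P b S o
    saved₁ : Saved₁ b → StepOut P b S o
    saved₂ : Saved₂ P b → StepOut P b S o

  absurd-reach : (∀ {b S} → Reach b S → suc D ≤ b) → ∀ {S} → Reach D S → ⊥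
  absurd-reach lower r = ℕ.<-irrefl refl (lower r)

  -- Since `b` is at most D + 1, a saving of two would bring the bound `suc b` down to D and is
  -- contradictory; a saving of one is reported as an outcome. The module is used with `b` = D + 1
  -- while one drop is still allowed, and with `b` = D afterwards.
  module Tip (lower : ∀ {b S} → Reach b S → suc D ≤ b) {P : Subset → Set} (closedP : PClosed P) {b} (b≤ : b ≤ suc D) where

    finish : ∀ {S t} → TipsIn S (_≡ t) → Walk (λ S _ → P S) (suc b) S t →
      (Σ (FreshOut P (suc b) S) λ F → ∀ u → u ∈ₛ S → u ≢ t → out (FreshOut.S′ F) u ≡ out S u) ⊎ Saved₁ b
    finish {S} {t} tips wk = go (other? W.S* W.w W.t*)
      where
      module W = Walk wk
      w~t* : W.w ~ W.t*
      w~t* = ~-sym W.t*~w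
      settled : ∀ u → u ∈ₛ W.S* → u ≢ W.t* → out W.S* u ≢ 1
      settled u u∈ ne e with W.new u u∈ ne
      ... | inj₂ z = 1≢0 e z
      ... | inj₁ (u∈S , u≢t) = u≢t (tips u u∈S (trans (sym (W.keep u u∈S u≢t)) e))
      go : (∃[ u ] (u ∈ₛ W.S* × W.w ~ u × u ≢ W.t*)) ⊎ OnlyNbr W.S* W.w W.t* → _
      go (inj₁ (u , u∈ , w~u , u≢t*)) = hit (deg-2-or-3 (deg≥2 W.w))
        where
        u≥2 : 2 ≤ out W.S* u
        u≥2 = ≢1⇒≥2 (out≥1 {W.S*} (~-sym w~u) W.w∉) (settled u u∈ u≢t*)
        hit : deg Γ W.w ≡ 2 ⊎ 3 ≤ deg Γ W.w → _
        -- One unit is saved at the old vertex `u` and one at the new vertex of degree at least 3.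
        hit (inj₂ d3) = ⊥-elim (absurd-reach lower (reach-force 2 (reach-≤ (s≤s b≤) W.reach) W.tip W.t*~w W.w∉
          (Φ-add-nbr-new {W.S*} W.w∉ W.t*∈ w~t* (u≢t* ∘ sym) u∈ w~u u∈ (~-sym w~u) u≥2 d3)))
        hit (inj₁ d2) = inj₂ record
          { S′ = add W.S* W.w ; x = u
          ; reach = reach-force 1 W.reach W.tip W.t*~w W.w∉ (Φ-add-nbr {W.S*} W.w∉ W.t*∈ w~t* u∈ (~-sym w~u) u≥2)
          ; x∈ = add-keep W.S* W.w u u∈
          ; x≥1 = ℕ.≤-pred (subst (2 ≤_) (sym O.out-u) u≥2)
          ; tips = tips′ }
          where
          module O = AddTwo-out (addTwo-deg2 {W.S*} W.w∉ (u≢t* ∘ sym) W.t*∈ w~t* u∈ w~u d2)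
          tips′ : TipsIn (add W.S* W.w) (_≡ u)
          tips′ y y∈ e with add-inv {W.S*} y∈
          ... | inj₂ refl = ⊥-elim (1≢0 e (ℕ.+-cancelʳ-≡ 2 _ 0 (trans O.out-w d2)))
          ... | inj₁ y∈* with y ≟ u | y ≟ W.t*
          ...   | yes q | _ = q
          ...   | no _ | yes refl = ⊥-elim (1≢0 e (ℕ.suc-injective (trans O.out-t W.tip)))
          ...   | no y≢u | no y≢t* = ⊥-elim (settled y y∈* y≢t* (trans (sym (O.out-other y∈* y≢t* y≢u)) e))
      go (inj₂ only) = inj₁ (F , keep)
        where
        d3 : 3 ≤ deg Γ W.w
        d3 with W.stop
        ... | inj₁ d = d
        ... | inj₂ (_ , u , u∈ , w~u , ne) = ⊥-elim (ne (only u w~u u∈))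
        a : AddOne W.S* W.w W.t*
        a = addOne W.w∉ W.t*∈ w~t* only
        S′ : Subset
        S′ = add W.S* W.w
        w≥2 : 2 ≤ out S′ W.w
        w≥2 = ℕ.≤-pred (subst (3 ≤_) (sym (addOne-out-w a)) d3)
        t*-zero : out S′ W.t* ≡ 0
        t*-zero = ℕ.suc-injective (trans (addOne-out-t a) W.tip)
        tipless : Tipless S′
        tipless y y∈ e with add-inv {W.S*} y∈
        ... | inj₂ refl = 2≰1 (subst (2 ≤_) e w≥2)
        ... | inj₁ y∈* with y ≟ W.t*
        ...   | yes refl = 1≢0 e t*-zero
        ...   | no ne = settled y y∈* ne (trans (sym (addOne-out-other a y∈* ne)) e)
        new : New S S′
        new y y∈ y∉ with add-inv {W.S*} y∈
        ... | inj₂ refl = inj₂ (sym (addOne-out-w a))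
        ... | inj₁ y∈* with y ≟ W.t*
        ...   | yes refl = inj₁ t*-zero
        ...   | no ne with W.new y y∈* ne
        ...     | inj₂ z = inj₁ (trans (addOne-out-other a y∈* ne) z)
        ...     | inj₁ (y∈S , _) = ⊥-elim (clash {S} y∈S y∉)
        keep : ∀ u → u ∈ₛ S → u ≢ t → out S′ u ≡ out S u
        keep u u∈ ne with u ≟ W.t*
        ... | no ne* = trans (addOne-out-other a (W.sub u u∈) ne*) (W.keep u u∈ ne)
        ... | yes refl = ⊥-elim (ne (tips u u∈ (trans (sym (W.keep u u∈ ne)) W.tip)))
        F : FreshOut P (suc b) S
        F = record
          { S′ = S′
          ; reach = reach-force 0 W.reach W.tip W.t*~w W.w∉ (Φ-add {W.S*} W.w∉ W.t*∈ w~t*)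
          ; p = closedP W.q a ; tipless = tipless
          ; sub = λ v v∈ → add-keep W.S* W.w v (W.sub v v∈)
          ; w = W.w ; w∈ = add-self W.S* W.w
          ; w∉ = ≢true⇒false (λ w∈S → clash {W.S*} (W.sub W.w w∈S) W.w∉)
          ; w≥2 = w≥2 ; w-deg = sym (addOne-out-w a) ; new = new }

    tipWalk : ∀ {S t} → Reach (suc b) S → P S → t ∈ₛ S → out S t ≡ 1 → TipsIn S (_≡ t) →
      (Σ (FreshOut P (suc b) S) λ F → ∀ u → u ∈ₛ S → u ≢ t → out (FreshOut.S′ F) u ≡ out S u) ⊎ Saved₁ b
    tipWalk {S} {t} r p t∈ tip tips =
      finish tips (walk {Q = λ S _ → P S} (λ q a _ → closedP q a) (suc (rest S)) ℕ.≤-refl r p t∈ tip)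

    -- Only `o` can have become a tip, by losing an outside neighbour; a second walk, from `o`,
    -- removes it. That walk leaves out(w) alone because `w` is not `o`.
    afterFresh : ∀ {S o S₁ w} → o ∈ₛ S → Reach (suc b) S₁ → P S₁ → S ⊆ₛ S₁ → w ∈ₛ S₁ → w ∉ₛ S →
      2 ≤ out S₁ w → deg Γ w ≡ suc (out S₁ w) → New S S₁ → TipsIn S₁ (_≡ o) → StepOut P b S o
    afterFresh {S} {o} {S₁} {w} o∈ r p sub w∈ w∉ w≥2 wd new tips with out S₁ o ≟ℕ 1
    ... | no ne = fresh record
      { S′ = S₁ ; reach = r ; p = p ; tipless = λ u u∈ e → ne (trans (sym (cong (out S₁) (tips u u∈ e))) e)
      ; sub = sub ; w = w ; w∈ = w∈ ; w∉ = w∉ ; w≥2 = w≥2 ; w-deg = wd ; new = new }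
    ... | yes e with tipWalk r p (sub o o∈) e tips
    ...   | inj₂ s = saved₁ s
    ...   | inj₁ (F , keep) = fresh record
      { S′ = F.S′ ; reach = F.reach ; p = F.p ; tipless = F.tipless ; sub = λ v v∈ → F.sub v (sub v v∈)
      ; w = w ; w∈ = F.sub w w∈ ; w∉ = w∉
      ; w≥2 = subst (2 ≤_) (sym w-same) w≥2 ; w-deg = trans wd (cong suc (sym w-same)) ; new = new′ }
      where
      module F = FreshOut F
      w-same : out F.S′ w ≡ out S₁ w
      w-same = keep w w∈ (∈∉⇒≢ {S} o∈ w∉ ∘ sym)
      new′ : New S F.S′
      new′ u u∈ u∉ with ∈-or-∉ S₁ u
      ... | inj₂ u∉₁ = F.new u u∈ u∉₁
      ... | inj₁ u∈₁ rewrite keep u u∈₁ (∈∉⇒≢ {S} o∈ u∉ ∘ sym) = new u u∈₁ u∉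

    -- A path of vertices of degree 2 has left `o`. Apart from its end `t*`, only `o` can have been
    -- brought down to out = 1, so meeting any other old vertex saves at that vertex. Coming back to
    -- `o` through a vertex of degree 2 is the outcome `loop`.
    afterWalk : ∀ {S o w} → Tipless S → o ∈ₛ S → 2 ≤ out S o → AddOne S w o →
      Walk (Trail P o S) (suc b) (add S w) w → StepOut P b S o
    afterWalk {S} {o} {w} tl o∈ o≥2 a wk = walked (other? W.S* W.w W.t*) (deg-2-or-3 (deg≥2 W.w))
      where
      S₁ : Subset
      S₁ = add S w
      o∈₁ : o ∈ₛ S₁
      o∈₁ = add-keep S w o o∈
      o≢w : o ≢ w
      o≢w = ∈∉⇒≢ {S} o∈ (AddOne.w∉ a)
      o₁≥1 : 1 ≤ out S₁ o
      o₁≥1 = ℕ.≤-pred (subst (2 ≤_) (sym (addOne-out-t a)) o≥2)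
      settled₁ : ∀ y → y ∈ₛ S → y ≢ o → out S₁ y ≢ 1
      settled₁ y y∈ ne e = tl y y∈ (trans (sym (addOne-out-other a y∈ ne)) e)
      module W = Walk wk
      module T = Trail W.q
      w~t* : W.w ~ W.t*
      w~t* = ~-sym W.t*~w
      o∈* : o ∈ₛ W.S*
      o∈* = W.sub o o∈₁
      o*≥1 : 1 ≤ out W.S* o
      o*≥1 = subst (1 ≤_) (sym (W.keep o o∈₁ o≢w)) o₁≥1
      o≢t* : o ≢ W.t*
      o≢t* e = ∈∉⇒≢ {S} o∈ (T.notS W.t* (here refl)) e
      settled : ∀ y → y ∈ₛ W.S* → y ≢ W.t* → y ≢ o → out W.S* y ≢ 1
      settled y y∈ ne y≢o e with W.new y y∈ ne
      ... | inj₂ z = 1≢0 e z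
      ... | inj₁ (y∈₁ , y≢w) with add-inv {S} y∈₁
      ...   | inj₂ q = y≢w q
      ...   | inj₁ y∈S = settled₁ y y∈S y≢o (trans (sym (W.keep y y∈₁ y≢w)) e)
      nbr≥2 : ∀ y → y ∈ₛ W.S* → W.w ~ y → y ≢ W.t* → y ≢ o → 2 ≤ out W.S* y
      nbr≥2 y y∈ w~y ne y≢o = ≢1⇒≥2 (out≥1 {W.S*} (~-sym w~y) W.w∉) (settled y y∈ ne y≢o)
      save₂ : ∀ u v → u ≢ W.t* → u ∈ₛ W.S* → W.w ~ u → v ∈ₛ W.S* → W.w ~ v → 2 ≤ out W.S* v → 3 ≤ deg Γ W.w → ⊥
      save₂ u v u≢t* u∈ w~u v∈ w~v k d = absurd-reach lower (reach-force 2 (reach-≤ (s≤s b≤) W.reach) W.tip W.t*~w W.w∉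
        (Φ-add-nbr-new {W.S*} W.w∉ W.t*∈ w~t* (u≢t* ∘ sym) u∈ w~u v∈ (~-sym w~v) k d))
      S′ : Subset
      S′ = add W.S* W.w
      walked : (∃[ u ] (u ∈ₛ W.S* × W.w ~ u × u ≢ W.t*)) ⊎ OnlyNbr W.S* W.w W.t* →
        deg Γ W.w ≡ 2 ⊎ 3 ≤ deg Γ W.w → StepOut P b S o
      walked (inj₁ (u , u∈ , w~u , u≢t*)) dw with u ≟ o | dw
      ... | no u≢o | inj₂ d3 = ⊥-elim (save₂ u u u≢t* u∈ w~u u∈ w~u (nbr≥2 u u∈ w~u u≢t* u≢o) d3)
      ... | no u≢o | inj₁ dd = saved₂ record
        { S = W.S* ; w = W.w ; t = W.t* ; u = u ; addTwo = aa ; p = T.pS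
        ; reach = reach-force 1 W.reach W.tip W.t*~w W.w∉ (Φ-add-nbr {W.S*} W.w∉ W.t*∈ w~t* u∈ (~-sym w~u) u≥2)
        ; x = o ; y = u ; x≢y = u≢o ∘ sym ; x∈ = add-keep W.S* W.w o o∈* ; y∈ = add-keep W.S* W.w u u∈
        ; x≥1 = subst (1 ≤_) (sym (O.out-other o∈* o≢t* (u≢o ∘ sym))) o*≥1
        ; y≥1 = ℕ.≤-pred (subst (2 ≤_) (sym O.out-u) u≥2)
        ; tips = tips }
        where
        u≥2 : 2 ≤ out W.S* u
        u≥2 = nbr≥2 u u∈ w~u u≢t* u≢o
        aa : AddTwo W.S* W.w W.t* u
        aa = addTwo-deg2 {W.S*} W.w∉ (u≢t* ∘ sym) W.t*∈ w~t* u∈ w~u dd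
        module O = AddTwo-out aa
        tips : TipsIn S′ (λ z → z ≡ o ⊎ z ≡ u)
        tips y y∈ e with add-inv {W.S*} y∈
        ... | inj₂ refl = ⊥-elim (1≢0 e (ℕ.+-cancelʳ-≡ 2 _ 0 (trans O.out-w dd)))
        ... | inj₁ y∈* with y ≟ o | y ≟ u | y ≟ W.t*
        ...   | yes q | _ | _ = inj₁ q
        ...   | no _ | yes q | _ = inj₂ q
        ...   | no _ | no _ | yes refl = ⊥-elim (1≢0 e (ℕ.suc-injective (trans O.out-t W.tip)))
        ...   | no y≢o | no y≢u | no y≢t* = ⊥-elim (settled y y∈* y≢t* y≢o (trans (sym (O.out-other y∈* y≢t* y≢u)) e))
      walked (inj₁ (u , u∈ , w~u , u≢t*)) dw | yes refl | inj₁ dd = loop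
        (record { t = W.w ; u = W.t* ; us = T.ws ; close = w~u
                ; chain = next T.chain W.t*~w dd (∈∉⇒≢ {W.S*} o∈* W.w∉ ∘ sym)
                            (λ w∈ → clash {W.S*} (T.inS W.w w∈) W.w∉) })
        (λ { x (here refl) → ≢true⇒false (λ x∈ → clash {W.S*} (T.old x x∈) W.w∉)
           ; x (there x∈) → T.notS x x∈ })
      -- Back at `o` through a vertex of degree at least 3, which saves one unit. If out(o) is at
      -- least 2, `o` saves another, a contradiction; otherwise `o` and `t*` are both exhausted and
      -- only `W.w` can be a tip.
      walked (inj₁ (u , u∈ , w~u , u≢t*)) dw | yes refl | inj₂ d3 with 2 ≤? out W.S* o
      ... | yes k = ⊥-elim (save₂ o o u≢t* u∈ w~u u∈ w~u k d3)
      ... | no nk = saved₁ record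
        { S′ = S′ ; x = W.w
        ; reach = reach-force 1 W.reach W.tip W.t*~w W.w∉ (Φ-add-new {W.S*} W.w∉ W.t*∈ w~t* o≢t*′ u∈ w~u d3)
        ; x∈ = add-self W.S* W.w
        ; x≥1 = ℕ.+-cancelʳ-≤ 2 _ _ (subst (3 ≤_) (sym O.out-w) d3)
        ; tips = tips }
        where
        o≢t*′ : W.t* ≢ o
        o≢t*′ = o≢t* ∘ sym
        o-one : out W.S* o ≡ 1
        o-one = ℕ.≤-antisym (ℕ.≤-pred (ℕ.≰⇒> nk)) o*≥1
        only₂ : ∀ x → W.w ~ x → x ∈ₛ W.S* → x ≡ W.t* ⊎ x ≡ o
        only₂ x w~x x∈ with x ≟ W.t* | x ≟ o
        ... | yes q | _ = inj₁ q
        ... | no _ | yes q = inj₂ q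
        ... | no x≢t* | no x≢o = ⊥-elim (save₂ x x x≢t* x∈ w~x x∈ w~x (nbr≥2 x x∈ w~x x≢t* x≢o) d3)
        oo : AddTwo W.S* W.w W.t* o
        oo = record
          { w∉ = W.w∉ ; t≢u = o≢t*′ ; t∈ = W.t*∈ ; w~t = w~t* ; u∈ = o∈* ; w~u = w~u ; only = only₂ }
        module O = AddTwo-out oo
        tips : TipsIn S′ (_≡ W.w)
        tips y y∈ e with add-inv {W.S*} y∈
        ... | inj₂ q = q
        ... | inj₁ y∈* with y ≟ o | y ≟ W.t*
        ...   | yes refl | _ = ⊥-elim (1≢0 e (ℕ.suc-injective (trans O.out-u o-one)))
        ...   | no _ | yes refl = ⊥-elim (1≢0 e (ℕ.suc-injective (trans O.out-t W.tip)))
        ...   | no y≢o | no y≢t* = ⊥-elim (settled y y∈* y≢t* y≢o (trans (sym (O.out-other y∈* y≢t* y≢o)) e))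
      walked (inj₂ only*) (inj₁ dd) with W.stop
      ... | inj₁ d3 = ⊥-elim (2≰1 (ℕ.≤-pred (subst (3 ≤_) dd d3)))
      ... | inj₂ (_ , u , u∈ , w~u , ne) = ⊥-elim (ne (only* u w~u u∈))
      walked (inj₂ only*) (inj₂ d3) =
        afterFresh o∈ (reach-force 0 W.reach W.tip W.t*~w W.w∉ (Φ-add {W.S*} W.w∉ W.t*∈ w~t*))
          (closedP T.pS aw) (λ v v∈ → add-keep W.S* W.w v (T.old v v∈)) (add-self W.S* W.w)
          (≢true⇒false (λ w∈ → clash {W.S*} (T.old W.w w∈) W.w∉)) w≥2 (sym (addOne-out-w aw)) new tips
        where
        aw : AddOne W.S* W.w W.t*
        aw = addOne W.w∉ W.t*∈ w~t* only*
        w≥2 : 2 ≤ out S′ W.w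
        w≥2 = ℕ.≤-pred (subst (3 ≤_) (sym (addOne-out-w aw)) d3)
        t*-zero : out S′ W.t* ≡ 0
        t*-zero = ℕ.suc-injective (trans (addOne-out-t aw) W.tip)
        new : New S S′
        new y y∈ y∉ with add-inv {W.S*} y∈
        ... | inj₂ refl = inj₂ (sym (addOne-out-w aw))
        ... | inj₁ y∈* with y ≟ W.t*
        ...   | yes refl = inj₁ t*-zero
        ...   | no ne with W.new y y∈* ne
        ...     | inj₂ z = inj₁ (trans (addOne-out-other aw y∈* ne) z)
        ...     | inj₁ (y∈₁ , y≢w) with add-inv {S} y∈₁
        ...       | inj₁ y∈S = ⊥-elim (clash {S} y∈S y∉)
        ...       | inj₂ q = ⊥-elim (y≢w q)
        tips : TipsIn S′ (_≡ o)
        tips y y∈ e with add-inv {W.S*} y∈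
        ... | inj₂ refl = ⊥-elim (2≰1 (subst (2 ≤_) e w≥2))
        ... | inj₁ y∈* with y ≟ o | y ≟ W.t*
        ...   | yes q | _ = q
        ...   | no _ | yes refl = ⊥-elim (1≢0 e t*-zero)
        ...   | no y≢o | no y≢t* = ⊥-elim (settled y y∈* y≢t* y≢o (trans (sym (addOne-out-other aw y∈* y≢t*)) e))

    step : ∀ {S o} → Reach (suc b) S → P S → Tipless S → o ∈ₛ S → 2 ≤ out S o → StepOut P b S o
    step {S} {o} r p tl o∈ o≥2 with out-witness {S} (ℕ.≤-trans (s≤s z≤n) o≥2)
    ... | w , o~w , w∉ = first (other? S w o) (deg-2-or-3 (deg≥2 w))
      where
      w~o : w ~ o
      w~o = ~-sym o~w
      S₁ : Subset
      S₁ = add S w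
      o∈₁ : o ∈ₛ S₁
      o∈₁ = add-keep S w o o∈
      o≢w : o ≢ w
      o≢w = ∈∉⇒≢ {S} o∈ w∉
      o₁≥1 : 1 ≤ out S₁ o
      o₁≥1 = ℕ.≤-pred (subst (2 ≤_) (sym (out-add-adj {S} w∉ o~w)) o≥2)
      -- The free coordinate at `w` is paid for by `o`, whose weight falls by one.
      r₁ : Reach (suc b) S₁
      r₁ = reach-param 0 w r (Φ-add-nbr {S} w∉ o∈ w~o o∈ o~w o≥2)

      first : (∃[ u ] (u ∈ₛ S × w ~ u × u ≢ o)) ⊎ OnlyNbr S w o → deg Γ w ≡ 2 ⊎ 3 ≤ deg Γ w → StepOut P b S o
      first (inj₁ (u , u∈ , w~u , u≢o)) = hit
        where
        u≥2 : 2 ≤ out S u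
        u≥2 = ≢1⇒≥2 (out≥1 {S} (~-sym w~u) w∉) (tl u u∈)
        hit : deg Γ w ≡ 2 ⊎ 3 ≤ deg Γ w → StepOut P b S o
        -- Of the three decreases, the one at `o` pays for the coordinate; those at `u` and `w`
        -- lower the bound by two.
        hit (inj₂ d3) = ⊥-elim (absurd-reach lower (reach-param 2 w (reach-≤ (s≤s b≤) r)
          (∑ℕ-strict₃ (weight-add≤ {S} w∉ o∈ w~o) (u≢o ∘ sym) o≢w (∈∉⇒≢ {S} u∈ w∉)
            (weight-add-nbr< {S} w∉ o∈ w~o o∈ o~w o≥2)
            (weight-add-nbr< {S} w∉ o∈ w~o u∈ (~-sym w~u) u≥2)
            (weight-add-new< {S} w∉ o∈ w~o (u≢o ∘ sym) u∈ w~u d3))))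
        hit (inj₁ d2) = saved₂ record
          { S = S ; w = w ; t = o ; u = u ; addTwo = a ; p = p
          ; reach = reach-param 1 w r (Φ-add-nbr₂ {S} w∉ o∈ w~o (u≢o ∘ sym) o∈ o~w o≥2 u∈ (~-sym w~u) u≥2)
          ; x = o ; y = u ; x≢y = u≢o ∘ sym ; x∈ = o∈₁ ; y∈ = add-keep S w u u∈ ; x≥1 = o₁≥1
          ; y≥1 = ℕ.≤-pred (subst (2 ≤_) (sym O.out-u) u≥2)
          ; tips = tips }
          where
          a : AddTwo S w o u
          a = addTwo-deg2 {S} w∉ (u≢o ∘ sym) o∈ w~o u∈ w~u d2
          module O = AddTwo-out a
          tips : TipsIn (add S w) (λ z → z ≡ o ⊎ z ≡ u)
          tips y y∈ e with add-inv {S} y∈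
          ... | inj₂ refl = ⊥-elim (1≢0 e (ℕ.+-cancelʳ-≡ 2 _ 0 (trans O.out-w d2)))
          ... | inj₁ y∈S with y ≟ o | y ≟ u
          ...   | yes q | _ = inj₁ q
          ...   | no _ | yes q = inj₂ q
          ...   | no y≢o | no y≢u = ⊥-elim (tl y y∈S (trans (sym (O.out-other y∈S y≢o y≢u)) e))
      first (inj₂ only) = dead
        where
        a : AddOne S w o
        a = addOne w∉ o∈ w~o only
        p₁ : P S₁
        p₁ = closedP p a
        settled₁ : ∀ y → y ∈ₛ S → y ≢ o → out S₁ y ≢ 1
        settled₁ y y∈ ne e = tl y y∈ (trans (sym (addOne-out-other a y∈ ne)) e)
        dead : deg Γ w ≡ 2 ⊎ 3 ≤ deg Γ w → StepOut P b S o
        dead (inj₂ d3) = afterFresh o∈ r₁ p₁ (add-keep S w) (add-self S w) w∉ w≥2 (sym (addOne-out-w a)) new tips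
          where
          w≥2 : 2 ≤ out S₁ w
          w≥2 = ℕ.≤-pred (subst (3 ≤_) (sym (addOne-out-w a)) d3)
          new : New S S₁
          new y y∈ y∉ with add-inv {S} y∈
          ... | inj₁ y∈S = ⊥-elim (clash {S} y∈S y∉)
          ... | inj₂ refl = inj₂ (sym (addOne-out-w a))
          tips : TipsIn S₁ (_≡ o)
          tips y y∈ e with add-inv {S} y∈
          ... | inj₂ refl = ⊥-elim (2≰1 (subst (2 ≤_) e w≥2))
          ... | inj₁ y∈S with y ≟ o
          ...   | yes q = q
          ...   | no ne = ⊥-elim (settled₁ y y∈S ne e)
        dead (inj₁ d2) = afterWalk tl o∈ o≥2 a
          (walk (trail-step closedP o∈) (suc (rest S₁)) ℕ.≤-refl r₁ trail₁ (add-self S w)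
            (ℕ.suc-injective (trans (addOne-out-w a) d2)))
          where
          trail₁ : Trail P o S S₁ w
          trail₁ = record
            { pS = p₁ ; ws = [] ; chain = one o~w d2 ; old = add-keep S w
            ; inS = λ { y (here refl) → add-self S w } ; notS = λ { y (here refl) → w∉ } }

-- Pendant cycles

module Looping (Γ : SignedGraph) (con : Connected Γ) (deg≥2 : ∀ v → 2 ≤ deg Γ v) where
  open Stepping Γ con deg≥2 public
  open Reach

  prev : V → List V → V
  prev o [] = o
  prev o (u ∷ _) = u

  bottom : V → List V → V
  bottom t [] = t
  bottom t (u ∷ ws) = bottom u ws

  bottom∈ : ∀ t ws → bottom t ws ∈ (t ∷ ws)
  bottom∈ t [] = here refl
  bottom∈ t (u ∷ ws) = there (bottom∈ u ws)

  chain-o≢ : ∀ {o ws} → Chain o ws → ∀ w → w ∈ ws → w ≢ o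
  chain-o≢ (one o~w _) w (here refl) refl = ~-irrefl o~w
  chain-o≢ (next _ _ _ ne _) w (here refl) = ne
  chain-o≢ (next c _ _ _ _) w (there w∈) = chain-o≢ c w w∈

  chain-deg : ∀ {o ws} → Chain o ws → ∀ w → w ∈ ws → deg Γ w ≡ 2
  chain-deg (one _ d) w (here refl) = d
  chain-deg (next _ _ d _ _) w (here refl) = d
  chain-deg (next c _ _ _ _) w (there w∈) = chain-deg c w w∈

  chain-head∉ : ∀ {o t ws} → Chain o (t ∷ ws) → t ∉ ws
  chain-head∉ (one _ _) = λ ()
  chain-head∉ (next _ _ _ _ t∉) = t∉

  chain-prev : ∀ {o t ws} → Chain o (t ∷ ws) → t ~ prev o ws
  chain-prev (one p _) = ~-sym p
  chain-prev (next _ p _ _ _) = ~-sym p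

  chain-bottom : ∀ {o t ws} → Chain o (t ∷ ws) → o ~ bottom t ws
  chain-bottom (one p _) = p
  chain-bottom (next c _ _ _ _) = chain-bottom c

  head≢prev : ∀ {o t u ws} → t ≢ o → t ∉ (u ∷ ws) → t ≢ prev o ws
  head≢prev {ws = []} t≢o _ = t≢o
  head≢prev {ws = x ∷ ws} _ t∉ refl = t∉ (there (here refl))

  head-nbrs : ∀ {o t ws s} → Chain o (t ∷ ws) → t ~ s → s ≢ prev o ws → ∀ x → t ~ x → x ≡ s ⊎ x ≡ prev o ws
  head-nbrs c t~s ne x p = deg2-nbrs (chain-deg c _ (here refl)) ne t~s (chain-prev c) x p

  -- `s` is the neighbour of the head on its far side: `o` when the whole loop is considered, and
  -- the previous head as the recursion moves down the path.
  chain-closed : ∀ {o t ws s} → Chain o (t ∷ ws) → t ~ s → s ≢ prev o ws →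
    ∀ w x → w ∈ (t ∷ ws) → w ~ x → x ≡ s ⊎ x ≡ o ⊎ x ∈ (t ∷ ws)
  chain-closed {ws = []} c t~s ne w x (here refl) p =
    [ inj₁ , (λ e → inj₂ (inj₁ e)) ]′ (head-nbrs c t~s ne x p)
  chain-closed {ws = u ∷ ws} c t~s ne w x (here refl) p =
    [ inj₁ , (λ e → inj₂ (inj₂ (there (here e)))) ]′ (head-nbrs c t~s ne x p)
  chain-closed (next c u~t _ t≢o t∉) t~s ne w x (there w∈) p
    with chain-closed c u~t (head≢prev t≢o t∉) w x w∈ p
  ... | inj₁ e = inj₂ (inj₂ (here e))
  ... | inj₂ (inj₁ e) = inj₂ (inj₁ e)
  ... | inj₂ (inj₂ x∈) = inj₂ (inj₂ (there x∈))

  row : (V → ℚ) → V → ℚ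
  row x v = ∑ℚ (λ j → A Γ v j *ℚ x j)

  -- The kernel equation at the head has only two terms, at `s` and at the next vertex, so zeros at
  -- `s` and `t` are transported one place down the path.
  chain-det : ∀ {o t ws s} → Chain o (t ∷ ws) → t ~ s → s ≢ prev o ws → (x : V → ℚ) →
    (∀ v → v ∈ (t ∷ ws) → row x v ≡ 0ℚ) → x s ≡ 0ℚ → x t ≡ 0ℚ → ∀ v → v ∈ (t ∷ ws) → x v ≡ 0ℚ
  chain-det c t~s ne x eqs xs xt v (here refl) = xt
  chain-det {o} {t} {u ∷ ws} {s} c@(next c′ u~t _ t≢o t∉) t~s ne x eqs xs xt v (there v∈) =
    chain-det c′ u~t (head≢prev t≢o t∉) x (λ v v∈ → eqs v (there v∈)) xt xu v v∈
    where
    xu : x u ≡ 0ℚ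
    xu = *ℚ-≢0 (A≢0 {t} {u} (~-sym u~t)) (trans (sym (row-single x {t} {u} other)) (eqs t (here refl)))
      where
      other : ∀ j → j ≢ u → t ~ j → x j ≡ 0ℚ
      other j j≢u p with head-nbrs c t~s ne j p
      ... | inj₁ refl = xs
      ... | inj₂ e = ⊥-elim (j≢u e)

  chain-o-nbr : ∀ {o t ws s} → Chain o (t ∷ ws) → t ~ s → s ≢ prev o ws → s ≢ o →
    ∀ x → x ∈ (t ∷ ws) → x ~ o → x ≡ bottom t ws
  chain-o-nbr {ws = []} c t~s ne s≢o x (here refl) p = refl
  chain-o-nbr {o} {ws = u ∷ ws} c@(next c′ _ _ _ _) t~s ne s≢o x (here refl) p with head-nbrs c t~s ne o p
  ... | inj₁ e = ⊥-elim (s≢o (sym e))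
  ... | inj₂ e = ⊥-elim (chain-o≢ c′ u (here refl) (sym e))
  chain-o-nbr (next c u~t _ t≢o t∉) t~s ne s≢o x (there x∈) p =
    chain-o-nbr c u~t (head≢prev t≢o t∉) t≢o x x∈ p

  module LoopFacts {o} (ℓ : Loop o) where
    open Loop ℓ public using (t; u; us; chain; close)

    o≢u : o ≢ u
    o≢u e = chain-o≢ chain u (there (here refl)) (sym e)

    o∉ : ∀ w → w ∈ interior ℓ → w ≢ o
    o∉ = chain-o≢ chain

    deg2 : ∀ w → w ∈ interior ℓ → deg Γ w ≡ 2
    deg2 = chain-deg chain

    nbrs : ∀ w x → w ∈ interior ℓ → w ~ x → x ≡ o ⊎ x ∈ interior ℓ
    nbrs w x w∈ p with chain-closed chain close o≢u w x w∈ p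
    ... | inj₁ e = inj₁ e
    ... | inj₂ r = r

    last : V
    last = bottom u us

    last∈ : last ∈ interior ℓ
    last∈ = there (bottom∈ u us)

    o~last : o ~ last
    o~last = chain-bottom chain

    t≢last : t ≢ last
    t≢last e = chain-head∉ chain (subst (_∈ (u ∷ us)) (sym e) (bottom∈ u us))

    o-nbrs : ∀ x → x ∈ interior ℓ → o ~ x → x ≡ t ⊎ x ≡ last
    o-nbrs x (here e) p = inj₁ e
    o-nbrs x (there x∈) p with chain
    ... | next c u~t _ t≢o t∉ = inj₂ (chain-o-nbr c u~t (head≢prev t≢o t∉) t≢o x x∈ (~-sym p))

    loop-det : (x : V → ℚ) → (∀ v → v ∈ interior ℓ → row x v ≡ 0ℚ) → x o ≡ 0ℚ → x t ≡ 0ℚ →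
      ∀ v → v ∈ interior ℓ → x v ≡ 0ℚ
    loop-det = chain-det chain close o≢u

  addAll : Subset → List V → Subset
  addAll S [] = S
  addAll S (w ∷ ws) = add (addAll S ws) w

  addAll-keep : ∀ S ws → S ⊆ₛ addAll S ws
  addAll-keep S [] v p = p
  addAll-keep S (w ∷ ws) v p = add-keep (addAll S ws) w v (addAll-keep S ws v p)

  addAll-∈ : ∀ S ws v → v ∈ ws → v ∈ₛ addAll S ws
  addAll-∈ S (w ∷ ws) v (here refl) = add-self (addAll S ws) w
  addAll-∈ S (w ∷ ws) v (there v∈) = add-keep (addAll S ws) w v (addAll-∈ S ws v v∈)

  addAll-inv : ∀ S ws {v} → v ∈ₛ addAll S ws → v ∈ₛ S ⊎ v ∈ ws
  addAll-inv S [] p = inj₁ p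
  addAll-inv S (w ∷ ws) p with add-inv {addAll S ws} p
  ... | inj₂ e = inj₂ (here e)
  ... | inj₁ q with addAll-inv S ws q
  ...   | inj₁ r = inj₁ r
  ...   | inj₂ r = inj₂ (there r)

  module AddLoop {o} (ℓ : Loop o) {S} (o∈ : o ∈ₛ S) (disj : ∀ x → x ∈ interior ℓ → x ∉ₛ S) where
    open LoopFacts ℓ

    S′ : Subset
    S′ = addAll S (interior ℓ)

    sub : S ⊆ₛ S′
    sub = addAll-keep S (interior ℓ)

    int⊆ : ∀ w → w ∈ interior ℓ → w ∈ₛ S′
    int⊆ = addAll-∈ S (interior ℓ)

    inv : ∀ {v} → v ∈ₛ S′ → v ∈ₛ S ⊎ v ∈ interior ℓ
    inv = addAll-inv S (interior ℓ)

    out-int : ∀ w → w ∈ interior ℓ → out S′ w ≡ 0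
    out-int w w∈ = #-none (λ j → ≢true⇒false (λ h → let p , q = out-elim {S′} h in
      [ (λ { refl → clash {S′} (sub o o∈) q }) , (λ j∈ → clash {S′} (int⊆ j j∈) q) ]′ (nbrs w j w∈ p)))

    out-other : ∀ u → u ∈ₛ S → u ≢ o → out S′ u ≡ out S u
    out-other u u∈ u≢o = ΣN.∑-cong pointwise
      where
      nonadj : ∀ j → j ∈ interior ℓ → ¬ (u ~ j)
      nonadj j j∈ u~j = [ u≢o , (λ u∈′ → clash {S} u∈ (disj u u∈′)) ]′ (nbrs j u j∈ (~-sym u~j))
      pointwise : ∀ j → [ adj u j ∧ not (S′ j) ] ≡ [ adj u j ∧ not (S j) ]
      pointwise j with ∈-or-∉ S j | ∈-or-∉ S′ j
      ... | inj₁ p | _ rewrite p | sub j p = refl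
      ... | inj₂ p | inj₂ q rewrite p | q = refl
      ... | inj₂ p | inj₁ q with inv q
      ...   | inj₁ j∈S = ⊥-elim (clash {S} j∈S p)
      ...   | inj₂ j∈ rewrite ≢true⇒false (nonadj j j∈) = refl

    out-o : out S′ o + 2 ≡ out S o
    out-o = trans (cong₂ _+_ (ΣN.∑-cong pointwise) (sym two)) (#-split (λ j → adj o j ∧ not (S j)) S′)
      where
      pointwise : ∀ j → [ adj o j ∧ not (S′ j) ] ≡ [ (adj o j ∧ not (S j)) ∧ not (S′ j) ]
      pointwise j with adj o j | ∈-or-∉ S j
      ... | false | _ = refl
      ... | true | inj₂ p rewrite p = refl
      ... | true | inj₁ p rewrite p | sub j p = refl
      both : ∀ x → x ∈ interior ℓ → o ~ x → (adj o x ∧ not (S x)) ∧ S′ x ≡ true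
      both x x∈ p rewrite p | disj x x∈ | int⊆ x x∈ = refl
      two : # (λ j → (adj o j ∧ not (S j)) ∧ S′ j) ≡ 2
      two = #-pair t≢last (both t (here refl) (~-sym close)) (both last last∈ o~last) only
        where
        only : ∀ i → (adj o i ∧ not (S i)) ∧ S′ i ≡ true → i ≡ t ⊎ i ≡ last
        only i h = let h₁ , h₂ = ∧-true h ; p , q = out-elim {S} h₁ in
          [ (λ i∈S → ⊥-elim (clash {S} i∈S q)) , (λ i∈ → o-nbrs i i∈ p) ]′ (inv h₂)

    loop-Φ : ∀ d → out S′ o ∸ 1 + d ≤ out S o ∸ 1 → d + Φ S′ ≤ Φ S
    loop-Φ d le = subst (_≤ Φ S) (trans (cong (Φ S′ +_) (ΣN.∑-at o d)) (ℕ.+-comm (Φ S′) d))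
        (∑ℕ-mono-+ {f = weight S′} {ΣN.at o d} pointwise)
      where
      pointwise : ∀ v → weight S′ v + ΣN.at o d v ≤ weight S v
      pointwise v with v ≟ o
      ... | yes refl rewrite weight-∈ {S} o∈ | weight-∈ {S′} (sub o o∈) = le
      ... | no v≢o rewrite ℕ.+-identityʳ (weight S′ v) with ∈-or-∉ S v
      ...   | inj₁ v∈ rewrite weight-∈ {S} v∈ | weight-∈ {S′} (sub v v∈) | out-other v v∈ v≢o = ℕ.≤-refl
      ...   | inj₂ v∉ with ∈-or-∉ S′ v
      ...     | inj₂ v∉′ rewrite weight-∉ {S} v∉ | weight-∉ {S′} v∉′ = ℕ.≤-refl
      ...     | inj₁ v∈′ with inv v∈′
      ...       | inj₁ v∈ = ⊥-elim (clash {S} v∈ v∉)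
      ...       | inj₂ v∈ rewrite weight-∈ {S′} v∈′ | out-int v v∈ = z≤n

    -- A loop takes two outside neighbours from `o`. If out(o) = 2, truncation lets the weight fall
    -- only from 1 to 0, just enough for the coordinate at `t`. If out(o) is at least 3, it falls by
    -- two and one unit is saved, as `Φ₂` states.
    Φ₁ : 2 ≤ out S o → 1 + Φ S′ ≤ Φ S
    Φ₁ k = loop-Φ 1 (arith out-o k)
      where
      arith : ∀ {a b} → a + 2 ≡ b → 2 ≤ b → a ∸ 1 + 1 ≤ b ∸ 1
      arith {zero} refl _ = s≤s z≤n
      arith {suc a} refl _ = ℕ.+-monoʳ-≤ a (s≤s z≤n)

    Φ₂ : 3 ≤ out S o → 2 + Φ S′ ≤ Φ S
    Φ₂ k = loop-Φ 2 (arith out-o k)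
      where
      arith : ∀ {a b} → a + 2 ≡ b → 3 ≤ b → a ∸ 1 + 2 ≤ b ∸ 1
      arith {zero} refl (s≤s (s≤s ()))
      arith {suc a} refl _ = ℕ.≤-refl

    loop-reach : ∀ {b} d → Reach (d + b) S → suc d + Φ S′ ≤ Φ S → Reach b S′
    loop-reach {b} d r le = record
      { fs = t ∷ fs r ; root = root r ; root∈ = sub _ (root∈ r)
      ; det = det′
      ; bound = ℕ.+-cancelˡ-≤ d _ _ (ℕ.≤-trans (ℕ.≤-reflexive eq)
          (ℕ.≤-trans (ℕ.+-monoʳ-≤ (length (fs r)) le) (bound r))) }
      where
      L = length (fs r)
      eq : d + (suc L + Φ S′) ≡ L + (suc d + Φ S′)
      eq = trans (ℕ.+-suc d (L + Φ S′)) (trans (trans (sym (ℕ.+-assoc (suc d) L (Φ S′)))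
             (cong (_+ Φ S′) (ℕ.+-comm (suc d) L))) (ℕ.+-assoc L (suc d) (Φ S′)))
      det′ : Det S′ (t ∷ fs r)
      det′ x ker zs v v∈ with inv v∈
      ... | inj₁ v∈S = det r x ker (λ y y∈ → zs y (there y∈)) v v∈S
      ... | inj₂ v∈ℓ = loop-det x (λ w _ → ker w) (det r x ker (λ y y∈ → zs y (there y∈)) o o∈) (zs t (here refl)) v v∈ℓ

    loop-Θ : Θ S′ + 2 ≡ Θ S
    loop-Θ = trans (cong (Θ S′ +_) (sym (ΣN.∑-at o 2)))
        (trans (sym (ΣN.∑-∙ (θ S′) (ΣN.at o 2))) (ΣN.∑-cong pointwise))
      where
      pointwise : ∀ v → θ S′ v + ΣN.at o 2 v ≡ θ S v
      pointwise v with v ≟ o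
      ... | yes refl rewrite θ-∈ {S} o∈ | θ-∈ {S′} (sub o o∈) = out-o
      ... | no v≢o rewrite ℕ.+-identityʳ (θ S′ v) with ∈-or-∉ S v
      ...   | inj₁ v∈ rewrite θ-∈ {S} v∈ | θ-∈ {S′} (sub v v∈) = out-other v v∈ v≢o
      ...   | inj₂ v∉ with ∈-or-∉ S′ v
      ...     | inj₂ v∉′ rewrite θ-∉ {S} v∉ | θ-∉ {S′} v∉′ = refl
      ...     | inj₁ v∈′ with inv v∈′
      ...       | inj₁ v∈ = ⊥-elim (clash {S} v∈ v∉)
      ...       | inj₂ v∈ rewrite θ-∈ {S′} v∈′ | out-int v v∈ | θ-∉ {S} v∉ | deg2 v v∈ = refl

    loop-tips : ∀ u → u ∈ₛ S′ → out S′ u ≢ 0 → u ∈ₛ S × (u ≡ o ⊎ out S′ u ≡ out S u)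
    loop-tips u u∈ nz with inv u∈
    ... | inj₂ u∈ℓ = ⊥-elim (nz (out-int u u∈ℓ))
    ... | inj₁ u∈S with u ≟ o
    ...   | yes e = u∈S , inj₁ e
    ...   | no ne = u∈S , inj₂ (out-other u u∈S ne)

  stuck⇒full : ∀ {b S} → Reach b S → (∀ v → v ∈ₛ S → out S v ≡ 0) → ∀ v → v ∈ₛ S
  stuck⇒full {S = S} r z = closed⇒full {S} con (root∈ r) noExit
    where
    noExit : ∀ v w → v ∈ₛ S → v ~ w → w ∈ₛ S
    noExit v w v∈ p with ∈-or-∉ S w
    ... | inj₁ q = q
    ... | inj₂ q = ⊥-elim (ℕ.1+n≰n (subst (1 ≤_) (z v v∈) (out≥1 {S} p q)))

  stuck⇒Θ : ∀ {b S} → Reach b S → (∀ v → v ∈ₛ S → out S v ≡ 0) → Θ S ≡ 0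
  stuck⇒Θ {S = S} r z = ΣN.∑-unit (λ v → let v∈ = stuck⇒full {S = S} r z v in trans (θ-∈ {S} v∈) (z v v∈))

  boundary : ∀ {b S} → Reach b S → Tipless S → 1 ≤ Θ S → ∃[ v ] (v ∈ₛ S × 2 ≤ out S v)
  boundary {S = S} r tl k with boundary? S
  ... | inj₁ (v , w , v∈ , p , q) = v , v∈ , ≢1⇒≥2 (out≥1 {S} p q) (tl v v∈)
  ... | inj₂ cl = ⊥-elim (ℕ.1+n≰n (subst (1 ≤_) (stuck⇒Θ {S = S} r zero-out) k))
    where
    zero-out : ∀ v → v ∈ₛ S → out S v ≡ 0
    zero-out v v∈ = #-none (λ j → ≢true⇒false (λ h → let p , q = out-elim {S} h in clash {S} (cl v j v∈ p) q))

  -- At a vertex of degree 2 the loop would have no exit and be the whole graph. Then Θ would end at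
  -- 0 after falling by 2 from 2 + D, which gives D = 0.
  loop-deg≥3 : 1 ≤ D → ∀ {o} → Loop o → 3 ≤ deg Γ o
  loop-deg≥3 D≥1 {o} ℓ with deg-2-or-3 (deg≥2 o)
  ... | inj₂ d3 = d3
  ... | inj₁ d2 = ⊥-elim (ℕ.1+n≰n (subst (1 ≤_) D≡0 D≥1))
    where
    disj : ∀ x → x ∈ interior ℓ → x ∉ₛ ⟦ o ⟧
    disj x x∈ = dec-false (x ≟ o) (LoopFacts.o∉ ℓ x x∈)
    open AddLoop ℓ {⟦ o ⟧} (⟦⟧-self o) disj
    all0 : ∀ v → v ∈ₛ S′ → out S′ v ≡ 0
    all0 v v∈ with inv v∈
    ... | inj₂ v∈ℓ = out-int v v∈ℓ
    ... | inj₁ v∈o with ⟦⟧-inv {o} {v} v∈o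
    ...   | refl = ℕ.+-cancelʳ-≡ 2 _ 0 (trans out-o (trans (out-⟦⟧ o) d2))
    r′ : Reach (2 + D) S′
    r′ = loop-reach 0 (reach-⟦⟧ o) (Φ₁ (subst (2 ≤_) (sym (out-⟦⟧ o)) (deg≥2 o)))
    D≡0 : D ≡ 0
    D≡0 = ℕ.+-cancelˡ-≡ 2 D 0 (trans (sym (Θ-⟦⟧ o)) (trans (sym loop-Θ) (cong (_+ 2) (stuck⇒Θ r′ all0))))

  GoodLoop : Set
  GoodLoop = Σ V λ o → Loop o × deg Γ o ≡ 3

  module Find (lower : ∀ {b S} → Reach b S → suc D ≤ b) (D≥3 : 3 ≤ D) where

    Trivial : Subset → Set
    Trivial _ = ⊤

    module Tight = Tip lower {P = Trivial} (λ _ _ → tt) {D} (ℕ.n≤1+n D)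

    -- Without slack only `fresh` and `loop` are possible, and `fresh` shrinks the unexplored rest.
    -- A loop at `o` forces out(o) = 2, and since `o` has been entered through one edge, its degree
    -- is 3.
    iterFresh : ∀ m {S o} → rest S < m → Reach (suc D) S → Tipless S → o ∈ₛ S → 2 ≤ out S o →
      deg Γ o ≡ suc (out S o) → GoodLoop
    iterFresh (suc m) {S} {o} (s≤s lt) r tl o∈ o≥2 od with Tight.step r tt tl o∈ o≥2
    ... | saved₁ s = ⊥-elim (absurd-reach lower (Saved₁.reach s))
    ... | saved₂ s = ⊥-elim (absurd-reach lower (Saved₂.reach s))
    ... | fresh F = iterFresh m (ℕ.<-≤-trans (rest-⊂ {S} {F.S′} F.sub F.w∉ F.w∈) lt) F.reach F.tipless F.w∈ F.w≥2 F.w-deg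
      where module F = FreshOut F
    ... | loop ℓ disj with 3 ≤? out S o
    ...   | yes k = ⊥-elim (absurd-reach lower (loop-reach 1 r (Φ₂ k)))
      where open AddLoop ℓ {S} o∈ disj
    ...   | no nk = o , ℓ , trans od (cong suc (ℕ.≤-antisym (ℕ.≤-pred (ℕ.≰⇒> nk)) o≥2))

    iterTight : ∀ {S o} → Reach (suc D) S → Tipless S → o ∈ₛ S → 2 ≤ out S o → ∃[ o ] Loop o
    iterTight {S} {o} r tl o∈ o≥2 with Tight.step r tt tl o∈ o≥2
    ... | saved₁ s = ⊥-elim (absurd-reach lower (Saved₁.reach s))
    ... | saved₂ s = ⊥-elim (absurd-reach lower (Saved₂.reach s))
    ... | loop ℓ _ = o , ℓ
    ... | fresh F = let o , ℓ , _ = iterFresh _ ℕ.≤-refl F.reach F.tipless F.w∈ F.w≥2 F.w-deg in o , ℓ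
      where module F = FreshOut F

    resolve₁ : ∀ {S x} → Reach (suc D) S → x ∈ₛ S → 1 ≤ out S x → TipsIn S (_≡ x) → ∃[ o ] Loop o
    resolve₁ {S} {x} r x∈ x≥1 tips with out S x ≟ℕ 1
    ... | no ne = iterTight r (λ u u∈ e → ne (trans (cong (out S) (sym (tips u u∈ e))) e)) x∈ (≢1⇒≥2 x≥1 ne)
    ... | yes e with Tight.tipWalk r tt x∈ e tips
    ...   | inj₂ s = ⊥-elim (absurd-reach lower (Saved₁.reach s))
    ...   | inj₁ (F , _) = iterTight F.reach F.tipless F.w∈ F.w≥2
      where module F = FreshOut F

    -- Two tips remain after the single drop. The walk from `x` may run into `y` and close another
    -- cycle for free, because both ends are then exhausted. Only the value D - 2 of Θ, positive by
    -- `D≥3`, shows that some vertex is still open; for D = 2 the graph could end here as a theta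
    -- graph.
    resolve-walk : ∀ {S x y} → y ∈ₛ S → x ≢ y → out S y ≡ 1 → TipsIn S (λ z → z ≡ x ⊎ z ≡ y) →
      Walk (λ S _ → Θ S ≡ D) (suc D) S x → ∃[ o ] Loop o
    resolve-walk {S} {x} {y} y∈ x≢y y1 tips wk = go (other? W.S* W.w W.t*) (deg-2-or-3 (deg≥2 W.w))
      where
      module W = Walk wk
      w~t* : W.w ~ W.t*
      w~t* = ~-sym W.t*~w
      S′ : Subset
      S′ = add W.S* W.w
      y∈* : y ∈ₛ W.S*
      y∈* = W.sub y y∈
      y*1 : out W.S* y ≡ 1
      y*1 = trans (W.keep y y∈ (x≢y ∘ sym)) y1
      settled : ∀ u → u ∈ₛ W.S* → u ≢ W.t* → u ≢ y → out W.S* u ≢ 1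
      settled u u∈ ne u≢y e with W.new u u∈ ne
      ... | inj₂ z = 1≢0 e z
      ... | inj₁ (u∈S , u≢x) = [ u≢x , u≢y ]′ (tips u u∈S (trans (sym (W.keep u u∈S u≢x)) e))
      go : (∃[ u ] (u ∈ₛ W.S* × W.w ~ u × u ≢ W.t*)) ⊎ OnlyNbr W.S* W.w W.t* → deg Γ W.w ≡ 2 ⊎ 3 ≤ deg Γ W.w → ∃[ o ] Loop o
      go (inj₁ (u , u∈ , w~u , u≢t*)) (inj₂ d3) = ⊥-elim (absurd-reach lower
        (reach-force 1 W.reach W.tip W.t*~w W.w∉ (Φ-add-new {W.S*} W.w∉ W.t*∈ w~t* (u≢t* ∘ sym) u∈ w~u d3)))
      go (inj₁ (u , u∈ , w~u , u≢t*)) (inj₁ d2) with u ≟ y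
      ... | no u≢y = ⊥-elim (absurd-reach lower
        (reach-force 1 W.reach W.tip W.t*~w W.w∉ (Φ-add-nbr {W.S*} W.w∉ W.t*∈ w~t* u∈ (~-sym w~u)
          (≢1⇒≥2 (out≥1 {W.S*} (~-sym w~u) W.w∉) (settled u u∈ u≢t* u≢y)))))
      ... | yes refl = let v , v∈ , v≥2 = boundary r′ tl Θ≥1 in iterTight r′ tl v∈ v≥2
        where
        a : AddTwo W.S* W.w W.t* y
        a = addTwo-deg2 {W.S*} W.w∉ (u≢t* ∘ sym) W.t*∈ w~t* u∈ w~u d2
        module O = AddTwo-out a
        r′ : Reach (suc D) S′
        r′ = reach-force 0 W.reach W.tip W.t*~w W.w∉ (Φ-add {W.S*} W.w∉ W.t*∈ w~t*)
        tl : Tipless S′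
        tl z z∈ e with add-inv {W.S*} z∈
        ... | inj₂ refl = 1≢0 e (ℕ.+-cancelʳ-≡ 2 _ 0 (trans O.out-w d2))
        ... | inj₁ z∈* with z ≟ y | z ≟ W.t*
        ...   | yes refl | _ = 1≢0 e (ℕ.suc-injective (trans O.out-u y*1))
        ...   | no _ | yes refl = 1≢0 e (ℕ.suc-injective (trans O.out-t W.tip))
        ...   | no z≢y | no z≢t* = settled z z∈* z≢t* z≢y (trans (sym (O.out-other z∈* z≢t* z≢y)) e)
        Θ≥1 : 1 ≤ Θ S′
        Θ≥1 = ℕ.+-cancelʳ-≤ 2 1 _ (subst (3 ≤_) (sym (trans O.Θ-eq W.q)) D≥3)
      go (inj₂ only) (inj₁ d2) with W.stop
      ... | inj₁ d3 = ⊥-elim (2≰1 (ℕ.≤-pred (subst (3 ≤_) d2 d3)))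
      ... | inj₂ (_ , u , u∈ , w~u , ne) = ⊥-elim (ne (only u w~u u∈))
      go (inj₂ only) (inj₂ d3) = resolve₁ {S′} {y}
          (reach-force 0 W.reach W.tip W.t*~w W.w∉ (Φ-add {W.S*} W.w∉ W.t*∈ w~t*))
          (add-keep W.S* W.w y y∈*) y≥1 tips′
        where
        a : AddOne W.S* W.w W.t*
        a = addOne W.w∉ W.t*∈ w~t* only
        w≥2 : 2 ≤ out S′ W.w
        w≥2 = ℕ.≤-pred (subst (3 ≤_) (sym (addOne-out-w a)) d3)
        y≢t* : y ≢ W.t*
        y≢t* e = [ (λ e′ → x≢y (sym (trans e e′))) , (λ t∉ → ∈∉⇒≢ {S} y∈ t∉ e) ]′ W.start
        y≥1 : 1 ≤ out S′ y
        y≥1 = ℕ.≤-reflexive (sym (trans (addOne-out-other a y∈* y≢t*) y*1))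
        tips′ : TipsIn S′ (_≡ y)
        tips′ z z∈ e with add-inv {W.S*} z∈
        ... | inj₂ refl = ⊥-elim (2≰1 (subst (2 ≤_) e w≥2))
        ... | inj₁ z∈* with z ≟ y | z ≟ W.t*
        ...   | yes q | _ = q
        ...   | no _ | yes refl = ⊥-elim (1≢0 e (ℕ.suc-injective (trans (addOne-out-t a) W.tip)))
        ...   | no z≢y | no z≢t* = ⊥-elim (settled z z∈* z≢t* z≢y (trans (sym (addOne-out-other a z∈* z≢t*)) e))

    resolve₂ : ∀ {S x y} → Reach (suc D) S → Θ S ≡ D → x ∈ₛ S → y ∈ₛ S → x ≢ y → 1 ≤ out S x → 1 ≤ out S y →
      TipsIn S (λ z → z ≡ x ⊎ z ≡ y) → ∃[ o ] Loop o
    resolve₂ {S} {x} {y} r Θ≡ x∈ y∈ x≢y x≥1 y≥1 tips with out S x ≟ℕ 1 | out S y ≟ℕ 1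
    ... | no nx | _ = resolve₁ r y∈ y≥1 (λ z z∈ e → [ (λ { refl → ⊥-elim (nx e) }) , (λ q → q) ]′ (tips z z∈ e))
    ... | yes _ | no ny = resolve₁ r x∈ x≥1 (λ z z∈ e → [ (λ q → q) , (λ { refl → ⊥-elim (ny e) }) ]′ (tips z z∈ e))
    ... | yes ex | yes ey = resolve-walk y∈ x≢y ey tips
      (walk (λ q a _ → trans (Θ-add-one (AddOne.w∉ a) (AddOne.t∈ a) (AddOne.w~t a) (AddOne.only a)) q)
        (suc (rest S)) ℕ.≤-refl r Θ≡ x∈ ex)

    -- This value of Θ says that no cycle has been closed yet.
    ΘFull : Subset → Set
    ΘFull S = Θ S ≡ 2 + D

    module Slack = Tip lower {P = ΘFull}
      (λ q a → trans (Θ-add-one (AddOne.w∉ a) (AddOne.t∈ a) (AddOne.w~t a) (AddOne.only a)) q) {suc D} ℕ.≤-refl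

    -- Starts with one unit of slack: either a loop appears, or the slack is spent and the search
    -- goes on where no further drop is possible.
    iterSlack : ∀ m {S o} → rest S < m → Reach (2 + D) S → ΘFull S → Tipless S → o ∈ₛ S → 2 ≤ out S o → ∃[ o ] Loop o
    iterSlack (suc m) {S} {o} (s≤s lt) r q tl o∈ o≥2 with Slack.step r q tl o∈ o≥2
    ... | loop ℓ _ = o , ℓ
    ... | fresh F = iterSlack m (ℕ.<-≤-trans (rest-⊂ {S} {F.S′} F.sub F.w∉ F.w∈) lt) F.reach F.p F.tipless F.w∈ F.w≥2
      where module F = FreshOut F
    ... | saved₁ s = resolve₁ reach x∈ x≥1 tips
      where open Saved₁ s
    ... | saved₂ s = resolve₂ reach (ℕ.+-cancelʳ-≡ 2 _ D (trans (AddTwo-out.Θ-eq addTwo) (trans p (ℕ.+-comm 2 D))))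
                       x∈ y∈ x≢y x≥1 y≥1 tips
      where open Saved₂ s

    D≥1 : 1 ≤ D
    D≥1 = ℕ.≤-trans (s≤s z≤n) D≥3

    findLoop : ∃[ o ] Loop o
    findLoop with ∑ℕ-positive (λ v → deg Γ v ∸ 2) D≥1
    ... | r , k = iterSlack _ ℕ.≤-refl (reach-⟦⟧ r) (Θ-⟦⟧ r) tl (⟦⟧-self r) out≥2
      where
      d3 : 3 ≤ deg Γ r
      d3 = subst (3 ≤_) (ℕ.m∸n+n≡m (deg≥2 r)) (ℕ.+-monoˡ-≤ 2 k)
      out≥2 : 2 ≤ out ⟦ r ⟧ r
      out≥2 = subst (2 ≤_) (sym (out-⟦⟧ r)) (deg≥2 r)
      tl : Tipless ⟦ r ⟧
      tl u u∈ e with ⟦⟧-inv {r} {u} u∈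
      ... | refl = 2≰1 (ℕ.≤-trans (ℕ.n≤1+n 2) (subst (3 ≤_) (trans (sym (out-⟦⟧ r)) e) d3))

    module Start {o} (ℓ : Loop o) where
      disj₀ : ∀ x → x ∈ interior ℓ → x ∉ₛ ⟦ o ⟧
      disj₀ x x∈ = dec-false (x ≟ o) (LoopFacts.o∉ ℓ x x∈)
      module L = AddLoop ℓ {⟦ o ⟧} (⟦⟧-self o) disj₀
      out-start : out L.S′ o + 2 ≡ deg Γ o
      out-start = trans L.out-o (out-⟦⟧ o)
      o∈ : o ∈ₛ L.S′
      o∈ = L.sub o (⟦⟧-self o)
      Θ-start : Θ L.S′ ≡ D
      Θ-start = ℕ.+-cancelʳ-≡ 2 _ D (trans L.loop-Θ (trans (Θ-⟦⟧ o) (ℕ.+-comm 2 D)))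
      Φ-start : 2 + Φ L.S′ ≤ Φ ⟦ o ⟧
      Φ-start = L.Φ₂ (subst (3 ≤_) (sym (out-⟦⟧ o)) (loop-deg≥3 D≥1 ℓ))
      reach-start : Reach (suc D) L.S′
      reach-start = L.loop-reach 1 (reach-⟦⟧ o) Φ-start
      only-o : ∀ u → u ∈ₛ L.S′ → out L.S′ u ≢ 0 → u ≡ o
      only-o u u∈ nz = ⟦⟧-inv {o} {u} (proj₁ (L.loop-tips u u∈ nz))

    -- The loop found first may sit at a vertex of degree 4 or more, which cannot be a leaf of T.
    -- Starting again from this loop leaves no slack, so the next step reaches a fresh vertex, from
    -- which `iterFresh` finds a loop at a vertex of degree 3.
    goodLoop : GoodLoop
    goodLoop with findLoop
    ... | o , ℓ with deg Γ o ≟ℕ 3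
    ...   | yes d = o , ℓ , d
    ...   | no nd = go (Tight.step reach-start tt tl o∈ out≥2)
      where
      open Start ℓ
      d4 : 4 ≤ deg Γ o
      d4 = ℕ.≤∧≢⇒< (loop-deg≥3 D≥1 ℓ) (nd ∘ sym)
      out≥2 : 2 ≤ out L.S′ o
      out≥2 = ℕ.+-cancelʳ-≤ 2 2 _ (subst (4 ≤_) (sym out-start) d4)
      tl : Tipless L.S′
      tl u u∈ e with only-o u u∈ (λ z → 1≢0 e z)
      ... | refl = 2≰1 (subst (2 ≤_) e out≥2)
      go : StepOut Trivial D L.S′ o → GoodLoop
      go (saved₁ s) = ⊥-elim (absurd-reach lower (Saved₁.reach s))
      go (saved₂ s) = ⊥-elim (absurd-reach lower (Saved₂.reach s))
      go (fresh F) = iterFresh _ ℕ.≤-refl F.reach F.tipless F.w∈ F.w≥2 F.w-deg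
        where module F = FreshOut F
      -- Two loops at o exhaust the graph, which then has too few cycles.
      go (loop ℓ′ disj) with 3 ≤? out L.S′ o
      ... | yes k = ⊥-elim (absurd-reach lower (M.loop-reach 1 reach-start (M.Φ₂ k)))
        where module M = AddLoop ℓ′ {L.S′} o∈ disj
      ... | no nk = ⊥-elim (2≰1 (ℕ.≤-pred (subst (3 ≤_) D≡2 D≥3)))
        where
        module M = AddLoop ℓ′ {L.S′} o∈ disj
        o2 : out L.S′ o ≡ 2
        o2 = ℕ.≤-antisym (ℕ.≤-pred (ℕ.≰⇒> nk)) out≥2
        all0 : ∀ v → v ∈ₛ M.S′ → out M.S′ v ≡ 0
        all0 v v∈ with out M.S′ v ≟ℕ 0
        ... | yes z = z
        ... | no nz with M.loop-tips v v∈ nz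
        ...   | _ , inj₁ refl = ℕ.+-cancelʳ-≡ 2 _ 0 (trans M.out-o o2)
        ...   | v∈L , inj₂ e with only-o v v∈L (λ z → nz (trans e z))
        ...     | refl = ℕ.+-cancelʳ-≡ 2 _ 0 (trans M.out-o o2)
        D≡2 : D ≡ 2
        D≡2 = trans (sym Θ-start) (trans (sym M.loop-Θ) (cong (_+ 2)
                (stuck⇒Θ (M.loop-reach 0 reach-start (M.Φ₁ out≥2)) all0)))

-- Signed pendant cycles have nullity 2

module Holonomy (Γ : SignedGraph) (con : Connected Γ) (deg≥2 : ∀ v → 2 ≤ deg Γ v) where
  open Looping Γ con deg≥2 public

  a : V → V → ℚ
  a = A Γ

  a-sq : ∀ {u v} → u ~ v → a u v *ℚ a u v ≡ 1ℚ
  a-sq {u} {v} p with σ Γ u v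
  ... | just ⊕ = refl
  ... | just ⊖ = refl

  row-pair : ∀ (x : V → ℚ) {v p q} → p ≢ q → (∀ j → v ~ j → j ≡ p ⊎ j ≡ q) →
    row x v ≡ a v p *ℚ x p +ℚ a v q *ℚ x q
  row-pair x {v} {p} {q} p≢q only = ΣQ.∑-pair p≢q λ j j≢p j≢q →
    trans (cong (_*ℚ x j) (A≡0 {v} {j} (λ v~j → [ j≢p , j≢q ]′ (only j v~j)))) (ℚ.*-zeroˡ (x j))

  *ℚ-nonzero : ∀ {p q} → p ≢ 0ℚ → q ≢ 0ℚ → p *ℚ q ≢ 0ℚ
  *ℚ-nonzero p≢0 q≢0 pq = q≢0 (*ℚ-≢0 p≢0 pq)

  -- The solution d of b c + a d = 0 for a = ±1, where a is its own inverse: one step of the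
  -- recursion along a path of vertices of degree 2.
  transfer : ℚ → ℚ → ℚ → ℚ
  transfer b a c = (-ℚ (b *ℚ c)) *ℚ a

  transfer-row : ∀ b {a} c → a *ℚ a ≡ 1ℚ → b *ℚ c +ℚ a *ℚ transfer b a c ≡ 0ℚ
  transfer-row b {a} c sq = trans
    (solve 3 (λ b a c → b :* c :+ a :* (:- (b :* c) :* a) := b :* c :+ (:- (b :* c)) :* (a :* a)) refl b a c)
    (trans (cong (λ t → b *ℚ c +ℚ (-ℚ (b *ℚ c)) *ℚ t) sq)
      (trans (cong (b *ℚ c +ℚ_) (ℚ.*-identityʳ _)) (ℚ.+-inverseʳ (b *ℚ c))))
    where open ℚ-Solver.+-*-Solver

  transfer-unique : ∀ b {a} c d → a *ℚ a ≡ 1ℚ → b *ℚ c +ℚ a *ℚ d ≡ 0ℚ → d ≡ transfer b a c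
  transfer-unique b {a} c d sq h = begin
    d                                              ≡⟨ sym (ℚ.*-identityˡ d) ⟩
    1ℚ *ℚ d                                        ≡⟨ cong (_*ℚ d) (sym sq) ⟩
    a *ℚ a *ℚ d                                    ≡⟨ solve 4 (λ b a c d → a :* a :* d := :- (b :* c) :* a :+ a :* (b :* c :+ a :* d)) refl b a c d ⟩
    transfer b a c +ℚ a *ℚ (b *ℚ c +ℚ a *ℚ d)       ≡⟨ cong (λ t → transfer b a c +ℚ a *ℚ t) h ⟩
    transfer b a c +ℚ a *ℚ 0ℚ                      ≡⟨ cong (transfer b a c +ℚ_) (ℚ.*-zeroʳ a) ⟩
    transfer b a c +ℚ 0ℚ                           ≡⟨ ℚ.+-identityʳ _ ⟩
    transfer b a c                                 ∎
    where
    open ≡-Reasoning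
    open ℚ-Solver.+-*-Solver

  transfer-zero : ∀ b a {c} → c ≡ 0ℚ → transfer b a c ≡ 0ℚ
  transfer-zero b a refl = trans (cong (λ t → (-ℚ t) *ℚ a) (ℚ.*-zeroʳ b)) (ℚ.*-zeroˡ a)

  neg-nonzero : ∀ {p} → p ≢ 0ℚ → -ℚ p ≢ 0ℚ
  neg-nonzero {p} p≢0 h = p≢0 (trans (sym (solve 1 (λ p → :- (:- p) := p) refl p)) (cong -ℚ_ h))
    where open ℚ-Solver.+-*-Solver

  transfer-nonzero : ∀ {b a c} → b ≢ 0ℚ → a ≢ 0ℚ → c ≢ 0ℚ → transfer b a c ≢ 0ℚ
  transfer-nonzero b≢0 a≢0 c≢0 = *ℚ-nonzero (neg-nonzero (*ℚ-nonzero b≢0 c≢0)) a≢0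

  transfer-linear : ∀ b a p q c d → transfer b a (p *ℚ c +ℚ q *ℚ d) ≡ p *ℚ transfer b a c +ℚ q *ℚ transfer b a d
  transfer-linear = solve 6 (λ b a p q c d → :- (b :* (p :* c :+ q :* d)) :* a := p :* (:- (b :* c) :* a) :+ q :* (:- (b :* d) :* a)) refl
    where open ℚ-Solver.+-*-Solver

  -- Along a path x_{k+1} = ± x_{k-1}, so even and odd positions are decoupled: e and z live on opposite ones.
  Parity : (e z : V → ℚ) → V → V → Set
  Parity e z s t = (e s ≢ 0ℚ × z s ≡ 0ℚ × e t ≡ 0ℚ × z t ≢ 0ℚ) ⊎ (e s ≡ 0ℚ × z s ≢ 0ℚ × e t ≢ 0ℚ × z t ≡ 0ℚ)

  -- The discrete Wronskian (Casoratian) of two solutions of the recursion. The symmetry of A and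
  -- the weighting by the edge make it constant along the path.
  wronskian : (e z : V → ℚ) → V → V → ℚ
  wronskian e z s t = a s t *ℚ (e s *ℚ z t +ℚ -ℚ (e t *ℚ z s))

  Spans : V → V → (e z : V → ℚ) → V → Set
  Spans o t₀ e z v = ∀ x → InKernel Γ x → x v ≡ x o *ℚ e v +ℚ x t₀ *ℚ z v

  record Solutions (o t₀ : V) (c : ℚ) (e z : V → ℚ) (s t : V) : Set where
    field
      parity : Parity e z s t
      wrons  : wronskian e z s t ≡ c
      span-s : Spans o t₀ e z s
      span-t : Spans o t₀ e z t

  update : (V → ℚ) → V → ℚ → V → ℚ
  update f u c v = if does (v ≟ u) then c else f v

  update-same : ∀ f u c → update f u c u ≡ c
  update-same f u c rewrite dec-true (u ≟ u) refl = refl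

  update-other : ∀ f {u v} c → v ≢ u → update f u c v ≡ f v
  update-other f {u} {v} c ne rewrite dec-false (v ≟ u) ne = refl

  Solutions-cong : ∀ {o t₀ c e z e′ z′ s t} → e s ≡ e′ s → e t ≡ e′ t → z s ≡ z′ s → z t ≡ z′ t →
    Solutions o t₀ c e z s t → Solutions o t₀ c e′ z′ s t
  Solutions-cong {o} {t₀} {c} {e} {z} {e′} {z′} {s} {t} es et zs zt sol = record
    { parity = par parity
    ; wrons = trans (sym (cong₂ (λ p q → a s t *ℚ (p +ℚ -ℚ q)) (cong₂ _*ℚ_ es zt) (cong₂ _*ℚ_ et zs))) wrons
    ; span-s = λ x k → trans (span-s x k) (cong₂ (λ p q → x o *ℚ p +ℚ x t₀ *ℚ q) es zs)
    ; span-t = λ x k → trans (span-t x k) (cong₂ (λ p q → x o *ℚ p +ℚ x t₀ *ℚ q) et zt) }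
    where
    open Solutions sol
    par : Parity e z s t → Parity e′ z′ s t
    par (inj₁ (p , q , r , w)) = inj₁ (p ∘ trans es , trans (sym zs) q , trans (sym et) r , w ∘ trans zt)
    par (inj₂ (p , q , r , w)) = inj₂ (trans (sym es) p , q ∘ trans zs , r ∘ trans et , trans (sym zt) w)

  Solutions-step : ∀ {o t₀ c e z s t u} → t ~ s → t ~ u → s ≢ u → (∀ j → t ~ j → j ≡ s ⊎ j ≡ u) →
    e u ≡ transfer (a t s) (a t u) (e s) → z u ≡ transfer (a t s) (a t u) (z s) →
    Solutions o t₀ c e z s t → Solutions o t₀ c e z t u
  Solutions-step {o} {t₀} {c} {e} {z} {s} {t} {u} t~s t~u s≢u only eu zu sol = record
    { parity = par parity ; wrons = wr ; span-s = span-t ; span-t = sp }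
    where
    open Solutions sol
    par : Parity e z s t → Parity e z t u
    par (inj₁ (p , q , r , w)) = inj₂ (r , w , (λ h → transfer-nonzero (A≢0 t~s) (A≢0 t~u) p (trans (sym eu) h)) , trans zu (transfer-zero (a t s) (a t u) q))
    par (inj₂ (p , q , r , w)) = inj₁ (r , w , trans eu (transfer-zero (a t s) (a t u) p) , (λ h → transfer-nonzero (A≢0 t~s) (A≢0 t~u) q (trans (sym zu) h)))
    sp : Spans o t₀ e z u
    sp x k = trans (transfer-unique (a t s) {a t u} (x s) (x u) (a-sq t~u) (trans (sym (row-pair x s≢u only)) (k t)))
      (trans (cong (transfer (a t s) (a t u)) (span-s x k))
        (trans (transfer-linear (a t s) (a t u) (x o) (x t₀) (e s) (z s))
          (cong₂ (λ p q → x o *ℚ p +ℚ x t₀ *ℚ q) (sym eu) (sym zu))))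
    wr : wronskian e z t u ≡ c
    wr = begin
      a t u *ℚ (e t *ℚ z u +ℚ -ℚ (e u *ℚ z t))
        ≡⟨ cong₂ (λ p q → a t u *ℚ (e t *ℚ p +ℚ -ℚ (q *ℚ z t))) zu eu ⟩
      a t u *ℚ (e t *ℚ transfer (a t s) (a t u) (z s) +ℚ -ℚ (transfer (a t s) (a t u) (e s) *ℚ z t))
        ≡⟨ solve 6 (λ α β es zs et zt → α :* (et :* (:- (β :* zs) :* α) :+ :- (:- (β :* es) :* α :* zt))
             := (α :* α) :* (β :* (es :* zt :+ :- (et :* zs)))) refl (a t u) (a t s) (e s) (z s) (e t) (z t) ⟩
      (a t u *ℚ a t u) *ℚ (a t s *ℚ (e s *ℚ z t +ℚ -ℚ (e t *ℚ z s)))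
        ≡⟨ cong₂ (λ p q → p *ℚ (q *ℚ (e s *ℚ z t +ℚ -ℚ (e t *ℚ z s)))) (a-sq t~u) (A-sym Γ t s) ⟩
      1ℚ *ℚ wronskian e z s t
        ≡⟨ ℚ.*-identityˡ _ ⟩
      wronskian e z s t
        ≡⟨ wrons ⟩
      c ∎
      where
      open ≡-Reasoning
      open ℚ-Solver.+-*-Solver

  record Descent (o t₀ : V) (c : ℚ) (e z : V → ℚ) (t : V) (ws : List V) : Set where
    field
      e′ z′ : V → ℚ
      agree : ∀ v → v ∉ ws → e′ v ≡ e v × z′ v ≡ z v
      p     : V
      b~p   : bottom t ws ~ p
      p≢o   : p ≢ o
      sols  : Solutions o t₀ c e′ z′ p (bottom t ws)
      rows  : ∀ v → v ∈ (t ∷ ws) → v ≢ bottom t ws → row e′ v ≡ 0ℚ × row z′ v ≡ 0ℚ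

  -- The values of `e` and `z` are propagated by the kernel equations of all path vertices but the
  -- last. `s ∉ ws` ensures that later updates do not overwrite values already used. The equations
  -- at the last vertex and at `o` remain as closing conditions.
  descend : ∀ ws {o t₀ c s t} → Chain o (t ∷ ws) → t ~ s → s ≢ prev o ws → s ∉ ws → (e z : V → ℚ) →
    Solutions o t₀ c e z s t → Descent o t₀ c e z t ws
  descend [] {s = s} ch t~s ne s∉ e z sol = record
    { e′ = e ; z′ = z ; agree = λ _ _ → refl , refl ; p = s ; b~p = t~s ; p≢o = ne ; sols = sol
    ; rows = λ { v (here refl) v≢ → ⊥-elim (v≢ refl) } }
  descend (u ∷ ws) {o} {t₀} {c} {s} {t} ch@(next ch′ u~t _ t≢o t∉) t~s ne s∉ e z sol = record
    { e′ = R.e′ ; z′ = R.z′ ; agree = agree ; p = R.p ; b~p = R.b~p ; p≢o = R.p≢o ; sols = R.sols ; rows = rows }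
    where
    t~u : t ~ u
    t~u = ~-sym u~t
    only : ∀ j → t ~ j → j ≡ s ⊎ j ≡ u
    only = head-nbrs ch t~s ne
    val : ℚ → ℚ
    val = transfer (a t s) (a t u)
    e₁ z₁ : V → ℚ
    e₁ = update e u (val (e s))
    z₁ = update z u (val (z s))
    t≢u : t ≢ u
    t≢u = ~⇒≢ t~u
    sol₁ : Solutions o t₀ c e₁ z₁ t u
    sol₁ = Solutions-step t~s t~u ne only
      (trans (update-same e u _) (cong val (sym (update-other e _ ne))))
      (trans (update-same z u _) (cong val (sym (update-other z _ ne))))
      (Solutions-cong (sym (update-other e _ ne)) (sym (update-other e _ t≢u))
        (sym (update-other z _ ne)) (sym (update-other z _ t≢u)) sol)
    u∉ : u ∉ ws
    u∉ = chain-head∉ ch′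
    module R = Descent (descend ws ch′ u~t (head≢prev t≢o t∉) (λ t∈ → t∉ (there t∈)) e₁ z₁ sol₁)
    agree : ∀ v → v ∉ (u ∷ ws) → R.e′ v ≡ e v × R.z′ v ≡ z v
    agree v v∉ = let p , q = R.agree v (λ v∈ → v∉ (there v∈)) ; v≢u = λ v≡u → v∉ (here v≡u) in
      trans p (update-other e _ v≢u) , trans q (update-other z _ v≢u)
    rows : ∀ v → v ∈ (t ∷ u ∷ ws) → v ≢ bottom u ws → row R.e′ v ≡ 0ℚ × row R.z′ v ≡ 0ℚ
    rows v (there v∈) v≢ = R.rows v v∈ v≢
    rows v (here refl) _ = row0 R.e′ e (proj₁ (agree s s∉)) (trans (proj₁ (R.agree u u∉)) (update-same e u _))
                         , row0 R.z′ z (proj₂ (agree s s∉)) (trans (proj₂ (R.agree u u∉)) (update-same z u _))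
      where
      row0 : ∀ f g → f s ≡ g s → f u ≡ val (g s) → row f t ≡ 0ℚ
      row0 f g fs fu = trans (row-pair f ne only)
        (trans (cong₂ (λ p q → a t s *ℚ p +ℚ a t u *ℚ q) fs fu) (transfer-row (a t s) {a t u} (g s) (a-sq t~u)))

  record CycleVectors {o} (ℓ : Loop o) : Set where
    field
      e z     : V → ℚ
      support : ∀ v → v ≢ o → v ∉ interior ℓ → e v ≡ 0ℚ × z v ≡ 0ℚ
      e-o     : e o ≡ 1ℚ
      z-o     : z o ≡ 0ℚ
      z-t     : z (Loop.t ℓ) ≡ 1ℚ
      rows    : ∀ v → v ∈ (o ∷ interior ℓ) → row e v ≡ 0ℚ × row z v ≡ 0ℚ

  module LoopKernel (lower : ∀ {b S} → Reach b S → suc D ≤ b) (D≥3 : 3 ≤ D) {o} (ℓ : Loop o) where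
    open Find lower D≥3
    open Start ℓ
    open LoopFacts ℓ

    -- Otherwise the loop would be determined by one coordinate instead of two, and the bound D + 1 would drop to D.
    not-det₁ : ∀ f → ¬ (∀ x → InKernel Γ x → x f ≡ 0ℚ → x o ≡ 0ℚ × x t ≡ 0ℚ)
    not-det₁ f h = absurd-reach lower {S = L.S′} record
      { fs = f ∷ [] ; root = o ; root∈ = o∈ ; det = det
      ; bound = ℕ.≤-pred (ℕ.≤-trans Φ-start (ℕ.≤-reflexive (trans (Φ-⟦⟧ o (deg≥2 o)) (ℕ.+-comm D 1)))) }
      where
      det : Det L.S′ (f ∷ [])
      det x k zs v v∈ with L.inv {v} v∈ | h x k (zs f (here refl))
      ... | inj₂ v∈ℓ | xo , xt = loop-det x (λ w _ → k w) xo xt v v∈ℓ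
      ... | inj₁ v∈o | xo , xt with ⟦⟧-inv {o} {v} v∈o
      ...   | refl = xo

    t≢o : t ≢ o
    t≢o = o∉ t (here refl)

    e₀ z₀ : V → ℚ
    e₀ = update (λ _ → 0ℚ) o 1ℚ
    z₀ = update (λ _ → 0ℚ) t 1ℚ

    e₀o : e₀ o ≡ 1ℚ
    e₀o = update-same (λ _ → 0ℚ) o 1ℚ
    e₀t : e₀ t ≡ 0ℚ
    e₀t = update-other (λ _ → 0ℚ) 1ℚ t≢o
    z₀t : z₀ t ≡ 1ℚ
    z₀t = update-same (λ _ → 0ℚ) t 1ℚ
    z₀o : z₀ o ≡ 0ℚ
    z₀o = update-other (λ _ → 0ℚ) 1ℚ (t≢o ∘ sym)

    sol₀ : Solutions o t (a o t) e₀ z₀ o t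
    sol₀ = record
      { parity = inj₁ ((λ h → 1ℚ≢0ℚ (trans (sym e₀o) h)) , z₀o , e₀t , (λ h → 1ℚ≢0ℚ (trans (sym z₀t) h)))
      ; wrons = trans (cong₂ (λ p q → a o t *ℚ (p +ℚ -ℚ q)) (cong₂ _*ℚ_ e₀o z₀t) (cong₂ _*ℚ_ e₀t z₀o)) (ℚ.*-identityʳ (a o t))
      ; span-s = λ x _ → sym (trans (cong₂ (λ p q → x o *ℚ p +ℚ x t *ℚ q) e₀o z₀o)
          (trans (cong₂ _+ℚ_ (ℚ.*-identityʳ (x o)) (ℚ.*-zeroʳ (x t))) (ℚ.+-identityʳ (x o))))
      ; span-t = λ x _ → sym (trans (cong₂ (λ p q → x o *ℚ p +ℚ x t *ℚ q) e₀t z₀t)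
          (trans (cong₂ _+ℚ_ (ℚ.*-zeroʳ (x o)) (ℚ.*-identityʳ (x t))) (ℚ.+-identityˡ (x t)))) }

    t∉ : t ∉ (u ∷ us)
    t∉ = chain-head∉ chain

    o∉us : o ∉ (u ∷ us)
    o∉us o∈ = o∉ o (there o∈) refl

    module R = Descent (descend (u ∷ us) chain close o≢u o∉us e₀ z₀ sol₀)

    b p : V
    b = last
    p = R.p

    b-nbrs : ∀ j → b ~ j → j ≡ p ⊎ j ≡ o
    b-nbrs = deg2-nbrs (deg2 b last∈) R.p≢o R.b~p (~-sym o~last)

    e′o : R.e′ o ≡ 1ℚ
    e′o = trans (proj₁ (R.agree o o∉us)) e₀o
    z′o : R.z′ o ≡ 0ℚ
    z′o = trans (proj₂ (R.agree o o∉us)) z₀o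
    e′t : R.e′ t ≡ 0ℚ
    e′t = trans (proj₁ (R.agree t t∉)) e₀t
    z′t : R.z′ t ≡ 1ℚ
    z′t = trans (proj₂ (R.agree t t∉)) z₀t

    support : ∀ v → v ≢ o → v ∉ interior ℓ → R.e′ v ≡ 0ℚ × R.z′ v ≡ 0ℚ
    support v v≢o v∉ =
      trans (proj₁ (R.agree v (λ v∈ → v∉ (there v∈)))) (update-other (λ _ → 0ℚ) 1ℚ v≢o) ,
      trans (proj₂ (R.agree v (λ v∈ → v∉ (there v∈)))) (update-other (λ _ → 0ℚ) 1ℚ (λ e → v∉ (here e)))

    row-o : ∀ f → (∀ v → v ≢ o → v ∉ interior ℓ → f v ≡ 0ℚ) → row f o ≡ a o t *ℚ f t +ℚ a o b *ℚ f b
    row-o f sup = ΣQ.∑-pair t≢last other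
      where
      other : ∀ j → j ≢ t → j ≢ b → a o j *ℚ f j ≡ 0ℚ
      other j j≢t j≢b with adj o j ≟ᵇ true
      ... | no np = trans (cong (_*ℚ f j) (A≡0 {o} {j} np)) (ℚ.*-zeroˡ (f j))
      ... | yes o~j = trans (cong (a o j *ℚ_) (sup j (~⇒≢ (~-sym o~j)) (λ j∈ → [ j≢t , j≢b ]′ (o-nbrs j j∈ o~j)))) (ℚ.*-zeroʳ (a o j))

    row-b : ∀ f → row f b ≡ a b p *ℚ f p +ℚ a b o *ℚ f o
    row-b f = row-pair f R.p≢o b-nbrs

    -- The row of `e′` at the last vertex `b`, using that `e′` is 1 at `o`: the obstruction to
    -- closing a cycle of even length.
    κ : ℚ
    κ = a b p *ℚ R.e′ p +ℚ a b o

    -- In a cycle of odd length the equation at `b` turns x(o) = 0 into x(t) = 0, so `o` alone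
    -- determines the loop. In even length with κ ≠ 0 that equation forces x(o) = 0, so `t` alone
    -- does. Both are excluded by `not-det₁`, and for κ = 0 the propagated vectors close up.
    cycleVectors : CycleVectors ℓ
    cycleVectors with Solutions.parity R.sols
    ... | inj₂ (ep , zp , _ , _) = ⊥-elim (not-det₁ o λ x k xo → xo ,
      *ℚ-≢0 (*ℚ-nonzero (A≢0 R.b~p) zp) (trans (eq x k xo) (trans (sym (row-b x)) (k b))))
      where
      eq : ∀ x → InKernel Γ x → x o ≡ 0ℚ → (a b p *ℚ R.z′ p) *ℚ x t ≡ a b p *ℚ x p +ℚ a b o *ℚ x o
      eq x k xo = sym (begin
        a b p *ℚ x p +ℚ a b o *ℚ x o
          ≡⟨ cong₂ (λ s r → a b p *ℚ s +ℚ a b o *ℚ r) (Solutions.span-s R.sols x k) xo ⟩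
        a b p *ℚ (x o *ℚ R.e′ p +ℚ x t *ℚ R.z′ p) +ℚ a b o *ℚ 0ℚ
          ≡⟨ cong₂ (λ s r → a b p *ℚ (s *ℚ R.e′ p +ℚ x t *ℚ R.z′ p) +ℚ r) xo (ℚ.*-zeroʳ (a b o)) ⟩
        a b p *ℚ (0ℚ *ℚ R.e′ p +ℚ x t *ℚ R.z′ p) +ℚ 0ℚ
          ≡⟨ trans (ℚ.+-identityʳ _) (cong (λ s → a b p *ℚ (s +ℚ x t *ℚ R.z′ p)) (ℚ.*-zeroˡ (R.e′ p))) ⟩
        a b p *ℚ (0ℚ +ℚ x t *ℚ R.z′ p)
          ≡⟨ trans (cong (a b p *ℚ_) (ℚ.+-identityˡ _)) (solve 3 (λ α β γ → α :* (β :* γ) := α :* γ :* β) refl (a b p) (x t) (R.z′ p)) ⟩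
        (a b p *ℚ R.z′ p) *ℚ x t ∎)
        where
        open ≡-Reasoning
        open ℚ-Solver.+-*-Solver
    ... | inj₁ (ep , zp , eb , zb) with κ ℚ.≟ 0ℚ
    ...   | no κ≢0 = ⊥-elim (not-det₁ t λ x k xt → *ℚ-≢0 κ≢0 (trans (eq x k) (trans (sym (row-b x)) (k b))) , xt)
      where
      eq : ∀ x → InKernel Γ x → κ *ℚ x o ≡ a b p *ℚ x p +ℚ a b o *ℚ x o
      eq x k = sym (begin
        a b p *ℚ x p +ℚ a b o *ℚ x o
          ≡⟨ cong (λ s → a b p *ℚ s +ℚ a b o *ℚ x o) (Solutions.span-s R.sols x k) ⟩
        a b p *ℚ (x o *ℚ R.e′ p +ℚ x t *ℚ R.z′ p) +ℚ a b o *ℚ x o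
          ≡⟨ cong (λ s → a b p *ℚ (x o *ℚ R.e′ p +ℚ s) +ℚ a b o *ℚ x o) (trans (cong (x t *ℚ_) zp) (ℚ.*-zeroʳ (x t))) ⟩
        a b p *ℚ (x o *ℚ R.e′ p +ℚ 0ℚ) +ℚ a b o *ℚ x o
          ≡⟨ cong (λ s → a b p *ℚ s +ℚ a b o *ℚ x o) (ℚ.+-identityʳ _) ⟩
        a b p *ℚ (x o *ℚ R.e′ p) +ℚ a b o *ℚ x o
          ≡⟨ solve 4 (λ α β γ δ → α :* (β :* γ) :+ δ :* β := (α :* γ :+ δ) :* β) refl (a b p) (x o) (R.e′ p) (a b o) ⟩
        κ *ℚ x o ∎)
        where
        open ≡-Reasoning
        open ℚ-Solver.+-*-Solver
    ...   | yes κ≡0 = record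
      { e = R.e′ ; z = R.z′ ; support = support ; e-o = e′o ; z-o = z′o ; z-t = z′t ; rows = rows }
      where
      open ≡-Reasoning
      open ℚ-Solver.+-*-Solver
      e-row-o : row R.e′ o ≡ 0ℚ
      e-row-o = trans (row-o R.e′ (λ v n m → proj₁ (support v n m)))
        (trans (cong₂ (λ s r → a o t *ℚ s +ℚ a o b *ℚ r) e′t eb) (trans (cong₂ _+ℚ_ (ℚ.*-zeroʳ (a o t)) (ℚ.*-zeroʳ (a o b))) refl))
      wr : a p b *ℚ (R.e′ p *ℚ R.z′ b) ≡ a o t
      wr = trans (sym (trans (cong (λ s → a p b *ℚ (R.e′ p *ℚ R.z′ b +ℚ -ℚ s)) (trans (cong (_*ℚ R.z′ p) eb) (ℚ.*-zeroˡ (R.z′ p))))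
             (cong (a p b *ℚ_) (ℚ.+-identityʳ _)))) (Solutions.wrons R.sols)
      -- Constancy of the Wronskian expresses the entry `a o t` through the values at the other end
      -- of the path; the row then becomes a multiple of κ, so one closing condition serves for both
      -- vectors.
      z-row-o : row R.z′ o ≡ 0ℚ
      z-row-o = begin
        row R.z′ o
          ≡⟨ row-o R.z′ (λ v n m → proj₂ (support v n m)) ⟩
        a o t *ℚ R.z′ t +ℚ a o b *ℚ R.z′ b
          ≡⟨ cong₂ (λ s r → s +ℚ r *ℚ R.z′ b) (trans (cong (a o t *ℚ_) z′t) (ℚ.*-identityʳ (a o t))) (A-sym Γ o b) ⟩
        a o t +ℚ a b o *ℚ R.z′ b
          ≡⟨ cong (_+ℚ a b o *ℚ R.z′ b) (trans (sym wr) (cong (_*ℚ (R.e′ p *ℚ R.z′ b)) (A-sym Γ p b))) ⟩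
        a b p *ℚ (R.e′ p *ℚ R.z′ b) +ℚ a b o *ℚ R.z′ b
          ≡⟨ solve 4 (λ α β γ δ → α :* (β :* γ) :+ δ :* γ := (α :* β :+ δ) :* γ) refl (a b p) (R.e′ p) (R.z′ b) (a b o) ⟩
        κ *ℚ R.z′ b
          ≡⟨ trans (cong (_*ℚ R.z′ b) κ≡0) (ℚ.*-zeroˡ (R.z′ b)) ⟩
        0ℚ ∎
      e-row-b : row R.e′ b ≡ 0ℚ
      e-row-b = trans (row-b R.e′) (trans (cong (a b p *ℚ R.e′ p +ℚ_) (trans (cong (a b o *ℚ_) e′o) (ℚ.*-identityʳ (a b o)))) κ≡0)
      z-row-b : row R.z′ b ≡ 0ℚ
      z-row-b = trans (row-b R.z′) (trans (cong₂ (λ s r → a b p *ℚ s +ℚ a b o *ℚ r) zp z′o)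
        (trans (cong₂ _+ℚ_ (ℚ.*-zeroʳ (a b p)) (ℚ.*-zeroʳ (a b o))) refl))
      rows : ∀ v → v ∈ (o ∷ interior ℓ) → row R.e′ v ≡ 0ℚ × row R.z′ v ≡ 0ℚ
      rows v (here refl) = e-row-o , z-row-o
      rows v (there v∈) with v ≟ b
      ... | yes refl = e-row-b , z-row-b
      ... | no v≢b = R.rows v v∈ v≢b

-- Exploring the whole graph

module Decomposing (Γ : SignedGraph) (con : Connected Γ) (deg≥2 : ∀ v → 2 ≤ deg Γ v) where
  open Holonomy Γ con deg≥2 public

  -- Each vertex is a leaf of the graph induced by itself and the earlier ones, so connectedness and
  -- the edge count follow by induction on the list.
  data TreeList : List V → Set where
    root : ∀ r → TreeList (r ∷ [])
    grow : ∀ {w t ts} → TreeList ts → w ∉ ts → t ∈ ts → w ~ t → (∀ u → u ∈ ts → w ~ u → u ≡ t) → TreeList (w ∷ ts)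

  anchor : GoodLoop → V
  anchor = proj₁

  loopOf : (g : GoodLoop) → Loop (anchor g)
  loopOf g = proj₁ (proj₂ g)

  inside : GoodLoop → List V
  inside g = interior (loopOf g)

  Apart : GoodLoop → GoodLoop → Set
  Apart g h = anchor g ≢ anchor h × (∀ v → v ∈ inside g → v ∉ inside h)

  record Base (S : Subset) (ts : List V) (ls : List GoodLoop) : Set where
    field
      tree       : TreeList ts
      cover      : ∀ v → v ∈ₛ S → v ∈ ts ⊎ ∃[ g ] (g ∈ ls × v ∈ inside g)
      ts⊆        : ∀ v → v ∈ ts → v ∈ₛ S
      inside⊆    : ∀ g → g ∈ ls → ∀ v → v ∈ inside g → v ∈ₛ S
      anchor∈    : ∀ g → g ∈ ls → anchor g ∈ ts
      inside∉ts  : ∀ g → g ∈ ls → ∀ v → v ∈ inside g → v ∉ ts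
      apart      : AllPairs Apart ls

    inside-out : ∀ g → g ∈ ls → ∀ v → v ∈ inside g → out S v ≡ 0
    inside-out g g∈ v v∈ = #-none (λ j → ≢true⇒false (λ h → let p , q = out-elim {S} h in
      [ (λ e → ∈∉⇒≢ {S} (ts⊆ _ (anchor∈ g g∈)) q (sym e)) , (λ j∈ → clash {S} (inside⊆ g g∈ j j∈) q) ]′
        (LoopFacts.nbrs (loopOf g) v j v∈ p)))

    in-tree : ∀ v → v ∈ₛ S → 1 ≤ out S v → v ∈ ts
    in-tree v v∈ k with cover v v∈
    ... | inj₁ v∈ts = v∈ts
    ... | inj₂ (g , g∈ , v∈g) = ⊥-elim (ℕ.1+n≰n (subst (1 ≤_) (inside-out g g∈ v v∈g) k))

  -- The equation says that the recorded loops are the only cycles closed so far. At the end Θ is 0,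
  -- and it yields c(Γ) loops.
  Inv : List GoodLoop → Subset → Set
  Inv ls S = (∃[ ts ] Base S ts ls) × Θ S + 2 * length ls ≡ 2 + D

  Inv-closed : ∀ ls → PClosed (Inv ls)
  Inv-closed ls {S} {w} {t} ((ts , B) , θ≡) a@(addOne w∉ t∈ w~t only) =
    (w ∷ ts , record
      { tree = grow tree (λ w∈ → clash {S} (ts⊆ w w∈) w∉) (in-tree t t∈ (out≥1 {S} (~-sym w~t) w∉)) w~t
                 (λ u u∈ w~u → only u w~u (ts⊆ u u∈))
      ; cover = cover′
      ; ts⊆ = λ { v (here refl) → add-self S w ; v (there v∈) → add-keep S w v (ts⊆ v v∈) }
      ; inside⊆ = λ g g∈ v v∈ → add-keep S w v (inside⊆ g g∈ v v∈)
      ; anchor∈ = λ g g∈ → there (anchor∈ g g∈)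
      ; inside∉ts = λ { g g∈ v v∈ (here refl) → clash {S} (inside⊆ g g∈ v v∈) w∉
                      ; g g∈ v v∈ (there v∈ts) → inside∉ts g g∈ v v∈ v∈ts }
      ; apart = apart }) ,
    trans (cong (_+ 2 * length ls) (Θ-add-one w∉ t∈ w~t only)) θ≡
    where
    open Base B
    cover′ : ∀ v → v ∈ₛ add S w → v ∈ (w ∷ ts) ⊎ ∃[ g ] (g ∈ ls × v ∈ inside g)
    cover′ v v∈ with add-inv {S} v∈
    ... | inj₂ e = inj₁ (here e)
    ... | inj₁ v∈S = [ (λ p → inj₁ (there p)) , inj₂ ]′ (cover v v∈S)

  -- The last field remembers, for every vertex still to be explored, the moment when it was reached.
  record State (S : Subset) (ls : List GoodLoop) : Set where
    field
      reach   : Reach (suc D) S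
      tipless : Tipless S
      inv     : Inv ls S
      history : ∀ v → v ∈ₛ S → 2 ≤ out S v →
                Σ Subset λ S₀ → Reach (suc D) S₀ × S₀ ⊆ₛ S × v ∈ₛ S₀ × deg Γ v ≡ suc (out S₀ v)

  record Decomposition : Set where
    field
      S    : Subset
      full : ∀ v → v ∈ₛ S
      ts   : List V
      ls   : List GoodLoop
      base : Base S ts ls
      count : 2 * length ls ≡ 2 + D

  module Decompose (lower : ∀ {b S} → Reach b S → suc D ≤ b) (D≥3 : 3 ≤ D) where
    open Find lower D≥3

    module Stepper ls = Tip lower {P = Inv ls} (λ {S} {w} {t} → Inv-closed ls {S} {w} {t}) {D} (ℕ.n≤1+n D)

    -- As the first loop sits at a vertex `o` of degree 3, out(o) is 1; the walk from this tip
    -- produces the first set without tips.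
    startState : Σ Subset λ S → State S (goodLoop ∷ [])
    startState = go goodLoop
      where
      go : ∀ g → Σ Subset λ S → State S (g ∷ [])
      go g@(o , ℓ , d3) = finish (Stepper.tipWalk (g ∷ []) reach-start inv₀ o∈ tip tips)
        where
        open Start ℓ
        tip : out L.S′ o ≡ 1
        tip = ℕ.+-cancelʳ-≡ 2 _ 1 (trans out-start d3)
        tips : TipsIn L.S′ (_≡ o)
        tips u u∈ e = only-o u u∈ (λ z → 1≢0 e z)
        base₀ : Base L.S′ (o ∷ []) (g ∷ [])
        base₀ = record
          { tree = root o
          ; cover = λ v v∈ → [ (λ v∈o → inj₁ (here (⟦⟧-inv {o} {v} v∈o))) , (λ v∈ℓ → inj₂ (g , here refl , v∈ℓ)) ]′ (L.inv {v} v∈)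
          ; ts⊆ = λ { v (here refl) → o∈ }
          ; inside⊆ = λ { g (here refl) v v∈ → L.int⊆ v v∈ }
          ; anchor∈ = λ { g (here refl) → here refl }
          ; inside∉ts = λ { g (here refl) v v∈ (here refl) → LoopFacts.o∉ ℓ v v∈ refl }
          ; apart = [] ∷ [] }
        inv₀ : Inv (g ∷ []) L.S′
        inv₀ = (o ∷ [] , base₀) , trans (cong (_+ 2) Θ-start) (ℕ.+-comm D 2)
        finish : (Σ (FreshOut (Inv (g ∷ [])) (suc D) L.S′) λ F → ∀ u → u ∈ₛ L.S′ → u ≢ o → out (FreshOut.S′ F) u ≡ out L.S′ u) ⊎ Saved₁ D →
          Σ Subset λ S → State S (g ∷ [])
        finish (inj₂ s) = ⊥-elim (absurd-reach lower (Saved₁.reach s))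
        finish (inj₁ (F , _)) = F.S′ , record { reach = F.reach ; tipless = F.tipless ; inv = F.p ; history = history }
          where
          module F = FreshOut F
          history : ∀ v → v ∈ₛ F.S′ → 2 ≤ out F.S′ v →
            Σ Subset λ S₀ → Reach (suc D) S₀ × S₀ ⊆ₛ F.S′ × v ∈ₛ S₀ × deg Γ v ≡ suc (out S₀ v)
          history v v∈ k with ∈-or-∉ L.S′ v
          ... | inj₁ v∈₀ = ⊥-elim (2≰1 (ℕ.≤-trans k (ℕ.≤-trans (out-mono {L.S′} {F.S′} v F.sub) small)))
            where
            small : out L.S′ v ≤ 1
            small with out L.S′ v ≟ℕ 0
            ... | yes z = ℕ.≤-trans (ℕ.≤-reflexive z) z≤n
            ... | no nz with only-o v v∈₀ nz
            ...   | refl = ℕ.≤-reflexive tip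
          ... | inj₂ v∉₀ with F.new v v∈ v∉₀
          ...   | inj₁ z = ⊥-elim (2≰1 (ℕ.≤-trans (subst (2 ≤_) z k) z≤n))
          ...   | inj₂ d = F.S′ , F.reach , (λ _ p → p) , v∈ , d

    module Extend {S ls} (st : State S ls) {v} (v∈ : v ∈ₛ S) (v≥2 : 2 ≤ out S v)
      (ℓ : Loop v) (disj : ∀ x → x ∈ interior ℓ → x ∉ₛ S) where
      open State st
      module L = AddLoop ℓ {S} v∈ disj

      v≡2 : out S v ≡ 2
      v≡2 with 3 ≤? out S v
      ... | yes k = ⊥-elim (absurd-reach lower (L.loop-reach 1 reach (L.Φ₂ k)))
      ... | no nk = ℕ.≤-antisym (ℕ.≤-pred (ℕ.≰⇒> nk)) v≥2

      -- Had v degree at least 4, closing the loop as soon as v was reached would have saved a coordinate.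
      deg3 : deg Γ v ≡ 3
      deg3 with history v v∈ v≥2
      ... | S₀ , r₀ , sub₀ , v∈₀ , d with 3 ≤? out S₀ v
      ...   | yes k = ⊥-elim (absurd-reach lower (L₀.loop-reach 1 r₀ (L₀.Φ₂ k)))
        where
        module L₀ = AddLoop ℓ {S₀} v∈₀ (λ x x∈ → ≢true⇒false (λ x∈₀ → clash {S} (sub₀ x x∈₀) (disj x x∈)))
      ...   | no nk = trans d (cong suc (ℕ.≤-antisym (ℕ.≤-pred (ℕ.≰⇒> nk)) (ℕ.≤-trans v≥2 (out-mono {S₀} {S} v sub₀))))

      g₀ : GoodLoop
      g₀ = v , ℓ , deg3

      v-zero : out L.S′ v ≡ 0
      v-zero = ℕ.+-cancelʳ-≡ 2 _ 0 (trans L.out-o v≡2)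

      tips : ∀ u → u ∈ₛ L.S′ → out L.S′ u ≢ 0 → u ∈ₛ S × out L.S′ u ≡ out S u
      tips u u∈ nz with L.loop-tips u u∈ nz
      ... | u∈S , inj₂ e = u∈S , e
      ... | _ , inj₁ refl = ⊥-elim (nz v-zero)

      inv′ : Inv (g₀ ∷ ls) L.S′
      inv′ with inv
      ... | (ts , B) , θ≡ = (ts , record
          { tree = tree
          ; cover = cover′
          ; ts⊆ = λ x x∈ → L.sub x (ts⊆ x x∈)
          ; inside⊆ = λ { g (here refl) x x∈ → L.int⊆ x x∈ ; g (there g∈) x x∈ → L.sub x (inside⊆ g g∈ x x∈) }
          ; anchor∈ = λ { g (here refl) → in-tree v v∈ (ℕ.≤-trans (s≤s z≤n) v≥2) ; g (there g∈) → anchor∈ g g∈ }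
          ; inside∉ts = λ { g (here refl) x x∈ x∈ts → clash {S} (ts⊆ x x∈ts) (disj x x∈)
                          ; g (there g∈) x x∈ x∈ts → inside∉ts g g∈ x x∈ x∈ts }
          ; apart = tabulateAll sep ∷ apart }) , count
        where
        open Base B
        cover′ : ∀ x → x ∈ₛ L.S′ → x ∈ ts ⊎ ∃[ g ] (g ∈ (g₀ ∷ ls) × x ∈ inside g)
        cover′ x x∈ with L.inv {x} x∈
        ... | inj₂ x∈ℓ = inj₂ (g₀ , here refl , x∈ℓ)
        ... | inj₁ x∈S with cover x x∈S
        ...   | inj₁ p = inj₁ p
        ...   | inj₂ (g , g∈ , q) = inj₂ (g , there g∈ , q)
        sep : ∀ {g} → g ∈ ls → Apart g₀ g
        sep {g} g∈ = anchors , λ x x∈ x∈g → clash {S} (inside⊆ g g∈ x x∈g) (disj x x∈)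
          where
          module F = LoopFacts (loopOf g)
          anchors : v ≢ anchor g
          -- A loop already present at `v` would supply two neighbours in `S` besides the two
          -- outside, against degree 3.
          anchors refl = ℕ.1+n≰n (ℕ.≤-trans (ℕ.+-monoˡ-≤ 2 v≥2)
            (ℕ.≤-trans (inn≥2 {S} F.t≢last (~-sym F.close) (inside⊆ g g∈ F.t (here refl)) F.o~last (inside⊆ g g∈ F.last F.last∈))
              (ℕ.≤-reflexive deg3)))
        count : Θ L.S′ + 2 * length (g₀ ∷ ls) ≡ 2 + D
        count = trans (cong (Θ L.S′ +_) (ℕ.*-suc 2 (length ls)))
          (trans (sym (ℕ.+-assoc (Θ L.S′) 2 _)) (trans (cong (_+ 2 * length ls) L.loop-Θ) θ≡))

      extended : State L.S′ (g₀ ∷ ls)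
      extended = record
        { reach = L.loop-reach 0 reach (L.Φ₁ v≥2)
        ; tipless = λ u u∈ e → let u∈S , same = tips u u∈ (λ z → 1≢0 e z) in
                      tipless u u∈S (trans (sym same) e)
        ; inv = inv′
        ; history = λ u u∈ k →
            let u∈S , same = tips u u∈ (λ z → ℕ.1+n≰n (ℕ.≤-trans (s≤s z≤n) (subst (2 ≤_) z k)))
                S₀ , r₀ , sub₀ , u∈₀ , d = history u u∈S (subst (2 ≤_) same k)
            in S₀ , r₀ , (λ x x∈ → L.sub x (sub₀ x x∈)) , u∈₀ , d }

    freshState : ∀ {S ls} → State S ls → (F : FreshOut (Inv ls) (suc D) S) → State (FreshOut.S′ F) ls
    freshState {S} {ls} st F = record { reach = F.reach ; tipless = F.tipless ; inv = F.p ; history = history′ }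
      where
      module F = FreshOut F
      open State st
      history′ : ∀ v → v ∈ₛ F.S′ → 2 ≤ out F.S′ v →
        Σ Subset λ S₀ → Reach (suc D) S₀ × S₀ ⊆ₛ F.S′ × v ∈ₛ S₀ × deg Γ v ≡ suc (out S₀ v)
      history′ v v∈ k with ∈-or-∉ S v
      ... | inj₁ v∈S = let S₀ , r₀ , sub₀ , v∈₀ , d = history v v∈S (ℕ.≤-trans k (out-mono {S} {F.S′} v F.sub)) in
        S₀ , r₀ , (λ x x∈ → F.sub x (sub₀ x x∈)) , v∈₀ , d
      ... | inj₂ v∉S with F.new v v∈ v∉S
      ...   | inj₁ z = ⊥-elim (2≰1 (ℕ.≤-trans (subst (2 ≤_) z k) z≤n))
      ...   | inj₂ d = F.S′ , F.reach , (λ _ p → p) , v∈ , d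

    run : ∀ m {S ls} → rest S < m → State S ls → Decomposition
    run (suc m) {S} {ls} (s≤s lt) st with boundary? S
    ... | inj₁ (v , w , v∈ , v~w , w∉) = go (Stepper.step ls reach inv tipless v∈ v≥2)
      where
      open State st
      v≥2 : 2 ≤ out S v
      v≥2 = ≢1⇒≥2 (out≥1 {S} v~w w∉) (tipless v v∈)
      go : StepOut (Inv ls) D S v → Decomposition
      go (saved₁ s) = ⊥-elim (absurd-reach lower (Saved₁.reach s))
      go (saved₂ s) = ⊥-elim (absurd-reach lower (Saved₂.reach s))
      go (fresh F) = run m (ℕ.<-≤-trans (rest-⊂ {S} {F.S′} F.sub F.w∉ F.w∈) lt) (freshState st F)
        where module F = FreshOut F
      go (loop ℓ disj) = run m (ℕ.<-≤-trans (rest-⊂ {S} {E.L.S′} E.L.sub (disj _ (here refl)) (E.L.int⊆ (Loop.t ℓ) (here refl))) lt) E.extended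
        where module E = Extend st v∈ v≥2 ℓ disj
    ... | inj₂ cl = record
      { S = S ; full = full ; ts = proj₁ (proj₁ inv) ; ls = ls ; base = proj₂ (proj₁ inv)
      ; count = trans (cong (_+ 2 * length ls) (sym Θ≡0)) (proj₂ inv) }
      where
      open State st
      full : ∀ v → v ∈ₛ S
      full = closed⇒full {S} con (Reach.root∈ reach) cl
      Θ≡0 : Θ S ≡ 0
      Θ≡0 = stuck⇒Θ {S = S} reach λ v v∈ → #-none (λ j → ≢true⇒false (λ h → let p , q = out-elim {S} h in
        clash {S} (cl v j v∈ p) q))

    decomposition : Decomposition
    decomposition = run _ ℕ.≤-refl (proj₂ startState)

-- Induced subgraphs

handshake : ∀ Γ → ∑ℕ (deg Γ) ≡ 2 * edgeCount Γ
handshake Γ = begin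
  ∑ℕ (λ i → ∑ℕ (λ j → [ adj i j ]))
    ≡⟨ ΣN.∑-cong (λ i → trans (ΣN.∑-cong (λ j → split i j)) (ΣN.∑-∙ (λ j → up i j) (λ j → down i j))) ⟩
  ∑ℕ (λ i → ∑ℕ (λ j → up i j) + ∑ℕ (λ j → down i j))
    ≡⟨ ΣN.∑-∙ (λ i → ∑ℕ (λ j → up i j)) (λ i → ∑ℕ (λ j → down i j)) ⟩
  edgeCount Γ + ∑ℕ (λ i → ∑ℕ (λ j → down i j))
    ≡⟨ cong (edgeCount Γ +_) (trans (ΣN.∑-swap down) (ΣN.∑-cong (λ j → ΣN.∑-cong (λ i → cong (λ b → [ does (j <? i) ∧ b ]) (adj-sym i j))))) ⟩
  edgeCount Γ + edgeCount Γ
    ≡⟨ cong (edgeCount Γ +_) (sym (ℕ.+-identityʳ _)) ⟩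
  2 * edgeCount Γ ∎
  where
  open ≡-Reasoning
  open Forcing Γ
  up down : V → V → ℕ
  up i j = [ does (i <? j) ∧ adj i j ]
  down i j = [ does (j <? i) ∧ adj i j ]
  split : ∀ i j → [ adj i j ] ≡ up i j + down i j
  split i j with Fin.<-cmp i j
  ... | tri< p _ q rewrite dec-true (i <? j) p | dec-false (j <? i) q = sym (ℕ.+-identityʳ _)
  ... | tri> p _ q rewrite dec-false (i <? j) p | dec-true (j <? i) q = refl
  ... | tri≈ p refl q rewrite dec-false (i <? i) p | ≢true⇒false (~-irrefl {i}) = refl

data Distinct {X : Set} : List X → Set where
  []  : Distinct []
  _∷_ : ∀ {x xs} → x ∉ xs → Distinct xs → Distinct (x ∷ xs)

lookup-inj : ∀ {X : Set} {xs : List X} → Distinct xs → ∀ i j → lookup xs i ≡ lookup xs j → i ≡ j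
lookup-inj (x∉ ∷ d) zero zero e = refl
lookup-inj {xs = _ ∷ xs} (x∉ ∷ d) zero (suc j) e = ⊥-elim (x∉ (subst (_∈ xs) (sym e) (∈-lookup j)))
lookup-inj {xs = _ ∷ xs} (x∉ ∷ d) (suc i) zero e = ⊥-elim (x∉ (subst (_∈ xs) e (∈-lookup i)))
lookup-inj (x∉ ∷ d) (suc i) (suc j) e = cong suc (lookup-inj d i j e)

position : ∀ {X : Set} {xs : List X} {x} → x ∈ xs → Σ (Fin (length xs)) λ i → lookup xs i ≡ x
position x∈ = index x∈ , sym (lookup-index x∈)

-- Taking the count itself as the size of the domain makes the enumeration of the leaves of T a
-- function on `Fin (leafCount T)` without transport.
enum : ∀ {n} (P : Fin n → Bool) → Fin (# P) → Fin n
enum {suc n} P k with P zero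
enum {suc n} P zero    | true  = zero
enum {suc n} P (suc k) | true  = suc (enum (λ i → P (suc i)) k)
enum {suc n} P k       | false = suc (enum (λ i → P (suc i)) k)

enum-sound : ∀ {n} (P : Fin n → Bool) k → P (enum P k) ≡ true
enum-sound {suc n} P k with P zero in eq
enum-sound {suc n} P zero    | true  = eq
enum-sound {suc n} P (suc k) | true  = enum-sound (λ i → P (suc i)) k
enum-sound {suc n} P k       | false = enum-sound (λ i → P (suc i)) k

enum-inj : ∀ {n} (P : Fin n → Bool) k l → enum P k ≡ enum P l → k ≡ l
enum-inj {suc n} P k l e with P zero
enum-inj {suc n} P zero    zero    e | true  = refl
enum-inj {suc n} P (suc k) (suc l) e | true  = cong suc (enum-inj (λ i → P (suc i)) k l (Fin.suc-injective e))
enum-inj {suc n} P k       l       e | false = enum-inj (λ i → P (suc i)) k l (Fin.suc-injective e)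

enum-complete : ∀ {n} (P : Fin n → Bool) i → P i ≡ true → ∃[ k ] (enum P k ≡ i)
enum-complete {suc n} P i p with P zero in eq
enum-complete {suc n} P zero    p | true  = zero , refl
enum-complete {suc n} P (suc i) p | true  = let k , q = enum-complete (λ i → P (suc i)) i p in suc k , cong suc q
enum-complete {suc n} P zero    p | false = ⊥-elim (true≢false (trans (sym p) eq))
enum-complete {suc n} P (suc i) p | false = let k , q = enum-complete (λ i → P (suc i)) i p in k , cong suc q

module Inducing (Γ : SignedGraph) where
  open Forcing Γ
  open import Data.List.Membership.DecPropositional (_≟_ {size Γ}) using (_∈?_)

  induced : List V → SignedGraph
  induced L = record
    { size = length L
    ; σ = λ i j → σ Γ (lookup L i) (lookup L j)
    ; sym = λ i j → SignedGraph.sym Γ (lookup L i) (lookup L j)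
    ; loopless = λ i → SignedGraph.loopless Γ (lookup L i) }

  member : List V → Subset
  member L v = does (v ∈? L)

  member-∈ : ∀ {L v} → v ∈ L → v ∈ₛ member L
  member-∈ {L} {v} v∈ = dec-true (v ∈? L) v∈

  member-inv : ∀ {L v} → v ∈ₛ member L → v ∈ L
  member-inv {L} {v} p with v ∈? L
  ... | yes q = q
  member-inv {L} {v} () | no _

  member-∉ : ∀ {L v} → v ∉ L → v ∉ₛ member L
  member-∉ {L} {v} v∉ = dec-false (v ∈? L) v∉

  induced-deg : ∀ {L} → Distinct L → ∀ i → deg (induced L) i ≡ inn (member L) (lookup L i)
  induced-deg {L} d i = sym (trans (ΣN.∑-reindex (lookup L) (lookup-inj d) off) (ΣN.∑-cong on))
    where
    u = lookup L i
    off : ∀ v → (∀ j → lookup L j ≢ v) → [ adj u v ∧ member L v ] ≡ 0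
    off v h rewrite member-∉ {L} {v} (λ v∈ → let j , e = position v∈ in h j e) with adj u v
    ... | true = refl
    ... | false = refl
    on : ∀ j → [ adj u (lookup L j) ∧ member L (lookup L j) ] ≡ [ adj u (lookup L j) ]
    on j rewrite member-∈ {L} (∈-lookup {xs = L} j) with adj u (lookup L j)
    ... | true = refl
    ... | false = refl

  induced-row : ∀ {L} → Distinct L → (x : V → ℚ) → (∀ v → v ∉ L → x v ≡ 0ℚ) → ∀ i →
    ∑ℚ (λ j → A (induced L) i j *ℚ x (lookup L j)) ≡ ∑ℚ (λ v → A Γ (lookup L i) v *ℚ x v)
  induced-row {L} d x sup i = sym (ΣQ.∑-reindex (lookup L) (lookup-inj d) λ v h →
    trans (cong (A Γ (lookup L i) v *ℚ_) (sup v (λ v∈ → let j , e = position v∈ in h j e))) (ℚ.*-zeroʳ (A Γ (lookup L i) v)))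

  Within : List V → V → V → Set
  Within L u v = u ∈ L × v ∈ L × u ~ v

  Within-sym : ∀ {L u v} → Within L u v → Within L v u
  Within-sym (p , q , r) = q , p , ~-sym r

  star-induced : ∀ {L} → Distinct L → ∀ {u v} → Star (Within L) u v → ∀ i j → lookup L i ≡ u → lookup L j ≡ v →
    Star (Adj (induced L)) i j
  star-induced d ε i j ei ej with lookup-inj d i j (trans ei (sym ej))
  ... | refl = ε
  star-induced {L} d (_◅_ {j = w} (u∈ , w∈ , u~w) rest) i j refl ej with position w∈
  ... | k , refl = ~⇒Adj u~w ◅ star-induced d rest k j refl ej

  induced-connected : ∀ {L} → Distinct L → ∀ r → (∀ v → v ∈ L → Star (Within L) v r) → Connected (induced L)
  induced-connected {L} d r h i j =
    star-induced d (h _ (∈-lookup i) ◅◅ reverse Within-sym (h _ (∈-lookup j))) i j refl refl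

cycle-nullity≤2 : ∀ C → IsCycle C → ∀ r (w : Fin 3 → Vecℚ (size C)) → (∀ i → InKernel C (w i)) → ¬ LinIndep w
cycle-nullity≤2 C cy@(_ , con , deg2) r w Kw li =
  2≰1 (ℕ.≤-pred (subst (λ t → 3 ≤ 1 + t) (cycle-Φ C cy r)
    (nullity≤ con (λ v → ℕ.≤-reflexive (sym (deg2 v))) ⟦ r ⟧ (r ∷ []) {r} (⟦⟧-self r) (Det-⟦⟧ r) 3 w Kw li)))
  where
  open Forcing C

-- From the exploration to the tree and its attached cycles

module Assembling (Γ : SignedGraph) (con : Connected Γ) (deg≥2 : ∀ v → 2 ≤ deg Γ v) where
  open Decomposing Γ con deg≥2
  open Inducing Γ

  chain-distinct : ∀ {o ws} → Chain o ws → Distinct ws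
  chain-distinct (one _ _) = (λ ()) ∷ []
  chain-distinct (next c _ _ _ w∉) = w∉ ∷ chain-distinct c

  chain-star : ∀ {o ws L} → Chain o ws → o ∈ L → (∀ v → v ∈ ws → v ∈ L) → ∀ v → v ∈ ws → Star (Within L) v o
  chain-star (one o~w _) o∈ sub v (here refl) = (sub v (here refl) , o∈ , ~-sym o~w) ◅ ε
  chain-star {L = L} (next {w} {t} c t~w _ _ _) o∈ sub v (here refl) =
    (sub v (here refl) , sub t (there (here refl)) , ~-sym t~w) ◅ chain-star c o∈ (λ x x∈ → sub x (there x∈)) t (here refl)
  chain-star (next c _ _ _ _) o∈ sub v (there v∈) = chain-star c o∈ (λ x x∈ → sub x (there x∈)) v v∈

  tree-distinct : ∀ {ts} → TreeList ts → Distinct ts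
  tree-distinct (root r) = (λ ()) ∷ []
  tree-distinct (grow T w∉ _ _ _) = w∉ ∷ tree-distinct T

  tree-root : ∀ {ts} → TreeList ts → V
  tree-root (root r) = r
  tree-root (grow T _ _ _ _) = tree-root T

  tree-star : ∀ {ts L} (T : TreeList ts) → (∀ v → v ∈ ts → v ∈ L) → ∀ v → v ∈ ts → Star (Within L) v (tree-root T)
  tree-star (root r) sub v (here refl) = ε
  tree-star (grow {w} {t} T w∉ t∈ w~t _) sub v (here refl) =
    (sub v (here refl) , sub t (there t∈) , w~t) ◅ tree-star T (λ x x∈ → sub x (there x∈)) t t∈
  tree-star (grow T _ _ _ _) sub v (there v∈) = tree-star T (λ x x∈ → sub x (there x∈)) v v∈

  -- The newest vertex has index 0, so the edge count unfolds into its row, which contains the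
  -- single edge to `t`, and the count of the smaller tree.
  tree-edges : ∀ {ts} → TreeList ts → edgeCount (induced ts) + 1 ≡ length ts
  tree-edges (root r) = refl
  tree-edges (grow {w} {t} {ts} T w∉ t∈ w~t only) =
    trans (cong (λ k → k + edgeCount (induced ts) + 1) one-edge) (cong suc (tree-edges T))
    where
    one-edge : ∑ℕ (λ j → [ adj w (lookup ts j) ]) ≡ 1
    one-edge with position t∈
    ... | k , e = #-single {P = λ j → adj w (lookup ts j)} {k} (subst (w ~_) (sym e) w~t)
      (λ i p → lookup-inj (tree-distinct T) i k (trans (only _ (∈-lookup i) p) (sym e)))

  tree-isTree : ∀ {ts} → TreeList ts → IsTree (induced ts)
  tree-isTree {ts} T =
    induced-connected (tree-distinct T) (tree-root T) (tree-star T (λ _ p → p)) ,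
    trans (cong (_∸ length ts) (tree-edges T)) (ℕ.n∸n≡0 (length ts))

  module CycleGraph {o} (ℓ : Loop o) where
    open LoopFacts ℓ

    cs : List V
    cs = o ∷ interior ℓ

    cs-distinct : Distinct cs
    cs-distinct = (λ o∈ → o∉ o o∈ refl) ∷ chain-distinct chain

    C : SignedGraph
    C = induced cs

    deg-o : inn (member cs) o ≡ 2
    deg-o = #-pair t≢last
      (inn-∧ {member cs} (~-sym close) (member-∈ {cs} (there (here refl))))
      (inn-∧ {member cs} o~last (member-∈ {cs} (there last∈)))
      λ i h → let p , q = ∧-true h in case-in i p (member-inv {cs} q)
      where
      case-in : ∀ i → o ~ i → i ∈ cs → i ≡ t ⊎ i ≡ last
      case-in i p (here refl) = ⊥-elim (~-irrefl p)
      case-in i p (there i∈) = o-nbrs i i∈ p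

    deg-int : ∀ w → w ∈ interior ℓ → inn (member cs) w ≡ 2
    deg-int w w∈ = trans (cong (_+ inn (member cs) w) (sym none)) (trans (out+inn (member cs) w) (deg2 w w∈))
      where
      none : out (member cs) w ≡ 0
      none = #-none (λ j → ≢true⇒false (λ h → let p , q = out-elim {member cs} h in
        clash {member cs} {j} (member-∈ {cs} ([ here , there ]′ (nbrs w j w∈ p))) q))

    isCycle : IsCycle C
    isCycle = s≤s (s≤s (s≤s z≤n)) ,
      induced-connected cs-distinct o (λ { v (here refl) → ε ; v (there v∈) → chain-star chain (here refl) (λ _ p → there p) v v∈ }) ,
      degrees
      where
      degrees : ∀ i → deg C i ≡ 2
      degrees i = trans (induced-deg cs-distinct i) (by-case (∈-lookup {xs = cs} i))
        where
        by-case : ∀ {v} → v ∈ cs → inn (member cs) v ≡ 2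
        by-case (here refl) = deg-o
        by-case (there v∈) = deg-int _ v∈

    hasNullity : CycleVectors ℓ → HasNullity C 2
    hasNullity cv = (vecs , kernel , indep) , cycle-nullity≤2 C isCycle zero
      where
      open CycleVectors cv
      vecs : Fin 2 → Vecℚ (size C)
      vecs zero j = e (lookup cs j)
      vecs (suc zero) j = z (lookup cs j)
      kernel : ∀ i → InKernel C (vecs i)
      kernel zero i = trans (induced-row cs-distinct e (λ v v∉ → proj₁ (support v (λ p → v∉ (here p)) (λ p → v∉ (there p)))) i)
        (proj₁ (rows _ (∈-lookup {xs = cs} i)))
      kernel (suc zero) i = trans (induced-row cs-distinct z (λ v v∉ → proj₂ (support v (λ p → v∉ (here p)) (λ p → v∉ (there p)))) i)
        (proj₂ (rows _ (∈-lookup {xs = cs} i)))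
      indep : LinIndep vecs
      indep c h = result
        where
        open ≡-Reasoning
        c₀ c₁ : ℚ
        c₀ = c zero
        c₁ = c (suc zero)
        c₀≡0 : c₀ ≡ 0ℚ
        c₀≡0 = begin
          c₀                                       ≡⟨ sym (ℚ.*-identityʳ c₀) ⟩
          c₀ *ℚ 1ℚ                                 ≡⟨ sym (ℚ.+-identityʳ _) ⟩
          c₀ *ℚ 1ℚ +ℚ 0ℚ                           ≡⟨ cong (c₀ *ℚ 1ℚ +ℚ_) (sym (trans (ℚ.+-identityʳ _) (ℚ.*-zeroʳ c₁))) ⟩
          c₀ *ℚ 1ℚ +ℚ (c₁ *ℚ 0ℚ +ℚ 0ℚ)             ≡⟨ cong₂ (λ p q → c₀ *ℚ p +ℚ (c₁ *ℚ q +ℚ 0ℚ)) (sym e-o) (sym z-o) ⟩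
          c₀ *ℚ e o +ℚ (c₁ *ℚ z o +ℚ 0ℚ)           ≡⟨ h zero ⟩
          0ℚ                                       ∎
        c₁≡0 : c₁ ≡ 0ℚ
        c₁≡0 = begin
          c₁                                       ≡⟨ sym (trans (ℚ.+-identityʳ _) (ℚ.*-identityʳ c₁)) ⟩
          c₁ *ℚ 1ℚ +ℚ 0ℚ                           ≡⟨ sym (ℚ.+-identityˡ _) ⟩
          0ℚ +ℚ (c₁ *ℚ 1ℚ +ℚ 0ℚ)                   ≡⟨ cong₂ (λ p q → p +ℚ (c₁ *ℚ q +ℚ 0ℚ)) (sym (trans (cong (_*ℚ e t) c₀≡0) (ℚ.*-zeroˡ (e t)))) (sym z-t) ⟩
          c₀ *ℚ e t +ℚ (c₁ *ℚ z t +ℚ 0ℚ)           ≡⟨ h (suc zero) ⟩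
          0ℚ                                       ∎
        result : ∀ i → c i ≡ 0ℚ
        result zero = c₀≡0
        result (suc zero) = c₁≡0

  apart-or-same : ∀ {ls} → AllPairs Apart ls → ∀ {g h} → g ∈ ls → h ∈ ls → g ≡ h ⊎ Apart g h ⊎ Apart h g
  apart-or-same (a ∷ ap) (here refl) (here refl) = inj₁ refl
  apart-or-same (a ∷ ap) (here refl) (there h∈) = inj₂ (inj₁ (lookupAll a h∈))
  apart-or-same (a ∷ ap) (there g∈) (here refl) = inj₂ (inj₂ (lookupAll a g∈))
  apart-or-same (a ∷ ap) (there g∈) (there h∈) = apart-or-same ap g∈ h∈

  apart-distinct : ∀ {ls} → AllPairs Apart ls → Distinct ls
  apart-distinct [] = []
  apart-distinct (a ∷ ap) = (λ g∈ → proj₁ (lookupAll a g∈) refl) ∷ apart-distinct ap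

  module Assemble (Dec : Decomposition) (vectors : ∀ {o} (ℓ : Loop o) → CycleVectors ℓ) where
    open Decomposition Dec
    open Base base

    T : SignedGraph
    T = induced ts

    ts-distinct : Distinct ts
    ts-distinct = tree-distinct tree

    same-anchor : ∀ {g h} → g ∈ ls → h ∈ ls → anchor g ≡ anchor h → g ≡ h
    same-anchor g∈ h∈ e with apart-or-same apart g∈ h∈
    ... | inj₁ p = p
    ... | inj₂ (inj₁ (ne , _)) = ⊥-elim (ne e)
    ... | inj₂ (inj₂ (ne , _)) = ⊥-elim (ne (sym e))

    shared-vertex : ∀ {g h} → g ∈ ls → h ∈ ls → ∀ v → v ∈ inside g → v ∈ inside h → g ≡ h
    shared-vertex g∈ h∈ v v∈g v∈h with apart-or-same apart g∈ h∈
    ... | inj₁ p = p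
    ... | inj₂ (inj₁ (_ , dj)) = ⊥-elim (dj v v∈g v∈h)
    ... | inj₂ (inj₂ (_ , dj)) = ⊥-elim (dj v v∈h v∈g)

    -- The interior of a loop touches the rest of the graph only at its anchor, so this is the only
    -- place where an edge can leave the tree.
    outside : ∀ {v j} → v ∈ ts → v ~ j → j ∉ ts → ∃[ g ] (g ∈ ls × j ∈ inside g × v ≡ anchor g)
    outside {v} {j} v∈ v~j j∉ with cover j (full j)
    ... | inj₁ j∈ = ⊥-elim (j∉ j∈)
    ... | inj₂ (g , g∈ , j∈g) with LoopFacts.nbrs (loopOf g) j v j∈g (~-sym v~j)
    ...   | inj₁ e = g , g∈ , j∈g , e
    ...   | inj₂ v∈g = ⊥-elim (inside∉ts g g∈ v v∈g v∈)

    member-∉-inv : ∀ {v} → v ∉ₛ member ts → v ∉ ts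
    member-∉-inv {v} p v∈ = clash {member ts} {v} (member-∈ {ts} {v} v∈) p

    -- Two of the three edges at the anchor enter its own loop, and anchors of different loops are
    -- different; one edge is left for the tree.
    anchor-deg : ∀ g → g ∈ ls → inn (member ts) (anchor g) ≡ 1
    anchor-deg g g∈ = ℕ.+-cancelˡ-≡ 2 _ 1 (trans (cong (_+ inn (member ts) (anchor g)) (sym two))
        (trans (out+inn (member ts) (anchor g)) (proj₂ (proj₂ g))))
      where
      open LoopFacts (loopOf g)
      two : out (member ts) (anchor g) ≡ 2
      two = #-pair t≢last
        (out-∧ {member ts} (~-sym close) (member-∉ {ts} (inside∉ts g g∈ t (here refl))))
        (out-∧ {member ts} o~last (member-∉ {ts} (inside∉ts g g∈ last last∈)))
        λ i h → only i (out-elim {member ts} h)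
        where
        only : ∀ i → anchor g ~ i × i ∉ₛ member ts → i ≡ t ⊎ i ≡ last
        only i (p , q) with outside (anchor∈ g g∈) p (member-∉-inv q)
        ... | h , h∈ , i∈h , e with same-anchor g∈ h∈ e
        ...   | refl = o-nbrs i i∈h p

    -- Γ has no vertex of degree 1, so some edge at a leaf of T leaves T, and it can only lead into
    -- a loop anchored there.
    leaf-anchor : ∀ v → v ∈ ts → inn (member ts) v ≡ 1 → ∃[ g ] (g ∈ ls × anchor g ≡ v)
    leaf-anchor v v∈ d with out (member ts) v in eq
    ... | zero = ⊥-elim (2≰1 (subst (2 ≤_) (trans (sym (out+inn (member ts) v)) (trans (cong (_+ inn (member ts) v) eq) d)) (deg≥2 v)))
    ... | suc k = let j , p , q = out-witness {member ts} (subst (1 ≤_) (sym eq) (s≤s z≤n))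
                      g , g∈ , _ , e = outside v∈ p (member-∉-inv q)
                  in g , g∈ , sym e

    isLeaf : Fin (size T) → Bool
    isLeaf i = does (deg T i ≟ℕ 1)

    isLeaf-deg : ∀ i → isLeaf i ≡ true → deg T i ≡ 1
    isLeaf-deg i p = [ (λ e → e) , (λ ne → ⊥-elim (true≢false (trans (sym p) (dec-false (deg T i ≟ℕ 1) ne)))) ]′
      (toSum (deg T i ≟ℕ 1))

    leaf : Fin (leafCount T) → Fin (size T)
    leaf = enum isLeaf

    φ : Fin (size T) → V
    φ = lookup ts

    leaf-deg : ∀ i → deg T (leaf i) ≡ 1
    leaf-deg i = isLeaf-deg (leaf i) (enum-sound isLeaf i)

    loopAt : ∀ i → ∃[ g ] (g ∈ ls × anchor g ≡ φ (leaf i))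
    loopAt i = leaf-anchor (φ (leaf i)) (∈-lookup (leaf i)) (trans (sym (induced-deg ts-distinct (leaf i))) (leaf-deg i))

    gl : Fin (leafCount T) → GoodLoop
    gl i = proj₁ (loopAt i)

    gl∈ : ∀ i → gl i ∈ ls
    gl∈ i = proj₁ (proj₂ (loopAt i))

    gl-anchor : ∀ i → anchor (gl i) ≡ φ (leaf i)
    gl-anchor i = proj₂ (proj₂ (loopAt i))

    gl-inj : ∀ i j → gl i ≡ gl j → i ≡ j
    gl-inj i j e = enum-inj isLeaf i j (lookup-inj ts-distinct _ _
      (trans (sym (gl-anchor i)) (trans (cong anchor e) (gl-anchor j))))

    leafOf : ∀ g → g ∈ ls → ∃[ i ] (gl i ≡ g)
    leafOf g g∈ with position (anchor∈ g g∈)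
    ... | k , e with enum-complete isLeaf k (dec-true (deg T k ≟ℕ 1)
                       (trans (induced-deg ts-distinct k) (trans (cong (inn (member ts)) e) (anchor-deg g g∈))))
    ...   | i , q = i , same-anchor (gl∈ i) g∈ (trans (gl-anchor i) (trans (cong φ q) e))

    leafCount≡ : leafCount T ≡ length ls
    leafCount≡ = ℕ.≤-antisym (Fin.injective⇒≤ {f = f} f-inj) (Fin.injective⇒≤ {f = h} h-inj)
      where
      f : Fin (leafCount T) → Fin (length ls)
      f i = proj₁ (position (gl∈ i))
      f-eq : ∀ i → lookup ls (f i) ≡ gl i
      f-eq i = proj₂ (position (gl∈ i))
      f-inj : ∀ {i j} → f i ≡ f j → i ≡ j
      f-inj {i} {j} e = gl-inj i j (trans (sym (f-eq i)) (trans (cong (lookup ls) e) (f-eq j)))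
      h : Fin (length ls) → Fin (leafCount T)
      h k = proj₁ (leafOf (lookup ls k) (∈-lookup k))
      h-eq : ∀ k → gl (h k) ≡ lookup ls k
      h-eq k = proj₂ (leafOf (lookup ls k) (∈-lookup k))
      h-inj : ∀ {k l} → h k ≡ h l → k ≡ l
      h-inj {k} {l} e = lookup-inj (apart-distinct apart) k l (trans (sym (h-eq k)) (trans (cong gl e) (h-eq l)))

    module CG g = CycleGraph (loopOf g)

    cycleList : GoodLoop → List V
    cycleList g = anchor g ∷ inside g

    ψ : ∀ i → Fin (size (CG.C (gl i))) → V
    ψ i = lookup (cycleList (gl i))

    TC-disj : ∀ i a b → ψ i a ≡ φ b → a ≡ zero
    TC-disj i zero b e = refl
    TC-disj i (suc a) b e = ⊥-elim (inside∉ts (gl i) (gl∈ i) _ (∈-lookup {xs = inside (gl i)} a) (subst (_∈ ts) (sym e) (∈-lookup b)))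

    CC-disj : ∀ i j a b → ψ i a ≡ ψ j b → i ≡ j
    CC-disj i j zero zero e = gl-inj i j (same-anchor (gl∈ i) (gl∈ j) e)
    CC-disj i j zero (suc b) e =
      ⊥-elim (inside∉ts (gl j) (gl∈ j) _ (subst (_∈ inside (gl j)) (sym e) (∈-lookup {xs = inside (gl j)} b)) (anchor∈ (gl i) (gl∈ i)))
    CC-disj i j (suc a) zero e =
      ⊥-elim (inside∉ts (gl i) (gl∈ i) _ (subst (_∈ inside (gl i)) e (∈-lookup {xs = inside (gl i)} a)) (anchor∈ (gl j) (gl∈ j)))
    CC-disj i j (suc a) (suc b) e = gl-inj i j (shared-vertex (gl∈ i) (gl∈ j) _ (∈-lookup {xs = inside (gl i)} a)
      (subst (_∈ inside (gl j)) (sym e) (∈-lookup {xs = inside (gl j)} b)))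

    in-cycle : ∀ i {g} → gl i ≡ g → ∀ {v} → v ∈ cycleList g → ∃[ a ] (ψ i a ≡ v)
    in-cycle i e {v} v∈ = position (subst (λ h → v ∈ cycleList h) (sym e) v∈)

    cover-all : ∀ v → (∃[ a ] (φ a ≡ v)) ⊎ (∃[ i ] ∃[ a ] (ψ i a ≡ v))
    cover-all v with cover v (full v)
    ... | inj₁ v∈ = inj₁ (position v∈)
    ... | inj₂ (g , g∈ , v∈g) = let i , e = leafOf g g∈ in inj₂ (i , in-cycle i e (there v∈g))

    EdgeSource : V → V → Sign → Set
    EdgeSource u v s = (∃[ a ] ∃[ b ] (φ a ≡ u × φ b ≡ v × σ T a b ≡ just s)) ⊎
      (∃[ i ] ∃[ a ] ∃[ b ] (ψ i a ≡ u × ψ i b ≡ v × σ (CG.C (gl i)) a b ≡ just s))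

    cycle-edge : ∀ {u v s} g → g ∈ ls → u ∈ cycleList g → v ∈ cycleList g → σ Γ u v ≡ just s → EdgeSource u v s
    cycle-edge g g∈ u∈ v∈ e =
      let i , p = leafOf g g∈
          a , q = in-cycle i p u∈
          b , r = in-cycle i p v∈
      in inj₂ (i , a , b , q , r , trans (cong₂ (σ Γ) q r) e)

    edge-source : ∀ u v s → σ Γ u v ≡ just s → EdgeSource u v s
    edge-source u v s e with cover u (full u) | cover v (full v)
    ... | inj₂ (g , g∈ , u∈g) | _ = cycle-edge g g∈ (there u∈g) ([ here , there ]′ (LoopFacts.nbrs (loopOf g) u v u∈g (cong is-just e))) e
    ... | inj₁ _ | inj₂ (g , g∈ , v∈g) = cycle-edge g g∈ ([ here , there ]′ (LoopFacts.nbrs (loopOf g) v u v∈g (~-sym {u} {v} (cong is-just e)))) (there v∈g) e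
    ... | inj₁ u∈ | inj₁ v∈ =
      let a , q = position u∈
          b , r = position v∈
      in inj₁ (a , b , q , r , trans (cong₂ (σ Γ) q r) e)

    edge-target : ∀ u v s → EdgeSource u v s → σ Γ u v ≡ just s
    edge-target u v s (inj₁ (a , b , refl , refl , e)) = e
    edge-target u v s (inj₂ (i , a , b , refl , refl , e)) = e

    assembled : TreeWithNullity2Cycles Γ
    assembled = record
      { T = T
      ; isTree = tree-isTree tree
      ; leaf = leaf
      ; leaf-inj = enum-inj isLeaf
      ; leaf-deg = leaf-deg
      ; C = λ i → CG.C (gl i)
      ; C-cycle = λ i → CG.isCycle (gl i)
      ; C-null = λ i → CG.hasNullity (gl i) (vectors (loopOf (gl i)))
      ; att = λ i → zero
      ; φ = φ
      ; φ-inj = lookup-inj ts-distinct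
      ; ψ = ψ
      ; ψ-inj = λ i → lookup-inj (CG.cs-distinct (gl i))
      ; glue = gl-anchor
      ; TC-disj = TC-disj
      ; CC-disj = CC-disj
      ; cover = cover-all
      ; edges = λ u v s → mk⇔ (edge-source u v s) (edge-target u v s) }

-- The numerical hypotheses and the equivalence

module LeafFree (Γ : SignedGraph) (con : Connected Γ) (leafless : leafCount Γ ≡ 0) (c≥3 : 3 ≤ cyc Γ) where
  open Forcing Γ

  c : ℕ
  c = cyc Γ

  edges≡ : edgeCount Γ + 1 ≡ size Γ + c
  edges≡ = sym (ℕ.m+[n∸m]≡n (ℕ.<⇒≤ (ℕ.m∸n≢0⇒n<m {edgeCount Γ + 1} {size Γ} (λ e → ℕ.1+n≰n (ℕ.≤-trans (s≤s z≤n) (subst (3 ≤_) e c≥3))))))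

  deg≢1 : ∀ v → deg Γ v ≢ 1
  deg≢1 v d = ℕ.1+n≰n (subst₂ _≤_ (cong [_] (dec-true (deg Γ v ≟ℕ 1) d)) leafless
    (∑ℕ-lower (λ i → [ does (deg Γ i ≟ℕ 1) ]) v))

  -- By connectedness an isolated vertex would be the only one, leaving no edges, so that `cyc Γ`
  -- would be at most 1.
  deg≢0 : ∀ v → deg Γ v ≢ 0
  deg≢0 v d = 2≰1 (ℕ.≤-trans (ℕ.≤-trans (ℕ.n≤1+n 2) c≥3) (ℕ.≤-trans (ℕ.≤-reflexive (cong (λ k → k + 1 ∸ size Γ) no-edges)) (ℕ.m∸n≤m 1 (size Γ))))
    where
    isolated : ∀ u → u ≡ v
    isolated u with con v u
    ... | ε = refl
    ... | e ◅ _ = ⊥-elim (ℕ.1+n≰n (subst (1 ≤_) d (#-≥1 {P = adj v} _ (Adj⇒~ e))))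
    no-edges : edgeCount Γ ≡ 0
    no-edges = ℕ.*-cancelˡ-≡ (edgeCount Γ) 0 2 (trans (sym (handshake Γ)) (ΣN.∑-unit (λ u → trans (cong (deg Γ) (isolated u)) d)))

  deg≥2 : ∀ v → 2 ≤ deg Γ v
  deg≥2 v = ≢1⇒≥2 (≢0⇒≥1 (deg≢0 v)) (deg≢1 v)

  open Assembling Γ con deg≥2
  open Decomposing Γ con deg≥2 using (D; Reach; module Reach; module Decompose; module LoopKernel; Decomposition; module Decomposition; Loop; CycleVectors)

  -- The handshake lemma turns D into 2|E| - 2|V|, which is 2c - 2 for a connected graph.
  excess : 2 + D ≡ 2 * c
  excess = ℕ.+-cancelˡ-≡ (2 * size Γ) _ _ (begin
    2 * size Γ + (2 + D)                ≡⟨ rearrange (2 * size Γ) D ⟩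
    D + 2 * size Γ + 2                  ≡⟨ cong (_+ 2) total ⟩
    2 * edgeCount Γ + 2 * 1             ≡⟨ sym (ℕ.*-distribˡ-+ 2 (edgeCount Γ) 1) ⟩
    2 * (edgeCount Γ + 1)               ≡⟨ cong (2 *_) edges≡ ⟩
    2 * (size Γ + c)                    ≡⟨ ℕ.*-distribˡ-+ 2 (size Γ) c ⟩
    2 * size Γ + 2 * c                  ∎)
    where
    open ≡-Reasoning
    rearrange : ∀ m d → m + (2 + d) ≡ d + m + 2
    rearrange m d = trans (cong (m +_) (ℕ.+-comm 2 d)) (trans (sym (ℕ.+-assoc m d 2)) (cong (_+ 2) (ℕ.+-comm m d)))
    ∑-const : ∀ n → ∑ℕ {n} (λ _ → 2) ≡ 2 * n
    ∑-const zero = refl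
    ∑-const (suc n) = trans (cong (2 +_) (∑-const n)) (sym (ℕ.*-suc 2 n))
    total : D + 2 * size Γ ≡ 2 * edgeCount Γ
    total = trans (cong (D +_) (sym (∑-const (size Γ))))
      (trans (sym (ΣN.∑-∙ (λ v → deg Γ v ∸ 2) (λ _ → 2)))
        (trans (ΣN.∑-cong (λ v → ℕ.m∸n+n≡m (deg≥2 v))) (handshake Γ)))

  D≥3 : 3 ≤ D
  D≥3 = ℕ.+-cancelˡ-≤ 2 3 D (subst (5 ≤_) (sym excess) (ℕ.≤-trans (ℕ.n≤1+n 5) (ℕ.*-monoʳ-≤ 2 c≥3)))

  2c∸1≡ : 2 * c ∸ 1 ≡ suc D
  2c∸1≡ = cong (_∸ 1) (sym excess)

  c+c∸1≡ : c + (c ∸ 1) ≡ 2 * c ∸ 1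
  c+c∸1≡ = trans (sym (ℕ.+-∸-assoc c (ℕ.≤-trans (s≤s z≤n) c≥3))) (cong (λ k → c + k ∸ 1) (sym (ℕ.+-identityʳ c)))

  -- The exploration says nothing about η(T). It is recovered afterwards from η(Γ) = η(T) + p(T),
  -- with p(T) = c.
  assemble : HasNullity Γ (2 * c ∸ 1) → Decomposition → (∀ {o} (ℓ : Loop o) → CycleVectors ℓ) → ObtainedFromTree Γ
  assemble hn dec vectors = W , q≡c , hT
    where
    module As = Assemble dec vectors
    W : TreeWithNullity2Cycles Γ
    W = As.assembled
    q≡c : leafCount As.T ≡ c
    q≡c = trans As.leafCount≡ (ℕ.*-cancelˡ-≡ _ c 2 (trans (Decomposition.count dec) excess))
    hT : HasNullity As.T (leafCount As.T ∸ 1)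
    hT = Attached.nullity-Γ⇒T W (subst (HasNullity Γ) (sym (trans (cong (λ k → k + (k ∸ 1)) q≡c) c+c∸1≡)) hn)

  nullity⇒structure : HasNullity Γ (2 * c ∸ 1) → ObtainedFromTree Γ
  nullity⇒structure hn@((w , Kw , li) , _) =
    assemble hn (Decompose.decomposition lower D≥3) (LoopKernel.cycleVectors lower D≥3)
    where
    -- The given D + 1 independent kernel vectors bound every certified `b` from below.
    lower : ∀ {b S} → Reach b S → suc D ≤ b
    lower {b} {S} r = ℕ.≤-trans (ℕ.≤-reflexive (sym 2c∸1≡))
      (ℕ.≤-trans (nullity≤ con deg≥2 S (Reach.fs r) {Reach.root r} (Reach.root∈ r) (Reach.det r) _ w Kw li) (Reach.bound r))

  structure⇒nullity : ObtainedFromTree Γ → HasNullity Γ (2 * c ∸ 1)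
  structure⇒nullity (W , q≡c , hT) =
    subst (HasNullity Γ) (trans (cong (λ k → k + (k ∸ 1)) q≡c) c+c∸1≡) (Attached.nullity-T⇒Γ W hT)

theorem5p3 : (Γ : SignedGraph) → Connected Γ → leafCount Γ ≡ 0 → 3 ≤ cyc Γ →
    HasNullity Γ (2 * cyc Γ ∸ 1) ⇔ ObtainedFromTree Γ
theorem5p3 Γ con leafless c≥3 = mk⇔ nullity⇒structure structure⇒nullity
  where open LeafFree Γ con leafless c≥3
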